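{- Let $n \geq 2$ and $r \geq 1$ be integers. There exists a number $L_r(n)$ such that for every prime power $q > L_r(n)$ with $r \mid q^n - 1$, the extension $\mathbb{F}_{q^n}/\mathbb{F}_q$ possesses the line property for $r$-primitive elements. That is, for every $\alpha \in \mathbb{F}_{q^n}^*$ and every $\theta \in \mathbb{F}_{q^n}$ with $\mathbb{F}_{q^n} = \mathbb{F}_q(\theta)$, there exists $x \in \mathbb{F}_q$ such that $\alpha(\theta + x)$ has multiplicative order $(q^n-1)/r$. Moreover, there exists a number $T_r(n) \leq L_r(n)$ such that for every prime power $q > T_r(n)$ with $r \mid q^n - 1$, the extension $\mathbb{F}_{q^n}/\mathbb{F}_q$ possesses the translate property for $r$-primitive elements. That is, for every $\theta \in \mathbb{F}_{q^n}$ with $\mathbb{F}_{q^n} = \mathbb{F}_q(\theta)$, there exists $x \in \mathbb{F}_q$ such that $\theta + x$ has multiplicative order $(q^n-1)/r$.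
   Context: $\mathbb{F}_q$ denotes the finite field with $q$ elements and $\mathbb{F}_{q^n}$ its extension of degree $n$. For $r \mid q^n-1$, an element of $\mathbb{F}_{q^n}^*$ is called $r$-primitive if its multiplicative order is $(q^n-1)/r$. An element $\theta \in \mathbb{F}_{q^n}$ is a generator of the extension if $\mathbb{F}_{q^n} = \mathbb{F}_q(\theta)$. For a generator $\theta$ and $\alpha \in \mathbb{F}_{q^n}^*$, the line of $\alpha$ and $\theta$ is the set $\{\alpha(\theta + x) : x \in \mathbb{F}_q\}$. The set of translates of $\theta$ is the line with $\alpha = 1$. The extension has the line property (respectively, the translate property) for $r$-primitive elements if every line (respectively, every set of translates) contains an $r$-primitive element. -}

module Defs where

open import Level using (0ℓ)
open import Algebra.Bundles using (CommutativeRing)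
open import Data.Nat as ℕ using (ℕ; zero; suc; _≤_; NonZero)
open import Data.Nat.DivMod using (_/_)
open import Data.List using (List; length; filter)
open import Data.List.Relation.Unary.Any using (Any)
open import Data.List.Relation.Unary.AllPairs using (AllPairs)
open import Data.Product using (Σ; ∃; _×_)
open import Relation.Nullary using (¬_; Dec)
open import Relation.Unary using (Pred)
import Relation.Unary as U
import Relation.Binary as B

record FiniteField : Set₁ where
  field
    commRing : CommutativeRing 0ℓ 0ℓ
  open CommutativeRing commRing public
  field
    _≟_      : B.Decidable _≈_
    1≉0      : ¬ (1# ≈ 0#)
    inverse  : ∀ x → ¬ (x ≈ 0#) → ∃ λ y → (x * y) ≈ 1#
    elems    : List Carrier
    complete : ∀ x → Any (x ≈_) elems
    distinct : AllPairs (λ a b → ¬ (a ≈ b)) elems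

  card : ℕ
  card = length elems

  infixr 8 _^_
  _^_ : Carrier → ℕ → Carrier
  x ^ zero  = 1#
  x ^ suc m = x * (x ^ m)

  HasOrder : Carrier → ℕ → Set
  HasOrder x m =
    (1 ≤ m) × ((x ^ m) ≈ 1#) × (∀ k → 1 ≤ k → (x ^ k) ≈ 1# → m ≤ k)

  record IsSubfield (P : Pred Carrier 0ℓ) : Set where
    field
      resp   : ∀ {x y} → x ≈ y → P x → P y
      has0   : P 0#
      has1   : P 1#
      closed+ : ∀ {x y} → P x → P y → P (x + y)
      closed* : ∀ {x y} → P x → P y → P (x * y)
      closed- : ∀ {x} → P x → P (- x)
      closed⁻¹ : ∀ {x y} → P x → (x * y) ≈ 1# → P y

open FiniteField public using (Carrier; _≈_; 0#; 1#; _+_; _*_; -_; elems; card; HasOrder; IsSubfield)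

record Subfield (K : FiniteField) : Set₁ where
  field
    mem    : Pred (Carrier K) 0ℓ
    mem?   : U.Decidable mem
    isSubfield : IsSubfield K mem

  size : ℕ
  size = length (filter mem? (elems K))

open Subfield public

Generates : (K : FiniteField) → Subfield K → Carrier K → Set₁
Generates K F θ =
  (Q : Pred (Carrier K) 0ℓ) → IsSubfield K Q →
  (∀ x → mem F x → Q x) → Q θ → ∀ y → Q y

IsRPrimitive : (K : FiniteField) (r : ℕ) → .{{NonZero r}} → Carrier K → Set
IsRPrimitive K r α = HasOrder K α ((card K ℕ.∸ 1) / r)

LineProperty : (K : FiniteField) → Subfield K → (r : ℕ) → .{{NonZero r}} → Set₁
LineProperty K F r =
  ∀ (α : Carrier K) → ¬ (_≈_ K α (0# K)) →
  ∀ (θ : Carrier K) → Generates K F θ →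
  Σ (Carrier K) λ x → mem F x × IsRPrimitive K r (_*_ K α (_+_ K θ x))

TranslateProperty : (K : FiniteField) → Subfield K → (r : ℕ) → .{{NonZero r}} → Set₁
TranslateProperty K F r =
  ∀ (θ : Carrier K) → Generates K F θ →
  Σ (Carrier K) λ x → mem F x × IsRPrimitive K r (_+_ K θ x)

-- For d dividing q^n - 1 let N_d be the number of x in F for which α(θ + x) has trivial ((q^n - 1)/d)-th power. An
-- inclusion-exclusion sieve over the primes dividing (q^n - 1)/r reduces the claim to N_d = q/d + O(q^(1 - ε)), uniformly
-- in d and α, since q^n - 1 has only q^o(1) squarefree divisors.
--
-- If d is large, the products of n factors α(θ + x), one from each of n disjoint blocks of solutions, are distinct (θ has
-- degree n, and two monic polynomials of degree n differ by one of smaller degree) and have trivial ((q^n - 1)/d)-th power,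
-- so N_d = O(q d^(-1/n)).
--
-- If d is small, Stepanov's method bounds the solutions in each coset of the d-th powers. With e = (q^n - 1)/d written in
-- base q, (θ + x)^e = ∏ (θ^(q^i) + x)^(e_i) for x in F. The conjugates of θ are distinct and the leading digit is close to
-- q/d, so the powers of this product have well separated orders of vanishing at a single conjugate; this makes
-- the auxiliary polynomial nonzero without any irreducibility argument. Since the cosets cover F, the upper bounds
-- for all of them yield the lower bound for each.
module Submission where

open import Algebra.Bundles using (CommutativeRing)
import Algebra.Properties.CommutativeSemiring.Exp
open import Data.Empty using (⊥-elim; ⊥)
open import Data.Fin as Fin using (Fin)
import Data.Fin.Properties as Fin
open import Data.List using (List; []; _∷_; length; map; filter; lookup; applyUpTo; tabulate; upTo)
open import Data.List.Membership.Propositional using () renaming (_∈_ to _∈ˡ_)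
open import Data.List.Membership.Propositional.Properties using (∈-lookup; ∈-upTo⁺)
import Data.List.Membership.Propositional.Properties as ∈ˡ
open import Data.List.Membership.Setoid.Properties using (∈-filter⁺)
import Data.List.Properties as List
open import Data.List.Relation.Unary.All as All using (All; []; _∷_)
import Data.List.Relation.Unary.All.Properties as All
open import Data.List.Relation.Unary.AllPairs as AllPairs using (AllPairs; []; _∷_)
import Data.List.Relation.Unary.AllPairs.Properties as AllPairs
open import Data.List.Relation.Unary.Any as Any using (Any; here; there)
import Data.List.Relation.Unary.Any.Properties as Any
open import Data.List.Relation.Unary.Unique.Propositional.Properties using (upTo⁺)
open import Data.Nat as ℕ using (ℕ; zero; suc; _≤_; _<_; s≤s; z≤n; NonZero; >-nonZero)
open import Data.Nat.Coprimality using (Coprime; coprime-divisor; coprime-Bézout)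
open import Data.Nat.DivMod using (_/_; _%_; m≡m%n+[m/n]*n; m%n<n; /-monoˡ-≤; m*n/n≡m; m<n*o⇒m/o<n; m%n≤n; m/n*n≤m)
open import Data.Nat.Divisibility using (_∣_; divides; _∣?_; ∣-trans; ∣⇒≤; *-monoʳ-∣; m∣m*n; ∣1⇒≡1; 1∣_; ∣n⇒∣m*n)
open import Data.Nat.GCD using (module Bézout; module GCD)
open import Data.Nat.ListAction using (product)
open import Data.Nat.ListAction.Properties using (∈⇒∣product)
open import Data.Nat.Primality using (Prime; prime?; prime⇒irreducible; prime⇒nonTrivial)
open import Data.Nat.Primality.Factorisation using (factorise; module PrimeFactorisation)
import Data.Nat.Properties as ℕ
open import Data.Nat.Tactic.RingSolver using (solve-∀)
open import Data.Product using (_,_; Σ; _×_; proj₁; proj₂; ∃)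
open import Data.Sum using (_⊎_; inj₁; inj₂)
open import Data.Unit using (⊤; tt)
open import Defs using (FiniteField; Subfield; Generates; LineProperty; TranslateProperty)
open import Function using (id; _∘_)
open import Level using (0ℓ)
open import Relation.Binary.PropositionalEquality as ≡ using (_≡_; _≗_; _≢_)
import Relation.Binary.Reasoning.Setoid
open import Relation.Nullary using (¬_; yes; no; ¬?)
open import Relation.Nullary.Decidable using (_×-dec_)
open import Relation.Unary using (Decidable)

-- The usual route to such a result estimates character sums over lines by Weil's theorem. Against
-- q^o(1) divisors any fixed power saving in q suffices, which leaves room for elementary methods.
-- The unit of precision is t, the integer part of the 8n-th root of q, and the error aimed at is C
-- q / t with C = 3n + 2. The two ranges of d meet at t^n. Beyond it, q / d and q d^(-1/n) are both
-- at most q / t. Below it, Stepanov's method needs a parameter B with t d^3 ≤ B and B^2 ≤ q; as d ≤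
-- t^n, the choice B = t^(4n) works, whence the exponent 8n. Inequalities are cleared of
-- denominators and use sums in place of differences, so that they live in the natural numbers.
-- Additivity of the q-th power comes from counting roots instead of binomial coefficients modulo
-- the characteristic, and orders of vanishing are read off from power series, since derivatives
-- lose information in small characteristic.

-- Formal power series

module PowerSeries (R : CommutativeRing 0ℓ 0ℓ) where
  open CommutativeRing R
  open import Relation.Binary.Reasoning.Setoid setoid
  open import Algebra.Properties.CommutativeSemigroup +-commutativeSemigroup using () renaming (interchange to +-interchange)

  Series : Set
  Series = ℕ → Carrier

  infix 4 _≋_
  _≋_ : Series → Series → Set
  f ≋ g = ∀ n → f n ≈ g n

  tl : Series → Series
  tl f n = f (suc n)

  constant : Carrier → Series
  constant a zero    = a
  constant a (suc n) = 0#

  linear : Carrier → Carrier → Series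
  linear a b zero    = a
  linear a b (suc n) = constant b n

  infixl 6 _⊕_
  _⊕_ : Series → Series → Series
  (f ⊕ g) n = f n + g n

  infixl 7 _⊛_
  _⊛_ : Series → Series → Series
  (f ⊛ g) zero    = f 0 * g 0
  (f ⊛ g) (suc n) = f 0 * g (suc n) + (tl f ⊛ g) n

  ⊛-cong : ∀ {f f′ g g′} → f ≋ f′ → g ≋ g′ → f ⊛ g ≋ f′ ⊛ g′
  ⊛-cong p q zero    = *-cong (p 0) (q 0)
  ⊛-cong p q (suc n) = +-cong (*-cong (p 0) (q (suc n))) (⊛-cong (λ k → p (suc k)) q n)

  -- The product recurses on its left factor; this is the mirrored recursion, and commutativity
  -- follows by comparing the two.
  ⊛-suc : ∀ f g n → (f ⊛ g) (suc n) ≈ (f ⊛ tl g) n + f (suc n) * g 0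
  ⊛-suc f g zero    = refl
  ⊛-suc f g (suc n) = trans (+-congˡ (⊛-suc (tl f) g n)) (sym (+-assoc _ _ _))

  ⊛-comm : ∀ f g → f ⊛ g ≋ g ⊛ f
  ⊛-comm f g zero    = *-comm _ _
  ⊛-comm f g (suc n) = begin
    f 0 * g (suc n) + (tl f ⊛ g) n ≈⟨ +-cong (*-comm _ _) (⊛-comm (tl f) g n) ⟩
    g (suc n) * f 0 + (g ⊛ tl f) n ≈⟨ +-comm _ _ ⟩
    (g ⊛ tl f) n + g (suc n) * f 0 ≈⟨ ⊛-suc g f n ⟨
    (g ⊛ f) (suc n)                ∎

  ⊛-distribʳ : ∀ h f g → (f ⊕ g) ⊛ h ≋ f ⊛ h ⊕ g ⊛ h
  ⊛-distribʳ h f g zero    = distribʳ _ _ _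
  ⊛-distribʳ h f g (suc n) =
    trans (+-cong (distribʳ _ _ _) (⊛-distribʳ h (tl f) (tl g) n)) (+-interchange _ _ _ _)

  ⊛-scale : ∀ c f g n → ((λ k → c * f k) ⊛ g) n ≈ c * (f ⊛ g) n
  ⊛-scale c f g zero    = *-assoc _ _ _
  ⊛-scale c f g (suc n) = trans (+-cong (*-assoc _ _ _) (⊛-scale c (tl f) g n)) (sym (distribˡ _ _ _))

  ⊛-assoc : ∀ f g h → (f ⊛ g) ⊛ h ≋ f ⊛ (g ⊛ h)
  ⊛-assoc f g h zero    = *-assoc _ _ _
  ⊛-assoc f g h (suc n) = begin
    f 0 * g 0 * h (suc n) + (((λ k → f 0 * tl g k) ⊕ tl f ⊛ g) ⊛ h) n
      ≈⟨ +-cong (*-assoc _ _ _) (⊛-distribʳ h _ _ n) ⟩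
    f 0 * (g 0 * h (suc n)) + (((λ k → f 0 * tl g k) ⊛ h) n + ((tl f ⊛ g) ⊛ h) n)
      ≈⟨ +-congˡ (+-cong (⊛-scale _ _ h n) (⊛-assoc (tl f) g h n)) ⟩
    f 0 * (g 0 * h (suc n)) + (f 0 * (tl g ⊛ h) n + (tl f ⊛ (g ⊛ h)) n)
      ≈⟨ +-assoc _ _ _ ⟨
    f 0 * (g 0 * h (suc n)) + f 0 * (tl g ⊛ h) n + (tl f ⊛ (g ⊛ h)) n
      ≈⟨ +-congʳ (distribˡ _ _ _) ⟨
    f 0 * (g ⊛ h) (suc n) + (tl f ⊛ (g ⊛ h)) n ∎

  ⊛-zeroˡ : ∀ f → (λ _ → 0#) ⊛ f ≋ (λ _ → 0#)
  ⊛-zeroˡ f zero    = zeroˡ _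
  ⊛-zeroˡ f (suc n) = trans (+-cong (zeroˡ _) (⊛-zeroˡ f n)) (+-identityˡ _)

  constant-⊛ : ∀ a f n → (constant a ⊛ f) n ≈ a * f n
  constant-⊛ a f zero    = refl
  constant-⊛ a f (suc n) = trans (+-congˡ (⊛-zeroˡ f n)) (+-identityʳ _)

  ⊛-identityˡ : ∀ f → constant 1# ⊛ f ≋ f
  ⊛-identityˡ f n = trans (constant-⊛ 1# f n) (*-identityˡ _)

  seriesRing : CommutativeRing 0ℓ 0ℓ
  seriesRing = record
    { Carrier = Series ; _≈_ = _≋_ ; _+_ = _⊕_ ; _*_ = _⊛_ ; -_ = λ f n → - f n
    ; 0# = λ _ → 0# ; 1# = constant 1#
    ; isCommutativeRing = record
      { isRing = record
        { +-isAbelianGroup = record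
          { isGroup = record
            { isMonoid = record
              { isSemigroup = record
                { isMagma = record
                  { isEquivalence = record
                    { refl = λ n → refl ; sym = λ p n → sym (p n) ; trans = λ p q n → trans (p n) (q n) }
                  ; ∙-cong = λ p q n → +-cong (p n) (q n) }
                ; assoc = λ f g h n → +-assoc _ _ _ }
              ; identity = (λ f n → +-identityˡ _) , (λ f n → +-identityʳ _) }
            ; inverse = (λ f n → -‿inverseˡ _) , (λ f n → -‿inverseʳ _)
            ; ⁻¹-cong = λ p n → -‿cong (p n) }
          ; comm = λ f g n → +-comm _ _ }
        ; *-cong = λ {f} {f′} {g} {g′} → ⊛-cong {f} {f′} {g} {g′}
        ; *-assoc = ⊛-assoc
        ; *-identity = ⊛-identityˡ , λ f n → trans (⊛-comm f _ n) (⊛-identityˡ f n)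
        ; distrib = (λ h f g n → trans (⊛-comm h _ n) (trans (⊛-distribʳ h f g n) (+-cong (⊛-comm f h n) (⊛-comm g h n))))
                  , ⊛-distribʳ }
      ; *-comm = ⊛-comm } }

  constant-+ : ∀ a b → constant (a + b) ≋ constant a ⊕ constant b
  constant-+ a b zero    = refl
  constant-+ a b (suc n) = sym (+-identityʳ _)

  constant-* : ∀ a b → constant (a * b) ≋ constant a ⊛ constant b
  constant-* a b zero    = refl
  constant-* a b (suc n) = sym (trans (constant-⊛ a _ (suc n)) (zeroʳ _))

  infix 4 _≈[_]_
  -- Congruence modulo T^M. For the expansion of a polynomial at y + λT with λ nonzero, congruence
  -- to 0 means a zero of order at least M at y, in every characteristic.
  _≈[_]_ : Series → ℕ → Series → Set
  f ≈[ M ] g = ∀ m → m < M → f m ≈ g m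

  ⊛-cong[] : ∀ {M f f′ g g′} → f ≈[ M ] f′ → g ≈[ M ] g′ → f ⊛ g ≈[ M ] f′ ⊛ g′
  ⊛-cong[] p q zero    m<M = *-cong (p 0 m<M) (q 0 m<M)
  ⊛-cong[] {suc M} {f} {f′} p q (suc n) (s≤s m<M) =
    +-cong (*-cong (p 0 (s≤s z≤n)) (q (suc n) (s≤s m<M)))
      (⊛-cong[] {M} {tl f} {tl f′} (λ k k<M → p (suc k) (s≤s k<M)) (λ k k<M → q k (ℕ.m<n⇒m<1+n k<M)) n m<M)

-- Polynomials and their values in algebras

-- Polynomials over K are evaluated at elements of K and at power series over K; one interface
-- serves both.
record CommAlgebra (R : CommutativeRing 0ℓ 0ℓ) : Set₁ where
  private module R = CommutativeRing R
  field
    target : CommutativeRing 0ℓ 0ℓ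
  private module A = CommutativeRing target
  field
    ι      : R.Carrier → A.Carrier
    ι-cong : ∀ {a b} → a R.≈ b → ι a A.≈ ι b
    ι-0    : ι R.0# A.≈ A.0#
    ι-1    : ι R.1# A.≈ A.1#
    ι-+    : ∀ a b → ι (a R.+ b) A.≈ ι a A.+ ι b
    ι-*    : ∀ a b → ι (a R.* b) A.≈ ι a A.* ι b

module Polynomials (R : CommutativeRing 0ℓ 0ℓ) where
  private module R = CommutativeRing R
  open PowerSeries R using (seriesRing; constant; constant-+; constant-*)

  self : CommAlgebra R
  self = record { target = R ; ι = id ; ι-cong = id ; ι-0 = R.refl ; ι-1 = R.refl
                ; ι-+ = λ _ _ → R.refl ; ι-* = λ _ _ → R.refl }

  series : CommAlgebra R
  series = record { target = seriesRing ; ι = constant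
                  ; ι-cong = λ { p zero → p ; p (suc n) → R.refl }
                  ; ι-0 = λ { zero → R.refl ; (suc n) → R.refl } ; ι-1 = λ n → R.refl
                  ; ι-+ = constant-+ ; ι-* = constant-* }

  -- Coefficients start with the constant term. Trailing zeros are allowed, so degrees are bounded
  -- through lengths, and a polynomial is zero when all its entries are.
  Poly : Set
  Poly = List R.Carrier

  infixl 6 _+ₚ_
  _+ₚ_ : Poly → Poly → Poly
  []      +ₚ q       = q
  (a ∷ p) +ₚ []      = a ∷ p
  (a ∷ p) +ₚ (b ∷ q) = a R.+ b ∷ p +ₚ q

  scale : R.Carrier → Poly → Poly
  scale c []      = []
  scale c (a ∷ p) = c R.* a ∷ scale c p

  infixl 7 _*ₚ_
  _*ₚ_ : Poly → Poly → Poly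
  []      *ₚ q = []
  (a ∷ p) *ₚ q = scale a q +ₚ (R.0# ∷ p *ₚ q)

  length-+ₚ : ∀ {D} p q → length p ≤ D → length q ≤ D → length (p +ₚ q) ≤ D
  length-+ₚ []      q       _        v        = v
  length-+ₚ (a ∷ p) []      u        _        = u
  length-+ₚ (a ∷ p) (b ∷ q) (s≤s u) (s≤s v) = s≤s (length-+ₚ p q u v)

  length-scale : ∀ c p → length (scale c p) ≡ length p
  length-scale c []      = ≡.refl
  length-scale c (a ∷ p) = ≡.cong suc (length-scale c p)

  length-*ₚ : ∀ p q {D E} → length p ≤ suc D → length q ≤ suc E → length (p *ₚ q) ≤ suc (D ℕ.+ E)
  length-*ₚ []          q         _       _ = z≤n
  length-*ₚ (a ∷ [])    q {D} {E} _       v =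
    length-+ₚ (scale a q) (R.0# ∷ [])
      (ℕ.≤-trans (ℕ.≤-reflexive (length-scale a q)) (ℕ.≤-trans v (s≤s (ℕ.m≤n+m E D)))) (s≤s z≤n)
  length-*ₚ (a ∷ b ∷ p) q {suc D} {E} (s≤s u) v =
    length-+ₚ (scale a q) _
      (ℕ.≤-trans (ℕ.≤-reflexive (length-scale a q)) (ℕ.≤-trans v (s≤s (ℕ.m≤n+m E (suc D)))))
      (s≤s (length-*ₚ (b ∷ p) q u v))

  -- The quotient of a + X p by X - y, whatever a is.
  quotient : R.Carrier → Poly → Poly

  module Evaluation (A : CommAlgebra R) where
    open CommAlgebra A
    open CommutativeRing target
    open import Relation.Binary.Reasoning.Setoid setoid
    open import Algebra.Properties.CommutativeSemiring.Exp commutativeSemiring using (_^_)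
    open import Algebra.Solver.Ring.NaturalCoefficients.Default commutativeSemiring using (solve; _:=_; _:+_; _:*_)

    eval : Poly → Carrier → Carrier
    eval []      s = 0#
    eval (a ∷ p) s = ι a + s * eval p s

    eval-+ₚ : ∀ p q s → eval (p +ₚ q) s ≈ eval p s + eval q s
    eval-+ₚ []      q       s = sym (+-identityˡ _)
    eval-+ₚ (a ∷ p) []      s = sym (+-identityʳ _)
    eval-+ₚ (a ∷ p) (b ∷ q) s = begin
      ι (a R.+ b) + s * eval (p +ₚ q) s           ≈⟨ +-cong (ι-+ a b) (*-congˡ (eval-+ₚ p q s)) ⟩
      (ι a + ι b) + s * (eval p s + eval q s)     ≈⟨ solve 5 (λ x y z u v → (x :+ y) :+ z :* (u :+ v) := (x :+ z :* u) :+ (y :+ z :* v)) refl (ι a) (ι b) s (eval p s) (eval q s) ⟩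
      (ι a + s * eval p s) + (ι b + s * eval q s) ∎

    eval-scale : ∀ c p s → eval (scale c p) s ≈ ι c * eval p s
    eval-scale c []      s = sym (zeroʳ _)
    eval-scale c (a ∷ p) s = begin
      ι (c R.* a) + s * eval (scale c p) s ≈⟨ +-cong (ι-* c a) (*-congˡ (eval-scale c p s)) ⟩
      ι c * ι a + s * (ι c * eval p s)     ≈⟨ solve 4 (λ x y z u → x :* y :+ z :* (x :* u) := x :* (y :+ z :* u)) refl (ι c) (ι a) s (eval p s) ⟩
      ι c * (ι a + s * eval p s)           ∎

    eval-*ₚ : ∀ p q s → eval (p *ₚ q) s ≈ eval p s * eval q s
    eval-*ₚ []      q s = sym (zeroˡ _)
    eval-*ₚ (a ∷ p) q s = begin
      eval (scale a q +ₚ (R.0# ∷ p *ₚ q)) s              ≈⟨ eval-+ₚ (scale a q) _ s ⟩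
      eval (scale a q) s + (ι R.0# + s * eval (p *ₚ q) s) ≈⟨ +-cong (eval-scale a q s) (+-cong ι-0 (*-congˡ (eval-*ₚ p q s))) ⟩
      ι a * eval q s + (0# + s * (eval p s * eval q s))  ≈⟨ +-congˡ (+-identityˡ _) ⟩
      ι a * eval q s + s * (eval p s * eval q s)         ≈⟨ solve 4 (λ x y z u → x :* u :+ z :* (y :* u) := (x :+ z :* y) :* u) refl (ι a) (eval p s) s (eval q s) ⟩
      (ι a + s * eval p s) * eval q s                    ∎

    eval-zero : ∀ p s → All (R._≈ R.0#) p → eval p s ≈ 0#
    eval-zero []      s []      = refl
    eval-zero (a ∷ p) s (e ∷ z) = trans (+-cong (trans (ι-cong e) ι-0) (trans (*-congˡ (eval-zero p s z)) (zeroʳ s))) (+-identityʳ _)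

    -- Polynomial functions travel with a degree bound, so that degrees are computed by closure
    -- rules and polynomials need not be written out.
    IsPoly : ℕ → (Carrier → Carrier) → Set
    IsPoly D φ = Σ Poly λ p → length p ≤ suc D × (∀ s → φ s ≈ eval p s)

    poly-≤ : ∀ {D E φ} → D ≤ E → IsPoly D φ → IsPoly E φ
    poly-≤ D≤E (p , l , e) = p , ℕ.≤-trans l (s≤s D≤E) , e

    poly-resp : ∀ {D φ ψ} → (∀ s → ψ s ≈ φ s) → IsPoly D φ → IsPoly D ψ
    poly-resp h (p , l , e) = p , l , λ s → trans (h s) (e s)

    poly-ι : ∀ {D} a → IsPoly D (λ _ → ι a)
    poly-ι a = a ∷ [] , s≤s z≤n , λ s → sym (trans (+-congˡ (zeroʳ s)) (+-identityʳ _))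

    poly-0 : ∀ {D} → IsPoly D (λ _ → 0#)
    poly-0 = [] , z≤n , λ s → refl

    poly-id : ∀ {D} → IsPoly (suc D) (λ s → s)
    poly-id = R.0# ∷ R.1# ∷ [] , s≤s (s≤s z≤n) , λ s → sym (begin
      ι R.0# + s * (ι R.1# + s * 0#) ≈⟨ +-cong ι-0 (*-congˡ (+-cong ι-1 (zeroʳ s))) ⟩
      0# + s * (1# + 0#)             ≈⟨ +-identityˡ _ ⟩
      s * (1# + 0#)                  ≈⟨ *-congˡ (+-identityʳ _) ⟩
      s * 1#                         ≈⟨ *-identityʳ s ⟩
      s                              ∎)

    poly-+ : ∀ {D φ ψ} → IsPoly D φ → IsPoly D ψ → IsPoly D (λ s → φ s + ψ s)
    poly-+ (p , l , e) (q , m , f) =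
      p +ₚ q , length-+ₚ p q l m , λ s → trans (+-cong (e s) (f s)) (sym (eval-+ₚ p q s))

    poly-* : ∀ {D E φ ψ} → IsPoly D φ → IsPoly E ψ → IsPoly (D ℕ.+ E) (λ s → φ s * ψ s)
    poly-* (p , l , e) (q , m , f) =
      p *ₚ q , length-*ₚ p q l m , λ s → trans (*-cong (e s) (f s)) (sym (eval-*ₚ p q s))

    poly-^ : ∀ {D φ} k → IsPoly D φ → IsPoly (k ℕ.* D) (λ s → φ s ^ k)
    poly-^ zero    i = poly-resp (λ s → sym ι-1) (poly-ι R.1#)
    poly-^ (suc k) i = poly-* i (poly-^ k i)

  private module Self = Evaluation self

  quotient y []      = []
  quotient y (b ∷ p) = Self.eval (b ∷ p) y ∷ quotient y p

  length-quotient : ∀ y p → length (quotient y p) ≡ length p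
  length-quotient y []      = ≡.refl
  length-quotient y (b ∷ p) = ≡.cong suc (length-quotient y p)

  module _ (A : CommAlgebra R) where
    open CommAlgebra A
    open CommutativeRing target
    open Evaluation A
    open import Relation.Binary.Reasoning.Setoid setoid
    open import Algebra.Solver.Ring.NaturalCoefficients.Default commutativeSemiring using (solve; _:=_; _:+_; _:*_)

    -- The identity f(s) - f(y) = (s - y) g(s) of synthetic division, rearranged without subtraction
    -- to suit the semiring solver. It holds in every algebra, hence also at power series.
    eval-quotient : ∀ y a p s →
      eval (a ∷ p) s + ι y * eval (quotient y p) s ≈ s * eval (quotient y p) s + ι (Self.eval (a ∷ p) y)
    eval-quotient y a [] s = begin
      (ι a + s * 0#) + ι y * 0# ≈⟨ +-cong (+-congˡ (zeroʳ s)) (zeroʳ _) ⟩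
      (ι a + 0#) + 0#           ≈⟨ +-comm _ _ ⟩
      0# + (ι a + 0#)           ≈⟨ +-cong (zeroʳ s) (+-cong refl (trans (ι-cong (R.zeroʳ y)) ι-0)) ⟨
      s * 0# + (ι a + ι (y R.* R.0#)) ≈⟨ +-congˡ (ι-+ _ _) ⟨
      s * 0# + ι (a R.+ y R.* R.0#) ∎
    eval-quotient y a (b ∷ p) s = begin
      (ι a + s * f) + ι y * (ι v + s * g) ≈⟨ solve 6 (λ a s f y v g → (a :+ s :* f) :+ y :* (v :+ s :* g) := s :* (f :+ y :* g) :+ (a :+ y :* v)) refl (ι a) s f (ι y) (ι v) g ⟩
      s * (f + ι y * g) + (ι a + ι y * ι v) ≈⟨ +-cong (*-congˡ (eval-quotient y b p s)) (+-congˡ (sym (ι-* y v))) ⟩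
      s * (s * g + ι v) + (ι a + ι (y R.* v)) ≈⟨ +-cong (*-congˡ (+-comm _ _)) (sym (ι-+ _ _)) ⟩
      s * (ι v + s * g) + ι (a R.+ y R.* v) ∎
      where
      f = eval (b ∷ p) s
      g = eval (quotient y p) s
      v = Self.eval (b ∷ p) y

  zero-quotient : ∀ y a p → Self.eval (a ∷ p) y R.≈ R.0# → All (R._≈ R.0#) (quotient y p) → All (R._≈ R.0#) (a ∷ p)
  zero-quotient y a []      e z       = R.trans (R.sym (R.trans (R.+-congˡ (R.zeroʳ y)) (R.+-identityʳ a))) e ∷ []
  zero-quotient y a (b ∷ p) e (f ∷ z) =
    R.trans (R.sym (R.trans (R.+-congˡ (R.trans (R.*-congˡ f) (R.zeroʳ y))) (R.+-identityʳ a))) e ∷ zero-quotient y b p f z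

-- Finite fields and their subfields

module FieldFacts (K : FiniteField) where
  open FiniteField K hiding (_^_; zero) public
  open import Algebra.Properties.CommutativeSemiring.Exp commutativeSemiring public
  open import Algebra.Properties.Ring ring public using (-‿distribˡ-*; -1*x≈-x; x∙y⁻¹≈ε⇒x≈y)
  open import Algebra.Properties.CommutativeSemigroup *-commutativeSemigroup public using () renaming (interchange to *-interchange)
  open PowerSeries commRing public
  open Polynomials commRing public
  module PK = Evaluation self
  module PS = Evaluation series
  module SR = CommutativeRing seriesRing
  module SP = Algebra.Properties.CommutativeSemiring.Exp SR.commutativeSemiring
  open import Relation.Binary.Reasoning.Setoid setoid

  ^≡ : ∀ x n → FiniteField._^_ K x n ≡ x ^ n
  ^≡ x zero    = ≡.refl
  ^≡ x (suc n) = ≡.cong (x *_) (^≡ x n)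

  1^ : ∀ n → 1# ^ n ≈ 1#
  1^ zero    = refl
  1^ (suc n) = trans (*-identityˡ _) (1^ n)

  *-cancel-0 : ∀ {x y} → ¬ x ≈ 0# → x * y ≈ 0# → y ≈ 0#
  *-cancel-0 {x} {y} x≉0 xy≈0 = begin
    y              ≈⟨ *-identityˡ y ⟨
    1# * y         ≈⟨ *-congʳ (trans (*-comm _ _) (proj₂ (inverse x x≉0))) ⟨
    i * x * y      ≈⟨ *-assoc _ _ _ ⟩
    i * (x * y)    ≈⟨ *-congˡ xy≈0 ⟩
    i * 0#         ≈⟨ zeroʳ i ⟩
    0#             ∎
    where i = proj₁ (inverse x x≉0)

  *-cancel-≈ : ∀ {x y z} → ¬ x ≈ 0# → x * y ≈ x * z → y ≈ z
  *-cancel-≈ {x} {y} {z} x≉0 e = begin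
    y              ≈⟨ *-identityˡ y ⟨
    1# * y         ≈⟨ *-congʳ ix ⟨
    i * x * y      ≈⟨ *-assoc _ _ _ ⟩
    i * (x * y)    ≈⟨ *-congˡ e ⟩
    i * (x * z)    ≈⟨ *-assoc _ _ _ ⟨
    i * x * z      ≈⟨ *-congʳ ix ⟩
    1# * z         ≈⟨ *-identityˡ z ⟩
    z              ∎
    where
    i = proj₁ (inverse x x≉0)
    ix : i * x ≈ 1#
    ix = trans (*-comm _ _) (proj₂ (inverse x x≉0))

  *-≉0 : ∀ {x y} → ¬ x ≈ 0# → ¬ y ≈ 0# → ¬ x * y ≈ 0#
  *-≉0 x≉0 y≉0 e = y≉0 (*-cancel-0 x≉0 e)

  ^-≉0 : ∀ {x} n → ¬ x ≈ 0# → ¬ x ^ n ≈ 0#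
  ^-≉0 zero    x≉0 = 1≉0
  ^-≉0 (suc n) x≉0 = *-≉0 x≉0 (^-≉0 n x≉0)

  Distinct : List Carrier → Set
  Distinct = AllPairs (λ a b → ¬ (a ≈ b))

  infix 4 _∈_
  _∈_ : Carrier → List Carrier → Set
  x ∈ ys = Any (x ≈_) ys

  lookup-injective : ∀ {xs i j} → Distinct xs → lookup xs i ≈ lookup xs j → i ≡ j
  lookup-injective {x ∷ xs} {Fin.zero}  {Fin.zero}  _        e = ≡.refl
  lookup-injective {x ∷ xs} {Fin.zero}  {Fin.suc j} (d ∷ ds) e = ⊥-elim (All.lookup d (∈-lookup j) e)
  lookup-injective {x ∷ xs} {Fin.suc i} {Fin.zero}  (d ∷ ds) e = ⊥-elim (All.lookup d (∈-lookup i) (sym e))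
  lookup-injective {x ∷ xs} {Fin.suc i} {Fin.suc j} (d ∷ ds) e = ≡.cong Fin.suc (lookup-injective ds e)

  ∏ : List Carrier → Carrier
  ∏ []       = 1#
  ∏ (x ∷ xs) = x * ∏ xs

  extract : ∀ {x ys} → x ∈ ys → Σ (List Carrier) λ zs →
    length ys ≡ suc (length zs) × (∀ {z} → z ∈ ys → ¬ z ≈ x → z ∈ zs) × ∏ ys ≈ x * ∏ zs
  extract {x} {y ∷ ys} (here x≈y) = ys , ≡.refl ,
    (λ { (here z≈y) z≉x → ⊥-elim (z≉x (trans z≈y (sym x≈y))) ; (there z∈) _ → z∈ }) , *-congʳ (sym x≈y)
  extract {x} {y ∷ ys} (there x∈) with extract x∈
  ... | zs , l , f , e = y ∷ zs , ≡.cong suc l ,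
    (λ { (here z≈y) _ → here z≈y ; (there z∈) z≉x → there (f z∈ z≉x) }) ,
    trans (*-congˡ e) (trans (sym (*-assoc _ _ _)) (trans (*-congʳ (*-comm _ _)) (*-assoc _ _ _)))

  private
    rest⊆ : ∀ {x xs ys zs} → All (λ z → ¬ x ≈ z) xs → All (_∈ ys) xs → (∀ {z} → z ∈ ys → ¬ z ≈ x → z ∈ zs) → All (_∈ zs) xs
    rest⊆ []       []       f = []
    rest⊆ (d ∷ ds) (s ∷ ss) f = f s (λ e → d (sym e)) ∷ rest⊆ ds ss f

  distinct-⊆-length : ∀ {xs ys} → Distinct xs → All (_∈ ys) xs → length xs ≤ length ys
  distinct-⊆-length []       []       = z≤n
  distinct-⊆-length (d ∷ ds) (s ∷ ss) with extract s
  ... | zs , l , f , _ rewrite l = s≤s (distinct-⊆-length ds (rest⊆ d ss f))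

  -- Distinctness and equal lengths make `xs` a rearrangement of `ys`; its entries are removed from
  -- `ys` one at a time.
  distinct-⊆-product : ∀ {xs ys} → Distinct xs → All (_∈ ys) xs → length xs ≡ length ys → ∏ xs ≈ ∏ ys
  distinct-⊆-product {ys = []} [] [] _ = refl
  distinct-⊆-product (d ∷ ds) (s ∷ ss) l with extract s
  ... | zs , l′ , f , e = trans (*-congˡ (distinct-⊆-product ds (rest⊆ d ss f) (ℕ.suc-injective (≡.trans l l′)))) (sym e)

  product-map : ∀ a xs → ∏ (map (a *_) xs) ≈ a ^ length xs * ∏ xs
  product-map a []       = sym (*-identityˡ _)
  product-map a (x ∷ xs) = trans (*-congˡ (product-map a xs)) (*-interchange _ _ _ _)

  product-≉0 : ∀ {xs} → All (λ x → ¬ x ≈ 0#) xs → ¬ ∏ xs ≈ 0#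
  product-≉0 []       = 1≉0
  product-≉0 (z ∷ zs) = *-≉0 z (product-≉0 zs)

  -- Multiplication by `a` permutes `xs`, so the product of `xs` equals itself times the power of
  -- `a`, and it can be cancelled.
  closed⇒^length≈1 : ∀ {a xs} → ¬ a ≈ 0# → Distinct xs → All (λ x → ¬ x ≈ 0#) xs →
    All (λ x → a * x ∈ xs) xs → a ^ length xs ≈ 1#
  closed⇒^length≈1 {a} {xs} a≉0 d nz cl = *-cancel-≈ (product-≉0 nz) (begin
    ∏ xs * a ^ length xs ≈⟨ *-comm _ _ ⟩
    a ^ length xs * ∏ xs ≈⟨ product-map a xs ⟨
    ∏ (map (a *_) xs)    ≈⟨ distinct-⊆-product
                                    (AllPairs.map⁺ (AllPairs.map (λ ne e → ne (*-cancel-≈ a≉0 e)) d))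
                                    (All.map⁺ cl) (List.length-map (a *_) xs) ⟩
    ∏ xs                 ≈⟨ *-identityʳ _ ⟨
    ∏ xs * 1#            ∎)

  module SubfieldFacts (F : Subfield K) where
    open Subfield F public
    open FiniteField.IsSubfield isSubfield public

    members : List Carrier
    members = filter mem? elems

    ∈members : ∀ {x} → mem x → x ∈ members
    ∈members {x} = ∈-filter⁺ setoid mem? resp (complete x)

    members-mem : All mem members
    members-mem = All.all-filter mem? elems

    members-distinct : Distinct members
    members-distinct = AllPairs.filter⁺ mem? distinct

    nonzero? : Decidable (λ x → ¬ x ≈ 0#)
    nonzero? x = ¬? (x ≟ 0#)

    nonzeros : List Carrier
    nonzeros = filter nonzero? members

    nonzero-resp : ∀ {x y} → x ≈ y → ¬ x ≈ 0# → ¬ y ≈ 0#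
    nonzero-resp e ne e′ = ne (trans e e′)

    ∈nonzeros : ∀ {x} → mem x → ¬ x ≈ 0# → x ∈ nonzeros
    ∈nonzeros m = ∈-filter⁺ setoid nonzero? nonzero-resp (∈members m)

    size≡ : size ≡ suc (length nonzeros)
    size≡ = ℕ.≤-antisym
      (distinct-⊆-length members-distinct (All.map split members-mem))
      (distinct-⊆-length (All.map (λ ne e → ne (sym e)) (All.all-filter nonzero? members) ∷ AllPairs.filter⁺ nonzero? members-distinct)
        (∈members has0 ∷ All.map ∈members (All.filter⁺ nonzero? members-mem)))
      where
      split : ∀ {x} → mem x → x ∈ 0# ∷ nonzeros
      split {x} m with x ≟ 0#
      ... | yes e = here e
      ... | no ne = there (∈nonzeros m ne)

    fermat : ∀ {a} → mem a → ¬ a ≈ 0# → a ^ length nonzeros ≈ 1#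
    fermat m a≉0 = closed⇒^length≈1 a≉0 (AllPairs.filter⁺ nonzero? members-distinct) (All.all-filter nonzero? members)
      (All.zipWith (λ (m′ , x≉0) → ∈nonzeros (closed* m m′) (*-≉0 a≉0 x≉0))
        (All.filter⁺ nonzero? members-mem , All.all-filter nonzero? members))

    ^size : ∀ {a} → mem a → a ^ size ≈ a
    ^size {a} m rewrite size≡ with a ≟ 0#
    ... | yes e = trans (*-congʳ e) (trans (zeroˡ _) (sym e))
    ... | no ne = trans (*-congˡ (fermat m ne)) (*-identityʳ a)

  -- K as a subfield of itself, so that what is proved for subfields also serves K.
  whole : Subfield K
  whole = record { mem = λ _ → ⊤ ; mem? = λ _ → yes tt ; isSubfield = _ }

  open SubfieldFacts whole public using () renaming (size≡ to size-whole≡; fermat to fermat-whole; nonzeros to units)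

  card≡suc-units : card ≡ suc (length units)
  card≡suc-units = ≡.trans (≡.sym (≡.cong length (List.filter-all (Subfield.mem? whole) {elems} (All.universal (λ _ → tt) elems)))) size-whole≡

  ^card-1 : ∀ {a} → ¬ a ≈ 0# → a ^ (card ℕ.∸ 1) ≈ 1#
  ^card-1 a≉0 rewrite card≡suc-units = fermat-whole tt a≉0

  1<card : 1 < card
  1<card = distinct-⊆-length {xs = 1# ∷ 0# ∷ []} ((1≉0 ∷ []) ∷ [] ∷ []) (complete 1# ∷ complete 0# ∷ [])

-- Counting zeros with multiplicity

module RootCounting (K : FiniteField) where
  open FieldFacts K
  open import Relation.Binary.Reasoning.Setoid setoid
  open import Algebra.Properties.Group +-group using (∙-cancelˡ)

  evalₛ-0 : ∀ p f → PS.eval p f 0 ≈ PK.eval p (f 0)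
  evalₛ-0 []      f = refl
  evalₛ-0 (a ∷ p) f = +-congˡ (*-congˡ (evalₛ-0 p f))

  linear-⊛ : ∀ a b f n → (linear a b ⊛ f) (suc n) ≈ a * f (suc n) + b * f n
  linear-⊛ a b f n = +-congˡ (constant-⊛ b f n)

  -- Cancelling the factor X - y in X - y = λ T at the point y + λ T, which costs one order of vanishing.
  order-at : ∀ {y l M} a p → ¬ l ≈ 0# → PS.eval (a ∷ p) (linear y l) ≈[ suc M ] SR.0# →
    PS.eval (quotient y p) (linear y l) ≈[ M ] SR.0#
  order-at {y} {l} {M} a p l≉0 ord m m<M = *-cancel-0 l≉0 (∙-cancelˡ (y * g (suc m)) _ _ (begin
    y * g (suc m) + l * g m                  ≈⟨ linear-⊛ y l g m ⟨
    (linear y l ⊛ g) (suc m)                 ≈⟨ +-identityʳ _ ⟨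
    (linear y l ⊛ g) (suc m) + 0#            ≈⟨ eval-quotient series y a p (linear y l) (suc m) ⟨
    PS.eval (a ∷ p) (linear y l) (suc m) + (constant y ⊛ g) (suc m) ≈⟨ +-congʳ (ord (suc m) (s≤s m<M)) ⟩
    0# + (constant y ⊛ g) (suc m)            ≈⟨ +-identityˡ _ ⟩
    (constant y ⊛ g) (suc m)                 ≈⟨ constant-⊛ y g (suc m) ⟩
    y * g (suc m)                            ≈⟨ +-identityʳ _ ⟨
    y * g (suc m) + 0#                       ∎))
    where g = PS.eval (quotient y p) (linear y l)

  -- At z ≠ y the series z + lT - y has a nonzero constant term, so dividing by it costs no order;
  -- the coefficients of the quotient are cancelled one after another.
  order-away : ∀ {y z l M} a p → ¬ y ≈ z → PK.eval (a ∷ p) y ≈ 0# →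
    PS.eval (a ∷ p) (linear z l) ≈[ M ] SR.0# → PS.eval (quotient y p) (linear z l) ≈[ M ] SR.0#
  order-away {y} {z} {l} {M} a p y≉z root ord = go
    where
    g = PS.eval (quotient y p) (linear z l)

    eq : ∀ m → m < M → y * g m ≈ (linear z l ⊛ g) m
    eq m m<M = begin
      y * g m                 ≈⟨ constant-⊛ y g m ⟨
      (constant y ⊛ g) m      ≈⟨ +-identityˡ _ ⟨
      0# + (constant y ⊛ g) m ≈⟨ +-congʳ (ord m m<M) ⟨
      PS.eval (a ∷ p) (linear z l) m + (constant y ⊛ g) m ≈⟨ eval-quotient series y a p (linear z l) m ⟩
      (linear z l ⊛ g) m + constant (PK.eval (a ∷ p) y) m ≈⟨ +-congˡ (trans (CommAlgebra.ι-cong series root m) (CommAlgebra.ι-0 series m)) ⟩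
      (linear z l ⊛ g) m + 0# ≈⟨ +-identityʳ _ ⟩
      (linear z l ⊛ g) m      ∎

    cancel : ∀ {x} → y * x ≈ z * x → x ≈ 0#
    cancel {x} e = *-cancel-0 (λ d → y≉z (x∙y⁻¹≈ε⇒x≈y y z d)) (begin
      (y + - z) * x     ≈⟨ distribʳ x y (- z) ⟩
      y * x + - z * x   ≈⟨ +-cong e (sym (-‿distribˡ-* z x)) ⟩
      z * x + - (z * x) ≈⟨ -‿inverseʳ _ ⟩
      0#                ∎)

    go : ∀ m → m < M → g m ≈ 0#
    go zero    m<M = cancel (eq zero m<M)
    go (suc m) m<M = cancel (begin
      y * g (suc m)            ≈⟨ eq (suc m) m<M ⟩
      (linear z l ⊛ g) (suc m) ≈⟨ linear-⊛ z l g m ⟩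
      z * g (suc m) + l * g m  ≈⟨ +-congˡ (trans (*-congˡ (go m (ℕ.<-trans (ℕ.n<1+n m) m<M))) (zeroʳ l)) ⟩
      z * g (suc m) + 0#       ≈⟨ +-identityʳ _ ⟩
      z * g (suc m)            ∎)

  module _ (l : Carrier → Carrier) (M : ℕ) where

    VanishesAt : Poly → Carrier → Set
    VanishesAt p y = PS.eval p (linear y (l y)) ≈[ M ] SR.0#

    -- Synthetic division splits off X - y a total of M times per point, each time shortening the
    -- list by one; `order-at` loses one order at y and `order-away` none elsewhere. The nonzero
    -- scale `l y` does not affect the order, and Stepanov's method depends on choosing it freely.
    roots-with-multiplicity : ∀ ys p → Distinct ys → All (λ y → ¬ l y ≈ 0#) ys → All (VanishesAt p) ys →
      length p ≤ length ys ℕ.* M → All (_≈ 0#) p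
    roots-with-multiplicity [] [] _ _ _ _ = []
    roots-with-multiplicity (y ∷ ys) p (d ∷ ds) (nz ∷ nzs) (v ∷ vs) = peel M p v vs
      where
      peel : ∀ k p → PS.eval p (linear y (l y)) ≈[ k ] SR.0# → All (VanishesAt p) ys →
        length p ≤ k ℕ.+ length ys ℕ.* M → All (_≈ 0#) p
      peel zero    p       v vs len       = roots-with-multiplicity ys p ds nzs vs len
      peel (suc k) []      v vs len       = []
      peel (suc k) (a ∷ p) v vs (s≤s len) = zero-quotient y a p root
        (peel k (quotient y p) (order-at a p nz v)
          (All.zipWith (λ (y≉z , w) → order-away a p y≉z root w) (d , vs))
          (≡.subst (_≤ _) (≡.sym (length-quotient y p)) len))
        where
        root : PK.eval (a ∷ p) y ≈ 0#
        root = trans (sym (evalₛ-0 (a ∷ p) (linear y (l y)))) (v 0 (s≤s z≤n))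

  roots : ∀ ys p → Distinct ys → All (λ y → PK.eval p y ≈ 0#) ys → length p ≤ length ys → All (_≈ 0#) p
  roots ys p d rs len = roots-with-multiplicity (λ _ → 1#) 1 ys p d (All.universal (λ _ → 1≉0) ys)
    (All.map (λ {y} r → λ { zero _ → trans (evalₛ-0 p (linear y 1#)) r ; (suc m) (s≤s ()) }) rs)
    (≡.subst (length p ≤_) (≡.sym (ℕ.*-identityʳ _)) len)

  vanishing : ∀ {D φ} ys → PK.IsPoly D φ → Distinct ys → All (λ y → φ y ≈ 0#) ys → D < length ys → ∀ s → φ s ≈ 0#
  vanishing ys (p , l , e) d rs D<N s =
    trans (e s) (PK.eval-zero p s (roots ys p d (All.map (λ {y} r → trans (sym (e y)) r) rs) (ℕ.≤-trans l D<N)))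

  poly-power : ∀ k → PK.IsPoly k (_^ k)
  poly-power k = ≡.subst (λ d → PK.IsPoly d (_^ k)) (ℕ.*-identityʳ k) (PK.poly-^ k PK.poly-id)

  -- With more solutions X^e - c would vanish everywhere, but its value at 0 is -c.
  ^≈-count : ∀ {e c} ys → 1 ≤ e → ¬ c ≈ 0# → Distinct ys → All (λ y → y ^ e ≈ c) ys → length ys ≤ e
  ^≈-count {suc e} {c} ys _ c≉0 d rs = ℕ.≮⇒≥ λ e<N → c≉0 (begin
    c                    ≈⟨ +-identityˡ c ⟨
    0# + c               ≈⟨ +-congʳ (vanishing ys (PK.poly-+ (poly-power (suc e)) (PK.poly-ι (- c))) d
                              (All.map (λ r → trans (+-congʳ r) (-‿inverseʳ c)) rs) e<N 0#) ⟨
    0# * 0# ^ e + - c + c  ≈⟨ +-assoc _ _ _ ⟩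
    0# * 0# ^ e + (- c + c) ≈⟨ +-cong (zeroˡ _) (-‿inverseˡ c) ⟩
    0# + 0#              ≈⟨ +-identityˡ 0# ⟩
    0#                   ∎)

  monomial : ℕ → Poly
  monomial zero    = 1# ∷ []
  monomial (suc k) = 0# ∷ monomial k

  -- (1 + X)^k - X^k
  lowerBinomial : ℕ → Poly
  lowerBinomial zero    = []
  lowerBinomial (suc k) = monomial k +ₚ lowerBinomial k +ₚ (0# ∷ lowerBinomial k)

  length-monomial : ∀ k → length (monomial k) ≡ suc k
  length-monomial zero    = ≡.refl
  length-monomial (suc k) = ≡.cong suc (length-monomial k)

  length-lowerBinomial : ∀ k → length (lowerBinomial k) ≤ k
  length-lowerBinomial zero    = z≤n
  length-lowerBinomial (suc k) = length-+ₚ (monomial k +ₚ lowerBinomial k) (0# ∷ lowerBinomial k)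
    (length-+ₚ (monomial k) _ (ℕ.≤-reflexive (length-monomial k)) (ℕ.m≤n⇒m≤1+n (length-lowerBinomial k)))
    (s≤s (length-lowerBinomial k))

  module Binomial (A : CommAlgebra commRing) where
    open CommAlgebra A
    private module A = CommutativeRing target
    open Evaluation A
    open import Algebra.Properties.CommutativeSemiring.Exp A.commutativeSemiring using () renaming (_^_ to _^ᴬ_)
    open import Algebra.Solver.Ring.NaturalCoefficients.Default A.commutativeSemiring using (solve; _:=_; _:+_; _:*_)
    private module AR = Relation.Binary.Reasoning.Setoid A.setoid

    eval-monomial : ∀ k s → eval (monomial k) s A.≈ s ^ᴬ k
    eval-monomial zero    s = A.trans (A.+-cong ι-1 (A.zeroʳ s)) (A.+-identityʳ _)
    eval-monomial (suc k) s = A.trans (A.+-cong ι-0 (A.*-congˡ (eval-monomial k s))) (A.+-identityˡ _)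

    binomial : ∀ k s → (A.1# A.+ s) ^ᴬ k A.≈ s ^ᴬ k A.+ eval (lowerBinomial k) s
    binomial zero    s = A.sym (A.+-identityʳ _)
    binomial (suc k) s = AR.begin
      (A.1# A.+ s) A.* (A.1# A.+ s) ^ᴬ k AR.≈⟨ A.*-congˡ (binomial k s) ⟩
      (A.1# A.+ s) A.* (s ^ᴬ k A.+ r)    AR.≈⟨ A.trans (A.distribʳ _ _ _) (A.+-congʳ (A.*-identityˡ _)) ⟩
      (s ^ᴬ k A.+ r) A.+ s A.* (s ^ᴬ k A.+ r) AR.≈⟨ solve 3 (λ s p r → (p :+ r) :+ s :* (p :+ r) := s :* p :+ ((p :+ r) :+ s :* r)) A.refl s (s ^ᴬ k) r ⟩
      s A.* s ^ᴬ k A.+ ((s ^ᴬ k A.+ r) A.+ s A.* r) AR.≈⟨ A.+-congˡ (A.+-cong (A.+-congʳ (eval-monomial k s)) (A.trans (A.+-congʳ ι-0) (A.+-identityˡ _))) ⟨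
      s A.* s ^ᴬ k A.+ ((eval (monomial k) s A.+ r) A.+ eval (0# ∷ lowerBinomial k) s)
        AR.≈⟨ A.+-congˡ (A.trans (eval-+ₚ (monomial k +ₚ lowerBinomial k) _ s) (A.+-congʳ (eval-+ₚ (monomial k) _ s))) ⟨
      s A.* s ^ᴬ k A.+ eval (lowerBinomial (suc k)) s AR.∎
      where r = eval (lowerBinomial k) s

-- Frobenius powers and the conjugates of θ

module Frobenius (K : FiniteField) (F : Subfield K) where
  open FieldFacts K
  open RootCounting K
  open SubfieldFacts F
  open import Relation.Binary.Reasoning.Setoid setoid
  open import Algebra.Properties.Group +-group using (∙-cancelˡ)

  1<size : 1 < size
  1<size = distinct-⊆-length {xs = 1# ∷ 0# ∷ []} ((1≉0 ∷ []) ∷ [] ∷ []) (∈members has1 ∷ ∈members has0 ∷ [])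

  private
    -- This is (1 + X)^q - X^q - 1. It has degree below q and vanishes at the q elements of F, where
    -- x^q = x, so all its coefficients vanish.
    shifted : Poly
    shifted = lowerBinomial size +ₚ (- 1# ∷ [])

    shifted-zero : All (_≈ 0#) shifted
    shifted-zero = roots members shifted members-distinct (All.map root members-mem)
      (length-+ₚ (lowerBinomial size) _ (length-lowerBinomial size) (ℕ.<⇒≤ 1<size))
      where
      root : ∀ {x} → mem x → PK.eval shifted x ≈ 0#
      root {x} m = begin
        PK.eval shifted x                          ≈⟨ PK.eval-+ₚ (lowerBinomial size) _ x ⟩
        PK.eval (lowerBinomial size) x + (- 1# + x * 0#) ≈⟨ +-cong (∙-cancelˡ x _ _ (begin
          x + PK.eval (lowerBinomial size) x           ≈⟨ +-congʳ (^size m) ⟨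
          x ^ size + PK.eval (lowerBinomial size) x    ≈⟨ Binomial.binomial self size x ⟨
          (1# + x) ^ size                              ≈⟨ ^size (closed+ has1 m) ⟩
          1# + x                                       ≈⟨ +-comm _ _ ⟩
          x + 1#                                       ∎)) (trans (+-congˡ (zeroʳ x)) (+-identityʳ _)) ⟩
        1# + - 1#                                  ≈⟨ -‿inverseʳ 1# ⟩
        0#                                         ∎

  -- Since the coefficients of `shifted` vanish, the identity holds in every K-algebra; it is used
  -- in K and in the power series over K.
  module Dream (A : CommAlgebra commRing) where
    open CommAlgebra A
    private module A = CommutativeRing target
    open Evaluation A
    open import Algebra.Properties.CommutativeSemiring.Exp A.commutativeSemiring using () renaming (_^_ to _^ᴬ_)
    private module AR = Relation.Binary.Reasoning.Setoid A.setoid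

    eval-lower : ∀ s → eval (lowerBinomial size) s A.≈ A.1#
    eval-lower s = AR.begin
      r                              AR.≈⟨ A.+-identityʳ r ⟨
      r A.+ A.0#                     AR.≈⟨ A.+-congˡ (A.trans (A.sym (ι-+ _ _)) (A.trans (ι-cong (-‿inverseˡ 1#)) ι-0)) ⟨
      r A.+ (ι (- 1#) A.+ ι 1#)      AR.≈⟨ A.+-assoc _ _ _ ⟨
      r A.+ ι (- 1#) A.+ ι 1#        AR.≈⟨ A.+-cong (A.trans (A.+-congˡ (A.sym (A.trans (A.+-congˡ (A.zeroʳ s)) (A.+-identityʳ _)))) (A.trans (A.sym (eval-+ₚ (lowerBinomial size) _ s)) (eval-zero shifted s shifted-zero))) ι-1 ⟩
      A.0# A.+ A.1#                  AR.≈⟨ A.+-identityˡ _ ⟩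
      A.1#                           AR.∎
      where r = eval (lowerBinomial size) s

    [1+s]^size : ∀ s → (A.1# A.+ s) ^ᴬ size A.≈ s ^ᴬ size A.+ A.1#
    [1+s]^size s = A.trans (Binomial.binomial A size s) (A.+-congˡ (eval-lower s))

  0^ : ∀ {k} → 0 < k → 0# ^ k ≈ 0#
  0^ {suc k} _ = zeroˡ _

  frobenius : ∀ a b → (a + b) ^ size ≈ a ^ size + b ^ size
  frobenius a b with b ≟ 0#
  ... | yes b≈0 = begin
    (a + b) ^ size     ≈⟨ ^-congˡ size (trans (+-congˡ b≈0) (+-identityʳ a)) ⟩
    a ^ size           ≈⟨ +-identityʳ _ ⟨
    a ^ size + 0#      ≈⟨ +-congˡ (trans (^-congˡ size b≈0) (0^ (ℕ.<⇒≤ 1<size))) ⟨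
    a ^ size + b ^ size ∎
  -- Write a + b as b (1 + a / b), which reduces the claim to the case 1 + s.
  ... | no b≉0 = begin
    (a + b) ^ size                   ≈⟨ ^-congˡ size (trans (+-comm a b) (sym (trans (distribˡ b 1# (a * i)) (+-cong (*-identityʳ b) b*ai)))) ⟩
    (b * (1# + a * i)) ^ size        ≈⟨ ^-distrib-* b _ size ⟩
    b ^ size * (1# + a * i) ^ size   ≈⟨ *-congˡ (Dream.[1+s]^size self (a * i)) ⟩
    b ^ size * ((a * i) ^ size + 1#) ≈⟨ distribˡ _ _ _ ⟩
    b ^ size * (a * i) ^ size + b ^ size * 1# ≈⟨ +-cong (trans (sym (^-distrib-* b _ size)) (^-congˡ size b*ai)) (*-identityʳ _) ⟩
    a ^ size + b ^ size ∎
    where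
    i = proj₁ (inverse b b≉0)
    b*ai : b * (a * i) ≈ a
    b*ai = begin
      b * (a * i) ≈⟨ *-congˡ (*-comm a i) ⟩
      b * (i * a) ≈⟨ *-assoc _ _ _ ⟨
      b * i * a   ≈⟨ *-congʳ (proj₂ (inverse b b≉0)) ⟩
      1# * a      ≈⟨ *-identityˡ a ⟩
      a           ∎

  linear-0-^ : ∀ c k → linear 0# c SP.^ k ≈[ k ] SR.0#
  linear-0-^ c (suc k) zero    _         = zeroˡ _
  linear-0-^ c (suc k) (suc m) (s≤s m<k) = trans (linear-⊛ 0# c (linear 0# c SP.^ k) m)
    (trans (+-cong (zeroˡ _) (trans (*-congˡ (linear-0-^ c k m m<k)) (zeroʳ c))) (+-identityˡ 0#))

  constant-^ : ∀ y k → constant y SP.^ k ≋ constant (y ^ k)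
  constant-^ y zero    = SR.refl
  constant-^ y (suc k) = SR.trans (SR.*-congˡ (constant-^ y k)) (SR.sym (constant-* y (y ^ k)))

  -- Taking y out leaves (1 + u)^q = u^q + 1, where u^q starts only at T^q. So up to order q the
  -- q-th power behaves like a constant, which is why Stepanov's method may use high powers of X^q
  -- at little cost.
  linear-^size : ∀ {y} l → ¬ y ≈ 0# → linear y l SP.^ size ≈[ size ] constant (y ^ size)
  linear-^size {y} l y≉0 m m<q = begin
    (linear y l SP.^ size) m                             ≈⟨ SP.^-congˡ size factor m ⟩
    ((constant y ⊛ (SR.1# ⊕ u)) SP.^ size) m             ≈⟨ SP.^-distrib-* (constant y) (SR.1# ⊕ u) size m ⟩
    (constant y SP.^ size ⊛ (SR.1# ⊕ u) SP.^ size) m     ≈⟨ ⊛-cong[] {size} {constant y SP.^ size}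
      (λ k _ → constant-^ y size k) (λ k k<q → trans (Dream.[1+s]^size series u k) (trans (+-congʳ (linear-0-^ _ size k k<q)) (+-identityˡ _))) m m<q ⟩
    (constant (y ^ size) ⊛ SR.1#) m                      ≈⟨ SR.*-identityʳ _ m ⟩
    constant (y ^ size) m                                ∎
    where
    i = proj₁ (inverse y y≉0)
    u = linear 0# (i * l)
    factor : linear y l ≋ constant y ⊛ (SR.1# ⊕ u)
    factor zero          = sym (trans (*-congˡ (+-identityʳ 1#)) (*-identityʳ y))
    factor (suc zero)    = sym (begin
      (constant y ⊛ (SR.1# ⊕ u)) 1 ≈⟨ constant-⊛ y (SR.1# ⊕ u) 1 ⟩
      y * (0# + i * l)             ≈⟨ *-congˡ (+-identityˡ _) ⟩
      y * (i * l)                  ≈⟨ *-assoc _ _ _ ⟨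
      y * i * l                    ≈⟨ *-congʳ (proj₂ (inverse y y≉0)) ⟩
      1# * l                       ≈⟨ *-identityˡ l ⟩
      l                            ∎)
    factor (suc (suc k)) = sym (trans (constant-⊛ y _ (suc (suc k))) (trans (*-congˡ (+-identityʳ 0#)) (zeroʳ y)))

  frobenius^ : ∀ i a b → (a + b) ^ (size ℕ.^ i) ≈ a ^ (size ℕ.^ i) + b ^ (size ℕ.^ i)
  frobenius^ zero    a b = trans (*-identityʳ _) (+-cong (sym (*-identityʳ a)) (sym (*-identityʳ b)))
  frobenius^ (suc i) a b = begin
    (a + b) ^ (size ℕ.* size ℕ.^ i)          ≈⟨ ^-assocʳ (a + b) size _ ⟨
    ((a + b) ^ size) ^ (size ℕ.^ i)          ≈⟨ ^-congˡ (size ℕ.^ i) (frobenius a b) ⟩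
    (a ^ size + b ^ size) ^ (size ℕ.^ i)     ≈⟨ frobenius^ i _ _ ⟩
    (a ^ size) ^ (size ℕ.^ i) + (b ^ size) ^ (size ℕ.^ i) ≈⟨ +-cong (^-assocʳ a size _) (^-assocʳ b size _) ⟩
    a ^ (size ℕ.* size ℕ.^ i) + b ^ (size ℕ.* size ℕ.^ i) ∎

  mem-^size^ : ∀ i {x} → mem x → x ^ (size ℕ.^ i) ≈ x
  mem-^size^ zero    m = *-identityʳ _
  mem-^size^ (suc i) {x} m = trans (sym (^-assocʳ x size _)) (trans (^-congˡ (size ℕ.^ i) (^size m)) (mem-^size^ i m))

  -- The fixed field of the i-th power of Frobenius. It is the subfield to which the hypothesis
  -- `Generates` gets applied.
  fixed-IsSubfield : ∀ i → FiniteField.IsSubfield K (λ y → y ^ (size ℕ.^ i) ≈ y)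
  fixed-IsSubfield i = record
    { resp = λ e p → trans (^-congˡ (size ℕ.^ i) (sym e)) (trans p e)
    ; has0 = mem-^size^ i has0 ; has1 = mem-^size^ i has1
    ; closed+ = λ p q → trans (frobenius^ i _ _) (+-cong p q)
    ; closed* = λ p q → trans (^-distrib-* _ _ (size ℕ.^ i)) (*-cong p q)
    ; closed- = λ {x} p → ∙-cancelˡ x _ _ (begin
        x + (- x) ^ Q     ≈⟨ +-congʳ p ⟨
        x ^ Q + (- x) ^ Q ≈⟨ frobenius^ i x (- x) ⟨
        (x + - x) ^ Q     ≈⟨ ^-congˡ Q (-‿inverseʳ x) ⟩
        0# ^ Q            ≈⟨ mem-^size^ i has0 ⟩
        0#                ≈⟨ -‿inverseʳ x ⟨
        x + - x           ∎)
    ; closed⁻¹ = λ {x} {y} p xy≈1 → *-cancel-≈ (λ x≈0 → 1≉0 (trans (sym xy≈1) (trans (*-congʳ x≈0) (zeroˡ y)))) (begin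
        x * y ^ Q     ≈⟨ *-congʳ p ⟨
        x ^ Q * y ^ Q ≈⟨ ^-distrib-* x y Q ⟨
        (x * y) ^ Q   ≈⟨ ^-congˡ Q xy≈1 ⟩
        1# ^ Q        ≈⟨ 1^ Q ⟩
        1#            ≈⟨ xy≈1 ⟨
        x * y         ∎) }
    where Q = size ℕ.^ i

  module Conjugates (n : ℕ) (card≡ : card ≡ size ℕ.^ n) (θ : Carrier) (gen : Generates K F θ) where

    conjugate : ℕ → Carrier
    conjugate i = θ ^ (size ℕ.^ i)

    ^card : ∀ y → y ^ card ≈ y
    ^card y with y ≟ 0#
    ... | yes e = trans (^-congˡ card e) (trans (0^ (ℕ.<⇒≤ 1<card)) (sym e))
    ... | no ne = begin
      y ^ card                ≈⟨ ^-congʳ y (ℕ.suc-pred card {{ℕ.>-nonZero (ℕ.<⇒≤ 1<card)}}) ⟨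
      y * y ^ ℕ.pred card     ≈⟨ *-congˡ (^-congʳ y (ℕ.pred[m∸n]≡m∸[1+n] card 0)) ⟩
      y * y ^ (card ℕ.∸ 1)    ≈⟨ *-congˡ (^card-1 ne) ⟩
      y * 1#                  ≈⟨ *-identityʳ y ⟩
      y                       ∎

    ^size^-injective : ∀ {i a b} → i ≤ n → a ^ (size ℕ.^ i) ≈ b ^ (size ℕ.^ i) → a ≈ b
    ^size^-injective {i} {a} {b} i≤n e = trans (sym (lift a)) (trans (^-congˡ (size ℕ.^ (n ℕ.∸ i)) e) (lift b))
      where
      lift : ∀ c → (c ^ (size ℕ.^ i)) ^ (size ℕ.^ (n ℕ.∸ i)) ≈ c
      lift c = trans (^-assocʳ c (size ℕ.^ i) (size ℕ.^ (n ℕ.∸ i))) (trans (^-congʳ c (≡.trans (≡.sym (ℕ.^-distribˡ-+-* size i (n ℕ.∸ i)))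
        (≡.trans (≡.cong (size ℕ.^_) (ℕ.m+[n∸m]≡n i≤n)) (≡.sym card≡)))) (^card c))

    -- Otherwise all q^n - 1 nonzero elements would be roots of X^(q^m - 1) - 1.
    not-all-fixed : ∀ {m} → 1 ≤ m → m < n → ¬ (∀ y → y ^ (size ℕ.^ m) ≈ y)
    not-all-fixed {m} 1≤m m<n fixed = ℕ.<⇒≱ (ℕ.^-monoʳ-< size 1<size m<n)
      (ℕ.≤-trans (ℕ.≤-reflexive (≡.sym card≡)) (ℕ.≤-trans card≤ (ℕ.≤-reflexive (ℕ.m+[n∸m]≡n 1≤q^m))))
      where
      module W = SubfieldFacts whole
      1≤q^m : 1 ≤ size ℕ.^ m
      1≤q^m = ℕ.m^n>0 size {{ℕ.>-nonZero (ℕ.<⇒≤ 1<size)}} m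
      2≤q^m : 2 ≤ size ℕ.^ m
      2≤q^m = ℕ.≤-trans 1<size (ℕ.≤-trans (ℕ.≤-reflexive (≡.sym (ℕ.^-identityʳ size)))
        (ℕ.^-monoʳ-≤ size {{ℕ.>-nonZero (ℕ.<⇒≤ 1<size)}} 1≤m))
      e = size ℕ.^ m ℕ.∸ 1
      order : ∀ {y} → ¬ y ≈ 0# → y ^ e ≈ 1#
      order {y} y≉0 = *-cancel-≈ y≉0 (trans (^-congʳ y (ℕ.m+[n∸m]≡n 1≤q^m)) (trans (fixed y) (sym (*-identityʳ y))))
      card≤ : card ≤ suc e
      card≤ = ℕ.≤-trans (ℕ.≤-reflexive card≡suc-units)
        (s≤s (^≈-count W.nonzeros (ℕ.∸-monoˡ-≤ 1 2≤q^m) 1≉0 (AllPairs.filter⁺ W.nonzero? W.members-distinct)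
          (All.map order (All.all-filter W.nonzero? W.members))))

    -- If two conjugates agree, injectivity of Frobenius shows that θ is fixed by its (j - i)-th
    -- power. The fixed field then contains F and θ, so it is all of K.
    conjugate-distinct : ∀ {i j} → i < j → j < n → ¬ conjugate i ≈ conjugate j
    conjugate-distinct {i} {j} i<j j<n e = not-all-fixed (ℕ.m<n⇒0<n∸m i<j) (ℕ.≤-<-trans (ℕ.m∸n≤m j i) j<n)
      (gen _ (fixed-IsSubfield (j ℕ.∸ i)) (λ x m → mem-^size^ (j ℕ.∸ i) m) (^size^-injective (ℕ.<⇒≤ (ℕ.<-trans i<j j<n)) (sym (begin
        θ ^ (size ℕ.^ i)   ≈⟨ e ⟩
        θ ^ (size ℕ.^ j)   ≈⟨ ^-congʳ θ (≡.trans (≡.cong (size ℕ.^_) (≡.sym (ℕ.m∸n+n≡m (ℕ.<⇒≤ i<j)))) (ℕ.^-distribˡ-+-* size (j ℕ.∸ i) i)) ⟩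
        θ ^ (size ℕ.^ (j ℕ.∸ i) ℕ.* size ℕ.^ i) ≈⟨ ^-assocʳ θ (size ℕ.^ (j ℕ.∸ i)) (size ℕ.^ i) ⟨
        (θ ^ (size ℕ.^ (j ℕ.∸ i))) ^ (size ℕ.^ i) ∎))))

    conjugate-+ : ∀ i {x} → mem x → (θ + x) ^ (size ℕ.^ i) ≈ conjugate i + x
    conjugate-+ i m = trans (frobenius^ i _ _) (+-congˡ (mem-^size^ i m))

    θ∉F : 1 < n → ¬ mem θ
    θ∉F 1<n m = not-all-fixed {1} ℕ.≤-refl 1<n
      (gen _ (fixed-IsSubfield 1) (λ x → mem-^size^ 1) (mem-^size^ 1 m))

    θ+x≉0 : 1 < n → ∀ {x} → mem x → ¬ θ + x ≈ 0#
    θ+x≉0 1<n {x} m e = θ∉F 1<n (resp (sym (begin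
      θ             ≈⟨ +-identityʳ θ ⟨
      θ + 0#        ≈⟨ +-congˡ (-‿inverseʳ x) ⟨
      θ + (x + - x) ≈⟨ +-assoc _ _ _ ⟨
      θ + x + - x   ≈⟨ +-congʳ e ⟩
      0# + - x      ≈⟨ +-identityˡ _ ⟩
      - x           ∎)) (closed- m))

    conjugate+x≉0 : 1 < n → ∀ i {x} → mem x → ¬ conjugate i + x ≈ 0#
    conjugate+x≉0 1<n i m e = ^-≉0 (size ℕ.^ i) (θ+x≉0 1<n m) (trans (conjugate-+ i m) e)

    conjugates : List Carrier
    conjugates = applyUpTo conjugate n

    conjugates-distinct : Distinct conjugates
    conjugates-distinct = AllPairs.applyUpTo⁺₁ conjugate n conjugate-distinct

    length-conjugates : length conjugates ≡ n
    length-conjugates = List.length-applyUpTo conjugate n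

-- Products of solutions, one from each block

funToFin-cong : ∀ {m n} {f g : Fin m → Fin n} → f ≗ g → Fin.funToFin f ≡ Fin.funToFin g
funToFin-cong {zero}  e = ≡.refl
funToFin-cong {suc m} e = ≡.cong₂ Fin.combine (e Fin.zero) (funToFin-cong (e ∘ Fin.suc))

finToFun-injective : ∀ {m n} {i j : Fin (n ℕ.^ m)} → Fin.finToFun {n} {m} i ≗ Fin.finToFun {n} {m} j → i ≡ j
finToFun-injective {m} {n} {i} {j} e =
  ≡.trans (≡.sym (Fin.funToFin-finToFin {m} {n} i)) (≡.trans (funToFin-cong e) (Fin.funToFin-finToFin {m} {n} j))

module BlockProducts (K : FiniteField) (F : Subfield K) where
  open FieldFacts K
  open RootCounting K
  open SubfieldFacts F
  open Frobenius K F
  open import Relation.Binary.Reasoning.Setoid setoid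
  open import Algebra.Properties.Group +-group using (∙-cancelˡ)
  open import Algebra.Solver.Ring.NaturalCoefficients.Default commutativeSemiring using (solve; _:=_; _:+_; _:*_)

  Π : ∀ {k} → (Fin k → Carrier) → Carrier
  Π {zero}  f = 1#
  Π {suc k} f = f Fin.zero * Π (f ∘ Fin.suc)

  Π-cong : ∀ {k} {f g : Fin k → Carrier} → (∀ i → f i ≈ g i) → Π f ≈ Π g
  Π-cong {zero}  e = refl
  Π-cong {suc k} e = *-cong (e Fin.zero) (Π-cong (e ∘ Fin.suc))

  Π-^ : ∀ {k} (f : Fin k → Carrier) e → Π f ^ e ≈ Π (λ i → f i ^ e)
  Π-^ {zero}  f e = 1^ e
  Π-^ {suc k} f e = trans (^-distrib-* _ _ e) (*-congˡ (Π-^ (f ∘ Fin.suc) e))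

  Π-scale : ∀ {k} a (f : Fin k → Carrier) → Π (λ i → a * f i) ≈ a ^ k * Π f
  Π-scale {zero}  a f = sym (*-identityˡ _)
  Π-scale {suc k} a f = trans (*-congˡ (Π-scale a (f ∘ Fin.suc))) (*-interchange _ _ _ _)

  Π-1 : ∀ k → Π {k} (λ _ → 1#) ≈ 1#
  Π-1 zero    = refl
  Π-1 (suc k) = trans (*-identityˡ _) (Π-1 k)

  Π-zero : ∀ {k} (f : Fin k → Carrier) i → f i ≈ 0# → Π f ≈ 0#
  Π-zero f Fin.zero    e = trans (*-congʳ e) (zeroˡ _)
  Π-zero f (Fin.suc i) e = trans (*-congˡ (Π-zero (f ∘ Fin.suc) i e)) (zeroʳ _)

  Π-zero⁻¹ : ∀ {k} (f : Fin k → Carrier) → Π f ≈ 0# → ∃ λ i → f i ≈ 0#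
  Π-zero⁻¹ {zero}  f e = ⊥-elim (1≉0 e)
  Π-zero⁻¹ {suc k} f e with f Fin.zero ≟ 0#
  ... | yes z = Fin.zero , z
  ... | no nz with i , z ← Π-zero⁻¹ (f ∘ Fin.suc) (*-cancel-0 nz e) = Fin.suc i , z

  -- Separating the leading power makes it cancel in the difference of two such products, which
  -- therefore has degree at most k.
  monic : ∀ {k} (z : Fin (suc k) → Carrier) → Σ (Carrier → Carrier) λ ψ →
    PK.IsPoly k ψ × (∀ s → Π (λ i → s + z i) ≈ s ^ suc k + ψ s)
  monic {zero}  z = (λ _ → z Fin.zero) , PK.poly-ι _ , λ s → trans (*-identityʳ _) (+-congʳ (sym (*-identityʳ s)))
  monic {suc k} z with ψ , ψ-poly , e ← monic (z ∘ Fin.suc) =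
    (λ s → z₀ * s ^ suc k + (s + z₀) * ψ s) ,
    PK.poly-+ (PK.poly-* {D = 0} (PK.poly-ι z₀) (poly-power (suc k)))
      (PK.poly-* {D = 1} (PK.poly-+ PK.poly-id (PK.poly-ι z₀)) ψ-poly) ,
    λ s → trans (*-congˡ (e s)) (solve 4 (λ s z p r → (s :+ z) :* (p :+ r) := s :* p :+ (z :* p :+ (s :+ z) :* r)) refl s z₀ (s ^ suc k) (ψ s))
    where z₀ = z Fin.zero

  module _ (n : ℕ) (card≡ : card ≡ size ℕ.^ suc n) (θ : Carrier) (gen : Generates K F θ) where
    open Conjugates (suc n) card≡ θ gen

    Π-conjugate : ∀ {k} i (z : Fin k → Carrier) → (∀ j → mem (z j)) → Π (λ j → θ + z j) ^ (size ℕ.^ i) ≈ Π (λ j → conjugate i + z j)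
    Π-conjugate i z m = trans (Π-^ (λ j → θ + z j) (size ℕ.^ i)) (Π-cong (λ j → conjugate-+ i (m j)))

    -- The difference of the two products is a polynomial in θ of degree at most n over F; it also vanishes at the n + 1 conjugates.
    Π-determines : ∀ (y z : Fin (suc n) → Carrier) → (∀ j → mem (y j)) → (∀ j → mem (z j)) →
      Π (λ j → θ + y j) ≈ Π (λ j → θ + z j) → ∀ i → ∃ λ j → y i ≈ z j
    Π-determines y z my mz e i with ψ , ψ-poly , ψ≈ ← monic y | χ , χ-poly , χ≈ ← monic z =
      proj₁ found , sym (x∙y⁻¹≈ε⇒x≈y (z (proj₁ found)) (y i) (trans (+-comm _ _) (proj₂ found)))
      where
      s₀ = - y i
      difference : ∀ s → ψ s + - 1# * χ s ≈ 0# → Π (λ j → s + y j) ≈ Π (λ j → s + z j)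
      difference s d = trans (ψ≈ s) (trans (+-congˡ (x∙y⁻¹≈ε⇒x≈y (ψ s) (χ s) (trans (+-congˡ (sym (-1*x≈-x (χ s)))) d))) (sym (χ≈ s)))
      difference⁻¹ : ∀ s → Π (λ j → s + y j) ≈ Π (λ j → s + z j) → ψ s + - 1# * χ s ≈ 0#
      difference⁻¹ s d = trans (+-congˡ (-1*x≈-x (χ s))) (trans (+-congʳ (∙-cancelˡ (s ^ suc n) _ _ (trans (sym (ψ≈ s)) (trans d (χ≈ s))))) (-‿inverseʳ _))
      equal : ∀ s → Π (λ j → s + y j) ≈ Π (λ j → s + z j)
      equal s = difference s (vanishing conjugates
        (PK.poly-+ ψ-poly (PK.poly-* {D = 0} (PK.poly-ι (- 1#)) χ-poly)) conjugates-distinct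
        (All.applyUpTo⁺₁ conjugate (suc n) λ {j} _ → difference⁻¹ _
          (trans (sym (Π-conjugate j y my)) (trans (^-congˡ (size ℕ.^ j) e) (Π-conjugate j z mz))))
        (ℕ.≤-reflexive (≡.sym length-conjugates)) s)
      found = Π-zero⁻¹ (λ j → s₀ + z j) (trans (sym (equal s₀)) (Π-zero (λ j → s₀ + y j) i (-‿inverseˡ _)))

    -- The first (n + 1) b entries form n + 1 blocks of length b, and each choice of one entry per
    -- block gives an e-th root of unity. By `Π-determines` equal products have the same factors; as
    -- the blocks are disjoint, a shared factor comes from the same block, so the choices agree.
    -- Hence b^(n + 1) distinct roots of unity, of which there are at most e.
    block-bound : ∀ {α e b xs} → 1 ≤ e → ¬ α ≈ 0# → Distinct xs → All mem xs → All (λ x → (α * (θ + x)) ^ e ≈ 1#) xs →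
      suc n ℕ.* b ≤ length xs → b ℕ.^ suc n ≤ e
    block-bound {α} {e} {b} {xs} 1≤e α≉0 d m r len = ≡.subst (_≤ e) (List.length-tabulate value)
      (^≈-count (tabulate value) 1≤e 1≉0
        (AllPairs.tabulate⁺ λ i≢j p → i≢j (value-injective p)) (All.tabulate⁺ value^e))
      where
      x : Fin (suc n) → Fin b → Carrier
      x i j = lookup xs (Fin.inject≤ (Fin.combine i j) len)

      x-injective : ∀ {i j i′ j′} → x i j ≈ x i′ j′ → i ≡ i′ × j ≡ j′
      x-injective e = Fin.combine-injective _ _ _ _ (Fin.inject≤-injective len len _ _ (lookup-injective d e))

      x-mem : ∀ i j → mem (x i j)
      x-mem i j = All.lookup m (∈-lookup (Fin.inject≤ (Fin.combine i j) len))

      entry : Fin (b ℕ.^ suc n) → Fin (suc n) → Carrier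
      entry t i = x i (Fin.finToFun t i)

      value : Fin (b ℕ.^ suc n) → Carrier
      value t = Π (λ i → α * (θ + entry t i))

      value^e : ∀ t → value t ^ e ≈ 1#
      value^e t = trans (Π-^ (λ i → α * (θ + entry t i)) e)
        (trans (Π-cong (λ i → All.lookup r (∈-lookup (Fin.inject≤ (Fin.combine i (Fin.finToFun {b} {suc n} t i)) len)))) (Π-1 (suc n)))

      value-injective : ∀ {t u} → value t ≈ value u → t ≡ u
      value-injective {t} {u} p = finToFun-injective {suc n} {b} λ i → same i
        (Π-determines (entry t) (entry u) (λ j → x-mem j _) (λ j → x-mem j _)
          (*-cancel-≈ (^-≉0 (suc n) α≉0) (trans (sym (Π-scale α (λ j → θ + entry t j))) (trans p (Π-scale α (λ j → θ + entry u j))))) i)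
        where
        same : ∀ i → (∃ λ j → entry t i ≈ entry u j) → Fin.finToFun t i ≡ Fin.finToFun u i
        same i (j , q) with x-injective {i} {Fin.finToFun t i} {j} {Fin.finToFun u j} q
        ... | ≡.refl , e = e

-- Terms of distinct orders, and linear systems with more unknowns than equations

module LinearRelations (K : FiniteField) where
  open FieldFacts K
  open RootCounting K
  open import Relation.Binary.Reasoning.Setoid setoid
  open import Algebra.Properties.CommutativeSemigroup +-commutativeSemigroup using () renaming (interchange to +-interchange)
  open import Algebra.Solver.Ring.NaturalCoefficients.Default SR.commutativeSemiring using (solve; _:=_; _:+_; _:*_)

  ∑ : ℕ → (ℕ → Carrier) → Carrier
  ∑ zero    f = 0#
  ∑ (suc W) f = f 0 + ∑ W (f ∘ suc)

  ∑-cong : ∀ W {f g} → (∀ w → w < W → f w ≈ g w) → ∑ W f ≈ ∑ W g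
  ∑-cong zero    e = refl
  ∑-cong (suc W) e = +-cong (e 0 (s≤s z≤n)) (∑-cong W (λ w w<W → e (suc w) (s≤s w<W)))

  ∑-+ : ∀ W f g → ∑ W (λ w → f w + g w) ≈ ∑ W f + ∑ W g
  ∑-+ zero    f g = sym (+-identityʳ 0#)
  ∑-+ (suc W) f g = trans (+-congˡ (∑-+ W _ _)) (+-interchange _ _ _ _)

  ∑-* : ∀ W a f → ∑ W (λ w → a * f w) ≈ a * ∑ W f
  ∑-* zero    a f = sym (zeroʳ a)
  ∑-* (suc W) a f = trans (+-congˡ (∑-* W a _)) (sym (distribˡ _ _ _))

  ∑-0 : ∀ W → ∑ W (λ _ → 0#) ≈ 0#
  ∑-0 zero    = refl
  ∑-0 (suc W) = trans (+-congˡ (∑-0 W)) (+-identityʳ 0#)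

  ∑ₛ : ℕ → (ℕ → Series) → Series
  ∑ₛ W f m = ∑ W (λ w → f w m)

  poly-∑ₛ : ∀ {D} W {f : Series → ℕ → Series} → (∀ w → w < W → PS.IsPoly D (λ s → f s w)) → PS.IsPoly D (λ s → ∑ₛ W (f s))
  poly-∑ₛ zero    p = PS.poly-0
  poly-∑ₛ (suc W) p = PS.poly-+ (p 0 (s≤s z≤n)) (poly-∑ₛ W (λ w w<W → p (suc w) (s≤s w<W)))

  T : Series
  T = linear 0# 1#

  T-⊛-suc : ∀ f m → (T ⊛ f) (suc m) ≈ f m
  T-⊛-suc f m = trans (linear-⊛ 0# 1# f m) (trans (+-cong (zeroˡ _) (*-identityˡ _)) (+-identityˡ _))

  -- The w-th summand starts exactly at T^w unless its coefficient is zero: the constant term forces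
  -- the first coefficient to vanish, and then T is cancelled from the rest.
  triangular : ∀ W (c : ℕ → Carrier) (g : ℕ → Series) → (∀ w → ¬ g w 0 ≈ 0#) →
    ∑ₛ W (λ w → constant (c w) ⊛ (T SP.^ w ⊛ g w)) ≋ SR.0# → ∀ w → w < W → c w ≈ 0#
  triangular (suc W) c g unit e = λ { zero _ → c₀≈0 ; (suc w) (s≤s w<W) → triangular W (c ∘ suc) (g ∘ suc) (unit ∘ suc) tail-zero w w<W }
    where
    term : ℕ → Series
    term w = constant (c w) ⊛ (T SP.^ w ⊛ g w)

    shifted : ℕ → Series
    shifted w = constant (c (suc w)) ⊛ (T SP.^ w ⊛ g (suc w))

    shift : ∀ w → term (suc w) ≋ T ⊛ shifted w
    shift w = solve 4 (λ c t p g → c :* ((t :* p) :* g) := t :* (c :* (p :* g))) SR.refl (constant (c (suc w))) T (T SP.^ w) (g (suc w))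

    c₀g₀≈0 : c 0 * (1# * g 0 0) ≈ 0#
    c₀g₀≈0 = begin
      c 0 * (1# * g 0 0)       ≈⟨ +-identityʳ _ ⟨
      term 0 0 + 0#            ≈⟨ +-congˡ (trans (∑-cong W (λ w _ → trans (shift w 0) (zeroˡ _))) (∑-0 W)) ⟨
      ∑ₛ (suc W) term 0        ≈⟨ e 0 ⟩
      0#                       ∎

    c₀≈0 : c 0 ≈ 0#
    c₀≈0 = *-cancel-0 (unit 0) (trans (*-comm _ _) (trans (*-congˡ (sym (*-identityˡ _))) c₀g₀≈0))

    tail-zero : ∑ₛ W shifted ≋ SR.0#
    tail-zero m = begin
      ∑ₛ W shifted m                       ≈⟨ ∑-cong W (λ w _ → trans (shift w (suc m)) (T-⊛-suc (shifted w) m)) ⟨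
      ∑ W (λ w → term (suc w) (suc m))     ≈⟨ +-identityˡ _ ⟨
      0# + ∑ W (λ w → term (suc w) (suc m)) ≈⟨ +-congʳ (trans (constant-⊛ (c 0) _ (suc m)) (trans (*-congʳ c₀≈0) (zeroˡ _))) ⟨
      ∑ₛ (suc W) term (suc m)              ≈⟨ e (suc m) ⟩
      0#                                   ∎

  coefficient : Poly → ℕ → Carrier
  coefficient []      l       = 0#
  coefficient (a ∷ p) zero    = a
  coefficient (a ∷ p) (suc l) = coefficient p l

  eval-≈ : ∀ {D} p q y → length p ≤ D → length q ≤ D → (∀ l → l < D → coefficient p l ≈ coefficient q l) → PK.eval p y ≈ PK.eval q y
  eval-≈ []      []      y u v e = refl
  eval-≈ [] (b ∷ q) y z≤n (s≤s v) e = sym (trans (+-cong (sym (e 0 (s≤s z≤n))) (trans (*-congˡ (sym (eval-≈ [] q y z≤n v (λ l l<D → e (suc l) (s≤s l<D))))) (zeroʳ y))) (+-identityʳ 0#))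
  eval-≈ (a ∷ p) [] y (s≤s u) z≤n e = trans (+-cong (e 0 (s≤s z≤n)) (trans (*-congˡ (eval-≈ p [] y u z≤n (λ l l<D → e (suc l) (s≤s l<D)))) (zeroʳ y))) (+-identityʳ 0#)
  eval-≈ (a ∷ p) (b ∷ q) y (s≤s u) (s≤s v) e = +-cong (e 0 (s≤s z≤n)) (*-congˡ (eval-≈ p q y u v (λ l l<D → e (suc l) (s≤s l<D))))

  combination : (W : ℕ) → (ℕ → Carrier) → (ℕ → Poly) → Poly
  combination zero    c p = []
  combination (suc W) c p = scale (c 0) (p 0) +ₚ combination W (c ∘ suc) (p ∘ suc)

  length-combination : ∀ {D} W c p → (∀ w → w < W → length (p w) ≤ D) → length (combination W c p) ≤ D
  length-combination zero    c p l = z≤n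
  length-combination (suc W) c p l = length-+ₚ (scale (c 0) (p 0)) (combination W (c ∘ suc) (p ∘ suc))
    (ℕ.≤-trans (ℕ.≤-reflexive (length-scale (c 0) (p 0))) (l 0 (s≤s z≤n)))
    (length-combination W (c ∘ suc) (p ∘ suc) (λ w w<W → l (suc w) (s≤s w<W)))

  eval-combination : ∀ W c p y → PK.eval (combination W c p) y ≈ ∑ W (λ w → c w * PK.eval (p w) y)
  eval-combination zero    c p y = refl
  eval-combination (suc W) c p y = trans (PK.eval-+ₚ (scale (c 0) (p 0)) (combination W (c ∘ suc) (p ∘ suc)) y) (+-cong (PK.eval-scale (c 0) (p 0) y) (eval-combination W _ _ y))

  assign : ∀ {W} → (Fin W → Carrier) → ℕ → Carrier
  assign {zero}  f w       = 0#
  assign {suc W} f zero    = f Fin.zero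
  assign {suc W} f (suc w) = assign (f ∘ Fin.suc) w

  assign-toℕ : ∀ {W} (f : Fin W → Carrier) i → assign f (Fin.toℕ i) ≡ f i
  assign-toℕ {suc W} f Fin.zero    = ≡.refl
  assign-toℕ {suc W} f (Fin.suc i) = assign-toℕ (f ∘ Fin.suc) i

  -- Pigeonhole in place of linear algebra: there are card^W assignments of the unknowns but only
  -- card^(M D) outcomes, so two different assignments have the same outcome, and their difference
  -- solves the homogeneous system.
  private module Assignments (W M D : ℕ) (p : ℕ → ℕ → Poly) where
    vector : Fin (card ℕ.^ W) → ℕ → Carrier
    vector t = assign (lookup elems ∘ Fin.finToFun {card} {W} t)

    outcome : Fin (card ℕ.^ W) → ℕ → Poly
    outcome t m = combination W (vector t) (λ w → p w m)

    entry : Fin (card ℕ.^ W) → Fin (M ℕ.* D) → Carrier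
    entry t i = coefficient (outcome t (Fin.toℕ (Fin.quotient {M} D i))) (Fin.toℕ (Fin.remainder {M} D i))

    code : Fin (card ℕ.^ W) → Fin (card ℕ.^ (M ℕ.* D))
    code t = Fin.funToFin (λ i → Any.index (complete (entry t i)))

  -- More unknowns than equations: p w m lists the coefficients of the w-th unknown in the m-th group of equations.
  nontrivial-relation : ∀ W M D → M ℕ.* D < W → (p : ℕ → ℕ → Poly) → (∀ w m → m < M → length (p w m) ≤ D) →
    Σ (ℕ → Carrier) λ c → ¬ (∀ w → w < W → c w ≈ 0#) × (∀ m → m < M → ∀ y → ∑ W (λ w → c w * PK.eval (p w m) y) ≈ 0#)
  nontrivial-relation W M D MD<W p len with Fin.pigeonhole (ℕ.^-monoʳ-< card 1<card MD<W) (Assignments.code W M D p)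
  ... | t , u , t<u , same = (λ w → vector t w + - vector u w) , nonzero , solution
    where
    open Assignments W M D p

    entries : ∀ i → entry t i ≈ entry u i
    entries i = trans (Any.lookup-index (complete (entry t i))) (trans (reflexive (≡.cong (lookup elems) index≡)) (sym (Any.lookup-index (complete (entry u i)))))
      where
      index≡ : Any.index (complete (entry t i)) ≡ Any.index (complete (entry u i))
      index≡ = ≡.trans (≡.sym (Fin.finToFun-funToFin (λ i → Any.index (complete (entry t i))) i))
        (≡.trans (≡.cong (λ k → Fin.finToFun {card} {M ℕ.* D} k i) same) (Fin.finToFun-funToFin (λ i → Any.index (complete (entry u i))) i))

    coefficients : ∀ m l → m < M → l < D → coefficient (outcome t m) l ≈ coefficient (outcome u m) l
    coefficients m l m<M l<D = ≡.subst₂ (λ m l → coefficient (outcome t m) l ≈ coefficient (outcome u m) l)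
      (≡.trans (≡.cong (Fin.toℕ ∘ proj₁) rq) (Fin.toℕ-fromℕ< m<M)) (≡.trans (≡.cong (Fin.toℕ ∘ proj₂) rq) (Fin.toℕ-fromℕ< l<D))
      (entries (Fin.combine (Fin.fromℕ< m<M) (Fin.fromℕ< l<D)))
      where
      rq : Fin.remQuot {M} D (Fin.combine (Fin.fromℕ< m<M) (Fin.fromℕ< l<D)) ≡ (Fin.fromℕ< m<M , Fin.fromℕ< l<D)
      rq = Fin.remQuot-combine (Fin.fromℕ< m<M) (Fin.fromℕ< l<D)

    solution : ∀ m → m < M → ∀ y → ∑ W (λ w → (vector t w + - vector u w) * PK.eval (p w m) y) ≈ 0#
    solution m m<M y = begin
      ∑ W (λ w → (vector t w + - vector u w) * e w)
        ≈⟨ ∑-cong W (λ w _ → trans (distribʳ _ _ _) (+-congˡ (trans (sym (-‿distribˡ-* _ _)) (sym (-1*x≈-x _))))) ⟩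
      ∑ W (λ w → vector t w * e w + - 1# * (vector u w * e w)) ≈⟨ trans (∑-+ W _ _) (+-congˡ (∑-* W (- 1#) _)) ⟩
      ∑ W (λ w → vector t w * e w) + - 1# * ∑ W (λ w → vector u w * e w)
        ≈⟨ +-cong (eval-combination W (vector t) (λ w → p w m) y) (*-congˡ (eval-combination W (vector u) (λ w → p w m) y)) ⟨
      PK.eval (outcome t m) y + (- 1#) * PK.eval (outcome u m) y ≈⟨ +-cong
        (eval-≈ (outcome t m) (outcome u m) y (length-combination W (vector t) (λ w → p w m) (λ w _ → len w m m<M)) (length-combination W (vector u) (λ w → p w m) (λ w _ → len w m m<M)) (λ l l<D → coefficients m l m<M l<D)) (-1*x≈-x _) ⟩
      PK.eval (outcome u m) y + - PK.eval (outcome u m) y ≈⟨ -‿inverseʳ _ ⟩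
      0# ∎
      where
      e : ℕ → Carrier
      e w = PK.eval (p w m) y

    nonzero : ¬ (∀ w → w < W → vector t w + - vector u w ≈ 0#)
    nonzero z = Fin.<⇒≢ t<u (finToFun-injective {W} {card} λ i → lookup-injective distinct
      (trans (sym (reflexive (assign-toℕ (lookup elems ∘ Fin.finToFun {card} {W} t) i)))
        (trans (x∙y⁻¹≈ε⇒x≈y _ _ (z (Fin.toℕ i) (Fin.toℕ<n i))) (reflexive (assign-toℕ (lookup elems ∘ Fin.finToFun {card} {W} u) i)))))

-- Stepanov's auxiliary polynomial

module StepanovBound (K : FiniteField) (F : Subfield K) where
  open FieldFacts K
  open RootCounting K
  open Subfield F using (size)
  open Frobenius K F
  open LinearRelations K
  open import Relation.Binary.Reasoning.Setoid setoid
  private module SRR = Relation.Binary.Reasoning.Setoid SR.setoid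

  ^-cong[] : ∀ {M f g} k → f ≈[ M ] g → f SP.^ k ≈[ M ] g SP.^ k
  ^-cong[] zero    e m m<M = refl
  ^-cong[] {M} {f} {g} (suc k) e = ⊛-cong[] {M} {f} {g} e (^-cong[] k e)

  ^-at-0 : ∀ f k → (f SP.^ k) 0 ≈ f 0 ^ k
  ^-at-0 f zero    = refl
  ^-at-0 f (suc k) = *-congˡ (^-at-0 f k)

  linear-cong : ∀ {a a′ b b′} → a ≈ a′ → b ≈ b′ → linear a b ≋ linear a′ b′
  linear-cong p q zero          = p
  linear-cong p q (suc zero)    = q
  linear-cong p q (suc (suc n)) = refl

  linear-factor : ∀ a h → linear a (a * h) ≋ constant a ⊛ linear 1# h
  linear-factor a h zero          = sym (*-identityʳ a)
  linear-factor a h (suc zero)    = sym (constant-⊛ a (linear 1# h) 1)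
  linear-factor a h (suc (suc n)) = sym (trans (constant-⊛ a (linear 1# h) (suc (suc n))) (zeroʳ a))

  -- T counts with weight n: the coefficient of T^m may have degree b + n m in y. In products the
  -- bounds b add up, so b = 0 survives every power, and large exponents cost no degree.
  record Weighted (n b : ℕ) (Φ : Carrier → Series) : Set where
    constructor weighted
    field at : ∀ m → PK.IsPoly (b ℕ.+ n ℕ.* m) (λ y → Φ y m)
  open Weighted

  module _ {n : ℕ} where

    weighted-constant : ∀ {b φ} → PK.IsPoly b φ → Weighted n b (λ y → constant (φ y))
    weighted-constant p .at zero    = PK.poly-≤ (ℕ.m≤m+n _ _) p
    weighted-constant p .at (suc m) = PK.poly-0

    weighted-linear : ∀ {b φ ψ} → PK.IsPoly b φ → PK.IsPoly n ψ → Weighted n b (λ y → linear (φ y) (ψ y))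
    weighted-linear p r .at zero           = PK.poly-≤ (ℕ.m≤m+n _ _) p
    weighted-linear {b} p r .at (suc zero) = PK.poly-≤ (ℕ.≤-trans (ℕ.≤-reflexive (≡.sym (ℕ.*-identityʳ n))) (ℕ.m≤n+m _ b)) r
    weighted-linear p r .at (suc (suc m))  = PK.poly-0

    weighted-tl : ∀ {b Φ} → Weighted n b Φ → Weighted n (b ℕ.+ n) (λ y → tl (Φ y))
    weighted-tl {b} w .at m = PK.poly-≤ (ℕ.≤-reflexive (eq b n m)) (w .at (suc m))
      where
      eq : ∀ b n m → b ℕ.+ n ℕ.* suc m ≡ b ℕ.+ n ℕ.+ n ℕ.* m
      eq = solve-∀

    weighted-⊛ : ∀ {b c Φ Ψ} → Weighted n b Φ → Weighted n c Ψ → Weighted n (b ℕ.+ c) (λ y → Φ y ⊛ Ψ y)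
    weighted-⊛ {b} {c} v w .at zero    = PK.poly-≤ (ℕ.≤-reflexive (eq b c n)) (PK.poly-* (v .at 0) (w .at 0))
      where
      eq : ∀ b c n → b ℕ.+ n ℕ.* 0 ℕ.+ (c ℕ.+ n ℕ.* 0) ≡ b ℕ.+ c ℕ.+ n ℕ.* 0
      eq = solve-∀
    weighted-⊛ {b} {c} v w .at (suc m) = PK.poly-+
      (PK.poly-≤ (ℕ.≤-reflexive (eq b c n m)) (PK.poly-* (v .at 0) (w .at (suc m))))
      (PK.poly-≤ (ℕ.≤-reflexive (eq′ b c n m)) (weighted-⊛ (weighted-tl v) w .at m))
      where
      eq : ∀ b c n m → b ℕ.+ n ℕ.* 0 ℕ.+ (c ℕ.+ n ℕ.* suc m) ≡ b ℕ.+ c ℕ.+ n ℕ.* suc m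
      eq = solve-∀
      eq′ : ∀ b c n m → b ℕ.+ n ℕ.+ c ℕ.+ n ℕ.* m ≡ b ℕ.+ c ℕ.+ n ℕ.* suc m
      eq′ = solve-∀

    weighted-^ : ∀ {b Φ} k → Weighted n b Φ → Weighted n (k ℕ.* b) (λ y → Φ y SP.^ k)
    weighted-^ zero    w = weighted-constant (PK.poly-ι 1#)
    weighted-^ (suc k) w = weighted-⊛ w (weighted-^ k w)

    weighted-^0 : ∀ {Φ} k → Weighted n 0 Φ → Weighted n 0 (λ y → Φ y SP.^ k)
    weighted-^0 {Φ} k w = ≡.subst (λ b → Weighted n b (λ y → Φ y SP.^ k)) (ℕ.*-zeroʳ k) (weighted-^ k w)

  Factors : Set
  Factors = List (Carrier × ℕ)

  value : Factors → Carrier → Carrier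
  value []             y = 1#
  value ((ρ , e) ∷ fs) y = (y + ρ) ^ e * value fs y

  valueₛ : Factors → Series → Series
  valueₛ []             s = SR.1#
  valueₛ ((ρ , e) ∷ fs) s = (s ⊕ constant ρ) SP.^ e ⊛ valueₛ fs s

  -- Every base once, y included. As the scale λ in y + λT it is divisible by each y + ρ, while its
  -- degree ignores the exponents.
  radical : Factors → Carrier → Carrier
  radical []             y = y
  radical ((ρ , e) ∷ fs) y = (y + ρ) * radical fs y

  valueₛ-at-0 : ∀ fs s → valueₛ fs s 0 ≈ value fs (s 0)
  valueₛ-at-0 []             s = refl
  valueₛ-at-0 ((ρ , e) ∷ fs) s = *-cong (^-at-0 (s ⊕ constant ρ) e) (valueₛ-at-0 fs s)

  poly-radical : ∀ fs → PK.IsPoly (suc (length fs)) (radical fs)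
  poly-radical []       = PK.poly-id
  poly-radical (f ∷ fs) = PK.poly-* {D = 1} (PK.poly-+ PK.poly-id (PK.poly-ι _)) (poly-radical fs)

  radical-≉0 : ∀ fs {y} → ¬ y ≈ 0# → All (λ f → ¬ y + proj₁ f ≈ 0#) fs → ¬ radical fs y ≈ 0#
  radical-≉0 []       y≉0 []       = y≉0
  radical-≉0 (f ∷ fs) y≉0 (z ∷ zs) = *-≉0 z (radical-≉0 fs y≉0 zs)

  poly-valueₛ : ∀ {q} fs → All (λ f → proj₂ f ≤ q) fs → PS.IsPoly (length fs ℕ.* q) (valueₛ fs)
  poly-valueₛ []             []       = PS.poly-ι 1#
  poly-valueₛ ((ρ , e) ∷ fs) (l ∷ ls) = PS.poly-* (PS.poly-≤ (ℕ.≤-trans (ℕ.≤-reflexive (ℕ.*-identityʳ e)) l)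
    (PS.poly-^ e (PS.poly-+ PS.poly-id (PS.poly-ι ρ)))) (poly-valueₛ fs ls)

  module _ (E : ℕ) where

    -- The unit U in y^E ∏ (y + ρ)^e · U, which is the value at y + λ T for λ = μ y ∏ (y + ρ).
    unit : Factors → (Carrier → Carrier) → Carrier → Series
    unit []             μ y = linear 1# (μ y) SP.^ E
    unit ((ρ , e) ∷ fs) μ y = linear 1# (μ y * radical fs y) SP.^ e ⊛ unit fs (λ y → μ y * (y + ρ)) y

    factor-^ : ∀ a h {l} e → l ≈ a * h → linear a l SP.^ e ≋ constant (a ^ e) ⊛ linear 1# h SP.^ e
    factor-^ a h {l} e l≈ = SRR.begin
      linear a l SP.^ e                        SRR.≈⟨ SP.^-congˡ e (SR.trans (linear-cong refl l≈) (linear-factor a h)) ⟩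
      (constant a ⊛ linear 1# h) SP.^ e        SRR.≈⟨ SP.^-distrib-* (constant a) (linear 1# h) e ⟩
      constant a SP.^ e ⊛ linear 1# h SP.^ e   SRR.≈⟨ SR.*-congʳ {x = linear 1# h SP.^ e} (constant-^ a e) ⟩
      constant (a ^ e) ⊛ linear 1# h SP.^ e    SRR.∎

    -- Since y + ρ divides λ, there is a polynomial h in y with y + ρ + λT = (y + ρ)(1 + hT). All of
    -- the high degree thus sits in the constant factor, which equals c at a solution. The function
    -- `μ` collects the factors of λ already passed, so that each step still sees the whole of λ.
    value-unit : ∀ fs μ y {l} → l ≈ μ y * radical fs y →
      linear y l SP.^ E ⊛ valueₛ fs (linear y l) ≋ constant (y ^ E * value fs y) ⊛ unit fs μ y
    value-unit [] μ y {l} l≈ = SRR.begin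
      linear y l SP.^ E ⊛ SR.1#                     SRR.≈⟨ SR.*-identityʳ (linear y l SP.^ E) ⟩
      linear y l SP.^ E                             SRR.≈⟨ factor-^ y (μ y) E (trans l≈ (*-comm _ _)) ⟩
      constant (y ^ E) ⊛ linear 1# (μ y) SP.^ E     SRR.≈⟨ SR.*-congʳ {x = linear 1# (μ y) SP.^ E} (CommAlgebra.ι-cong series (sym (*-identityʳ _))) ⟩
      constant (y ^ E * 1#) ⊛ linear 1# (μ y) SP.^ E SRR.∎
    value-unit ((ρ , e) ∷ fs) μ y {l} l≈ = SRR.begin
      linear y l SP.^ E ⊛ ((linear y l ⊕ constant ρ) SP.^ e ⊛ V)
        SRR.≈⟨ x∙yz≈y∙xz (linear y l SP.^ E) ((linear y l ⊕ constant ρ) SP.^ e) V ⟩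
      (linear y l ⊕ constant ρ) SP.^ e ⊛ (linear y l SP.^ E ⊛ V)
        SRR.≈⟨ SR.*-cong {(linear y l ⊕ constant ρ) SP.^ e} {constant ((y + ρ) ^ e) ⊛ A} {linear y l SP.^ E ⊛ V} {constant (y ^ E * value fs y) ⊛ U}
             (SR.trans (SP.^-congˡ e shift) (factor-^ (y + ρ) (μ y * radical fs y) e (trans l≈ (swap _ _ _))))
             (value-unit fs (λ y → μ y * (y + ρ)) y (trans l≈ (sym (*-assoc _ _ _)))) ⟩
      (constant ((y + ρ) ^ e) ⊛ A) ⊛ (constant (y ^ E * value fs y) ⊛ U)
        SRR.≈⟨ interchange (constant ((y + ρ) ^ e)) A (constant (y ^ E * value fs y)) U ⟩
      (constant ((y + ρ) ^ e) ⊛ constant (y ^ E * value fs y)) ⊛ (A ⊛ U)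
        SRR.≈⟨ SR.*-congʳ {x = A ⊛ U} (SR.trans (SR.sym (constant-* _ _)) (CommAlgebra.ι-cong series (swap _ _ _))) ⟩
      constant (y ^ E * ((y + ρ) ^ e * value fs y)) ⊛ (A ⊛ U) SRR.∎
      where
      open import Algebra.Properties.CommutativeSemigroup SR.*-commutativeSemigroup using (x∙yz≈y∙xz; interchange)
      V = valueₛ fs (linear y l)
      A = linear 1# (μ y * radical fs y) SP.^ e
      U = unit fs (λ y → μ y * (y + ρ)) y
      shift : linear y l ⊕ constant ρ ≋ linear (y + ρ) l
      shift zero    = refl
      shift (suc n) = +-identityʳ _
      swap : ∀ a b c → a * (b * c) ≈ b * (a * c)
      swap a b c = trans (sym (*-assoc a b c)) (trans (*-congʳ (*-comm a b)) (*-assoc b a c))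

    weighted-unit : ∀ {n d} fs μ → PK.IsPoly d μ → d ℕ.+ suc (length fs) ≤ n → Weighted n 0 (unit fs μ)
    weighted-unit {n} {d} [] μ p l = weighted-^0 E
      (weighted-linear (PK.poly-ι 1#) (PK.poly-≤ (ℕ.≤-trans (ℕ.m≤m+n d 1) l) p))
    weighted-unit {n} {d} ((ρ , e) ∷ fs) μ p l =
      weighted-⊛
        (weighted-^0 e
          (weighted-linear (PK.poly-ι 1#) (PK.poly-≤ (ℕ.≤-trans (ℕ.+-monoʳ-≤ d (ℕ.n≤1+n _)) l) (PK.poly-* p (poly-radical fs)))))
        (weighted-unit fs _ (PK.poly-* {E = 1} p (PK.poly-+ PK.poly-id (PK.poly-ι ρ)))
          (ℕ.≤-trans (ℕ.≤-reflexive (ℕ.+-assoc d 1 _)) l))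

  instance
    size-nonZero : NonZero size
    size-nonZero = ℕ.>-nonZero (ℕ.<⇒≤ 1<size)

  -- Stepanov's method: a combination of the X^w G(X)^j, where the exponents w are pairwise distinct and G(0) ≠ 0, that
  -- vanishes to order M at every y with y^E G(y) = c.
  module _ (fs : Factors) (E : ℕ) {{_ : NonZero E}} (σ c : Carrier) where

    -- For y = x + τ and σ = τ^q - τ, the third condition is x^q = x.
    Solution : Carrier → Set
    Solution y = ¬ y ≈ 0# × All (λ f → ¬ y + proj₁ f ≈ 0#) fs × y ^ size ≈ y + σ × y ^ E * value fs y ≈ c

    -- There are q B unknowns, one for each exponent w < q B. At a solution each of the first M
    -- expansion coefficients is a polynomial in y with at most E + B + n M coefficients; `count`
    -- says that making all of these vanish takes fewer equations than there are unknowns.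
    module _ (B M n J : ℕ) (M≤q : M ≤ size) (fs<n : suc (length fs) ≤ n) (q≤JE : size ≤ J ℕ.* E)
             (count : M ℕ.* (E ℕ.+ B ℕ.+ n ℕ.* M) < size ℕ.* B)
             (exponents : All (λ f → proj₂ f ≤ size) fs) (nonzero : All (λ f → ¬ proj₁ f ≈ 0#) fs) where
      private
        q = size
        W = q ℕ.* B
        -- With w = a + k q + j E, the relations y^q = y + σ and y^E G(y) = c turn y^w G(y)^j into
        -- y^a (y + σ)^k c^j, of degree below E + B. The power of G is tied to w, so each order of
        -- vanishing w at 0 occurs exactly once among the terms.
        k j a : ℕ → ℕ
        k w = w / q
        j w = (w % q) / E
        a w = (w % q) % E

        term : Series → ℕ → Series
        term s w = s SP.^ w ⊛ valueₛ fs s SP.^ j w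

        expansion : ℕ → Carrier → Series
        expansion w y = (linear y (radical fs y) SP.^ a w ⊛ constant ((y + σ) ^ k w)) ⊛ (constant c ⊛ unit E fs (λ _ → 1#) y) SP.^ j w

        decompose : ∀ w → w ≡ a w ℕ.+ k w ℕ.* q ℕ.+ j w ℕ.* E
        decompose w = ≡.trans (m≡m%n+[m/n]*n w q) (≡.trans (≡.cong (ℕ._+ k w ℕ.* q) (m≡m%n+[m/n]*n (w % q) E)) (eq (a w) (j w ℕ.* E) (k w ℕ.* q)))
          where
          eq : ∀ x y z → x ℕ.+ y ℕ.+ z ≡ x ℕ.+ z ℕ.+ y
          eq = solve-∀

        j≤J : ∀ w → j w ≤ J
        j≤J w = ℕ.≤-trans (/-monoˡ-≤ E (ℕ.≤-trans (m%n≤n w q) q≤JE)) (ℕ.≤-reflexive (m*n/n≡m J E))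

        weighted-expansion : ∀ w → Weighted n (a w ℕ.+ k w) (expansion w)
        weighted-expansion w = ≡.subst (λ b → Weighted n b (expansion w)) (ℕ.+-identityʳ _)
          (weighted-⊛
            (weighted-⊛
              (≡.subst (λ b → Weighted n b (λ y → linear y (radical fs y) SP.^ a w)) (ℕ.*-identityʳ (a w))
                (weighted-^ (a w) (weighted-linear PK.poly-id (PK.poly-≤ fs<n (poly-radical fs)))))
              (weighted-constant (≡.subst (λ b → PK.IsPoly b (λ y → (y + σ) ^ k w)) (ℕ.*-identityʳ (k w))
                (PK.poly-^ (k w) (PK.poly-+ PK.poly-id (PK.poly-ι σ))))))
            (weighted-^0 (j w) (weighted-⊛ (weighted-constant (PK.poly-ι c)) (weighted-unit E {d = 0} fs (λ _ → 1#) (PK.poly-ι 1#) fs<n))))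

        term≈expansion : ∀ {y} → Solution y → ∀ w → term (linear y (radical fs y)) w ≈[ M ] expansion w y
        term≈expansion {y} (y≉0 , _ , y^q , y^E) w m m<M = begin
          (η SP.^ w ⊛ G SP.^ j w) m ≈⟨ SR.*-congʳ {x = G SP.^ j w} split m ⟩
          ((η SP.^ a w ⊛ (η SP.^ q) SP.^ k w) ⊛ (η SP.^ E) SP.^ j w ⊛ G SP.^ j w) m
            ≈⟨ SR.*-assoc (η SP.^ a w ⊛ (η SP.^ q) SP.^ k w) ((η SP.^ E) SP.^ j w) (G SP.^ j w) m ⟩
          ((η SP.^ a w ⊛ (η SP.^ q) SP.^ k w) ⊛ ((η SP.^ E) SP.^ j w ⊛ G SP.^ j w)) m
            ≈⟨ ⊛-cong[] {M} {η SP.^ a w ⊛ (η SP.^ q) SP.^ k w} {η SP.^ a w ⊛ constant ((y + σ) ^ k w)}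
                 (⊛-cong[] {M} {η SP.^ a w} {η SP.^ a w} (λ _ _ → refl) powers) (λ i _ → unit-power i) m m<M ⟩
          expansion w y m ∎
          where
          η = linear y (radical fs y)
          G = valueₛ fs η
          split : η SP.^ w ≋ (η SP.^ a w ⊛ (η SP.^ q) SP.^ k w) ⊛ (η SP.^ E) SP.^ j w
          split = SRR.begin
            η SP.^ w SRR.≈⟨ SP.^-congʳ η (≡.trans (decompose w) (≡.cong₂ ℕ._+_ (≡.cong (a w ℕ.+_) (ℕ.*-comm (k w) q)) (ℕ.*-comm (j w) E))) ⟩
            η SP.^ (a w ℕ.+ q ℕ.* k w ℕ.+ E ℕ.* j w) SRR.≈⟨ SP.^-homo-* η (a w ℕ.+ q ℕ.* k w) (E ℕ.* j w) ⟩
            η SP.^ (a w ℕ.+ q ℕ.* k w) ⊛ η SP.^ (E ℕ.* j w)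
              SRR.≈⟨ SR.*-cong {η SP.^ (a w ℕ.+ q ℕ.* k w)} {η SP.^ a w ⊛ η SP.^ (q ℕ.* k w)} {η SP.^ (E ℕ.* j w)} {(η SP.^ E) SP.^ j w}
                     (SP.^-homo-* η (a w) (q ℕ.* k w)) (SR.sym (SP.^-assocʳ η E (j w))) ⟩
            (η SP.^ a w ⊛ η SP.^ (q ℕ.* k w)) ⊛ (η SP.^ E) SP.^ j w
              SRR.≈⟨ SR.*-congʳ {x = (η SP.^ E) SP.^ j w} (SR.*-congˡ {x = η SP.^ a w} (SR.sym (SP.^-assocʳ η q (k w)))) ⟩
            (η SP.^ a w ⊛ (η SP.^ q) SP.^ k w) ⊛ (η SP.^ E) SP.^ j w SRR.∎
          powers : (η SP.^ q) SP.^ k w ≈[ M ] constant ((y + σ) ^ k w)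
          powers i i<M = trans (^-cong[] {M} (k w) (λ l l<M → trans (linear-^size (radical fs y) y≉0 l (ℕ.<-≤-trans l<M M≤q)) (CommAlgebra.ι-cong series y^q l)) i i<M)
            (constant-^ (y + σ) (k w) i)
          unit-power : (η SP.^ E) SP.^ j w ⊛ G SP.^ j w ≋ (constant c ⊛ unit E fs (λ _ → 1#) y) SP.^ j w
          unit-power = SR.trans (SR.sym (SP.^-distrib-* (η SP.^ E) G (j w))) (SP.^-congˡ (j w)
            (SR.trans (value-unit E fs (λ _ → 1#) y (sym (*-identityˡ _))) (SR.*-congʳ {x = unit E fs (λ _ → 1#) y} (CommAlgebra.ι-cong series y^E))))

        -- `nontrivial-relation` wants the length bound for every w. Beyond W the degree may be
        -- larger, so the entry is made empty there; only w < W enters the sum.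
        coefficients : ℕ → ℕ → Poly
        coefficients w m with w ℕ.<? W
        ... | yes _ = proj₁ (weighted-expansion w .at m)
        ... | no _  = []

        length-coefficients : ∀ w m → m < M → length (coefficients w m) ≤ E ℕ.+ B ℕ.+ n ℕ.* M
        length-coefficients w m m<M with w ℕ.<? W
        ... | no _    = z≤n
        ... | yes w<W = ℕ.≤-trans (proj₁ (proj₂ (weighted-expansion w .at m)))
          (ℕ.+-mono-≤ (ℕ.+-mono-≤ (m%n<n (w % q) E) (ℕ.<⇒≤ (m<n*o⇒m/o<n (≡.subst (w <_) (ℕ.*-comm q B) w<W)))) (ℕ.*-monoʳ-≤ n (ℕ.<⇒≤ m<M)))

        eval-coefficients : ∀ w m y → w < W → expansion w y m ≈ PK.eval (coefficients w m) y
        eval-coefficients w m y w<W with w ℕ.<? W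
        ... | yes w<W′ = proj₂ (proj₂ (weighted-expansion w .at m)) y
        ... | no w≮W   = ⊥-elim (w≮W w<W)

      -- If the zeros, counted M-fold, exceeded the degree, the combination R would be the zero
      -- polynomial. Its value at T would then vanish too, and as G(0) ≠ 0, `triangular` would make
      -- the relation trivial.
      stepanov : ∀ ys → Distinct ys → All Solution ys → length ys ℕ.* M ≤ q ℕ.* B ℕ.+ J ℕ.* (n ℕ.* q)
      stepanov ys d sols with nontrivial-relation W M _ count coefficients length-coefficients
      ... | δ , δ≉0 , relation = ℕ.≮⇒≥ λ D<NM → δ≉0 (triangular W δ (λ w → valueₛ fs T SP.^ j w)
          (λ w z → value-T w (trans (sym (^-at-0 (valueₛ fs T) (j w))) z))
          (SR.trans (proj₂ (proj₂ R-poly) T) (PS.eval-zero (proj₁ R-poly) T (R-zero D<NM))))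
        where
        R : Series → Series
        R s = ∑ₛ W (λ w → constant (δ w) ⊛ term s w)

        R-poly : PS.IsPoly (q ℕ.* B ℕ.+ J ℕ.* (n ℕ.* q)) R
        R-poly = poly-∑ₛ W λ w w<W → PS.poly-* {D = 0} (PS.poly-ι (δ w))
          (PS.poly-* (PS.poly-≤ (ℕ.≤-trans (ℕ.≤-reflexive (ℕ.*-identityʳ w)) (ℕ.<⇒≤ w<W)) (PS.poly-^ w PS.poly-id))
            (PS.poly-≤ (ℕ.*-mono-≤ (j≤J w) (ℕ.*-monoˡ-≤ q (ℕ.≤-trans (ℕ.n≤1+n _) fs<n))) (PS.poly-^ (j w) (poly-valueₛ fs exponents))))

        value-T : ∀ w → ¬ valueₛ fs T 0 ^ j w ≈ 0#
        value-T w = ^-≉0 (j w) λ z → value-0 nonzero (trans (sym (valueₛ-at-0 fs T)) z)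
          where
          value-0 : ∀ {fs} → All (λ f → ¬ proj₁ f ≈ 0#) fs → ¬ value fs 0# ≈ 0#
          value-0 []               = 1≉0
          value-0 {f ∷ _} (z ∷ zs) = *-≉0 (^-≉0 (proj₂ f) (λ e → z (trans (sym (+-identityˡ _)) e))) (value-0 zs)

        R-vanishes : ∀ {y} → Solution y → PS.eval (proj₁ R-poly) (linear y (radical fs y)) ≈[ M ] SR.0#
        R-vanishes {y} sol m m<M = begin
          PS.eval (proj₁ R-poly) η m ≈⟨ proj₂ (proj₂ R-poly) η m ⟨
          ∑ W (λ w → (constant (δ w) ⊛ term η w) m) ≈⟨ ∑-cong W (λ w w<W → trans (constant-⊛ (δ w) (term η w) m)
            (*-congˡ (trans (term≈expansion sol w m m<M) (eval-coefficients w m y w<W)))) ⟩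
          ∑ W (λ w → δ w * PK.eval (coefficients w m) y) ≈⟨ relation m m<M y ⟩
          0# ∎
          where η = linear y (radical fs y)

        R-zero : suc (q ℕ.* B ℕ.+ J ℕ.* (n ℕ.* q)) ≤ length ys ℕ.* M → All (_≈ 0#) (proj₁ R-poly)
        R-zero D<NM = roots-with-multiplicity (radical fs) M ys (proj₁ R-poly) d
          (All.map (λ (y≉0 , z , _) → radical-≉0 fs y≉0 z) sols) (All.map R-vanishes sols)
          (ℕ.≤-trans (proj₁ (proj₂ R-poly)) D<NM)

-- Choice of the parameters

-- M is slightly less than d B, so that N M ≤ q B + lower order terms gives N ≤ q / d + lower order terms;
-- the loss δ makes room for the equations beyond the M E leading ones.
module Parameters (n t q d E B : ℕ) (n+2≤t : 2 ℕ.+ n ≤ t) (1≤n : 1 ≤ n) (1≤d : 1 ≤ d) (d≤tⁿ : d ≤ t ℕ.^ n)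
  (B≡ : B ≡ t ℕ.^ (4 ℕ.* n)) (t^8n≤q : t ℕ.^ (8 ℕ.* n) ≤ q) (dE≤q : d ℕ.* E ≤ q) (q≤d+dE : q ≤ d ℕ.* suc E) where
  open import Data.Nat using (_+_; _*_; _^_; _∸_)
  open ℕ.≤-Reasoning

  instance
    t-nonZero : NonZero t
    t-nonZero = ℕ.>-nonZero (ℕ.≤-trans (s≤s z≤n) n+2≤t)
    d-nonZero : NonZero d
    d-nonZero = ℕ.>-nonZero 1≤d

  -- In `count`, the part (1 + n) d^3 of `δ` pays for the terms B + n M, and the remaining d^3 makes
  -- the inequality strict. `J` is 2 d because q ≤ d (E + 1) ≤ 2 d E. In `C`, a summand 2 n comes
  -- from the degree of the powers of G, and 2 + n comes from `δ`.
  C δ M J : ℕ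
  C = 3 * n + 2
  δ = (2 + n) * (d * d * d)
  M = d * B ∸ δ
  J = 2 * d

  B-nonZero : NonZero B
  B-nonZero = ≡.subst NonZero (≡.sym B≡) (ℕ.m^n≢0 t (4 * n))

  BB≤q : B * B ≤ q
  BB≤q = begin
    B * B                         ≡⟨ ≡.cong₂ _*_ B≡ B≡ ⟩
    t ^ (4 * n) * t ^ (4 * n)     ≡⟨ ℕ.^-distribˡ-+-* t (4 * n) (4 * n) ⟨
    t ^ (4 * n + 4 * n)           ≡⟨ ≡.cong (t ^_) (eq n) ⟩
    t ^ (8 * n)                   ≤⟨ t^8n≤q ⟩
    q                             ∎
    where
    eq : ∀ n → 4 * n + 4 * n ≡ 8 * n
    eq = solve-∀

  -- The origin of the exponent 4n of B: d^3 takes 3n, and t ≤ t^n takes one more n.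
  tddd≤B : t * (d * d * d) ≤ B
  tddd≤B = begin
    t * (d * d * d)                          ≤⟨ ℕ.*-monoʳ-≤ t (ℕ.*-mono-≤ (ℕ.*-mono-≤ d≤tⁿ d≤tⁿ) d≤tⁿ) ⟩
    t * (t ^ n * t ^ n * t ^ n)              ≤⟨ ℕ.*-monoˡ-≤ (t ^ n * t ^ n * t ^ n) (≡.subst (_≤ t ^ n) (ℕ.*-identityʳ t) (ℕ.^-monoʳ-≤ t 1≤n)) ⟩
    t ^ n * (t ^ n * t ^ n * t ^ n)          ≡⟨ ≡.cong (t ^ n *_) (≡.trans (≡.cong (_* t ^ n) (≡.sym (ℕ.^-distribˡ-+-* t n n))) (≡.sym (ℕ.^-distribˡ-+-* t (n + n) n))) ⟩
    t ^ n * t ^ (n + n + n)                  ≡⟨ ℕ.^-distribˡ-+-* t n (n + n + n) ⟨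
    t ^ (n + (n + n + n))                    ≡⟨ ≡.cong (t ^_) (eq n) ⟩
    t ^ (4 * n)                              ≡⟨ B≡ ⟨
    B                                        ∎
    where
    eq : ∀ n → n + (n + n + n) ≡ 4 * n
    eq = solve-∀

  δ≤B : δ ≤ B
  δ≤B = ℕ.≤-trans (ℕ.*-monoˡ-≤ (d * d * d) n+2≤t) tddd≤B

  M+δ≡ : M + δ ≡ d * B
  M+δ≡ = ℕ.m∸n+n≡m (ℕ.≤-trans δ≤B (ℕ.m≤n*m B d))

  M≤dB : M ≤ d * B
  M≤dB = ℕ.m∸n≤m (d * B) δ

  d≤B : d ≤ B
  d≤B = ℕ.≤-trans (ℕ.≤-trans (ℕ.m≤n*m d (t * (d * d)) {{ℕ.m*n≢0 t (d * d) {{t-nonZero}} {{ℕ.m*n≢0 d d}}}}) (ℕ.≤-reflexive (ℕ.*-assoc t (d * d) d))) tddd≤B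

  M≤q : M ≤ q
  M≤q = ℕ.≤-trans M≤dB (ℕ.≤-trans (ℕ.*-monoˡ-≤ B d≤B) BB≤q)

  d<q : d < q
  d<q = begin-strict
    d              <⟨ ℕ.m<m*n d t (ℕ.≤-trans (s≤s (s≤s z≤n)) n+2≤t) ⟩
    d * t          ≡⟨ ℕ.*-comm d t ⟩
    t * d          ≤⟨ ℕ.*-monoʳ-≤ t (ℕ.≤-trans (ℕ.m≤m*n d (d * d) {{ℕ.m*n≢0 d d}}) (ℕ.≤-reflexive (≡.sym (ℕ.*-assoc d d d)))) ⟩
    t * (d * d * d) ≤⟨ tddd≤B ⟩
    B              ≤⟨ ℕ.m≤m*n B B {{B-nonZero}} ⟩
    B * B          ≤⟨ BB≤q ⟩
    q              ∎

  1≤E : 1 ≤ E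
  1≤E with E ℕ.≟ 0
  ... | no E≢0 = ℕ.n≢0⇒n>0 E≢0
  ... | yes E≡0 = ⊥-elim (ℕ.<⇒≱ d<q (ℕ.≤-trans q≤d+dE (ℕ.≤-reflexive (≡.trans (≡.cong (λ e → d * suc e) E≡0) (ℕ.*-identityʳ d)))))

  q≤JE : q ≤ J * E
  q≤JE = begin
    q             ≤⟨ q≤d+dE ⟩
    d * suc E     ≤⟨ ℕ.*-monoʳ-≤ d (ℕ.+-monoˡ-≤ E 1≤E) ⟩
    d * (E + E)   ≡⟨ eq d E ⟩
    2 * d * E     ∎
    where
    eq : ∀ d E → d * (E + E) ≡ 2 * d * E
    eq = solve-∀

  count : M * (E + B + n * M) < q * B
  count = ℕ.*-cancelˡ-< d _ _ (begin-strict
    d * (M * (E + B + n * M))                       ≡⟨ eq₁ d M E B n ⟩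
    M * (d * E) + d * M * (B + n * M)               ≤⟨ ℕ.+-mono-≤ (ℕ.*-monoʳ-≤ M dE≤q)
                                                         (ℕ.*-mono-≤ (ℕ.*-monoʳ-≤ d M≤dB) (ℕ.+-monoʳ-≤ B (ℕ.*-monoʳ-≤ n M≤dB))) ⟩
    M * q + d * (d * B) * (B + n * (d * B))         ≡⟨ eq₂ d B n (M * q) ⟩
    M * q + (d * d + n * (d * d * d)) * (B * B)     ≤⟨ ℕ.+-monoʳ-≤ (M * q) (ℕ.*-mono-≤ (ℕ.+-monoˡ-≤ (n * (d * d * d)) (ℕ.m≤m*n (d * d) d)) BB≤q) ⟩
    M * q + (d * d * d + n * (d * d * d)) * q       <⟨ ℕ.+-monoʳ-< (M * q) (ℕ.*-monoˡ-< q {{ℕ.>-nonZero (ℕ.≤-trans (s≤s z≤n) d<q)}}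
                                                         (ℕ.m<n+m _ (ℕ.>-nonZero⁻¹ (d * d * d) {{ℕ.m*n≢0 (d * d) d {{ℕ.m*n≢0 d d}}}}))) ⟩
    M * q + δ * q                                   ≡⟨ ℕ.*-distribʳ-+ q M δ ⟨
    (M + δ) * q                                     ≡⟨ ≡.cong (_* q) M+δ≡ ⟩
    d * B * q                                       ≡⟨ eq₃ d B q ⟩
    d * (q * B)                                     ∎)
    where
    eq₁ : ∀ d M E B n → d * (M * (E + B + n * M)) ≡ M * (d * E) + d * M * (B + n * M)
    eq₁ = solve-∀
    eq₂ : ∀ d B n x → x + d * (d * B) * (B + n * (d * B)) ≡ x + (d * d + n * (d * d * d)) * (B * B)
    eq₂ = solve-∀
    eq₃ : ∀ d B q → d * B * q ≡ d * (q * B)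
    eq₃ = solve-∀

  -- After division by t d this reads N ≤ q / d + C q / (t d). In N d B = N M + N δ the first
  -- summand is bounded by Stepanov's method, and for the small second one N ≤ q is enough.
  conclusion : ∀ {N} → N ≤ q → N * M ≤ q * B + J * (n * q) → t * (d * N) ≤ t * q + C * q
  conclusion {N} N≤q NM≤ = ℕ.*-cancelʳ-≤ _ _ B {{B-nonZero}} (begin
    t * (d * N) * B                               ≡⟨ eq₁ t d N B ⟩
    t * (N * (d * B))                             ≡⟨ ≡.cong (λ x → t * (N * x)) M+δ≡ ⟨
    t * (N * (M + δ))                             ≡⟨ ≡.cong (t *_) (ℕ.*-distribˡ-+ N M δ) ⟩
    t * (N * M + N * δ)                           ≤⟨ ℕ.*-monoʳ-≤ t (ℕ.+-mono-≤ NM≤ (ℕ.*-monoˡ-≤ δ N≤q)) ⟩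
    t * (q * B + 2 * d * (n * q) + q * δ)         ≡⟨ eq₂ t q B d n (d * d * d) ⟩
    t * q * B + q * (2 * n * (t * d) + (2 + n) * (t * (d * d * d)))
      ≤⟨ ℕ.+-monoʳ-≤ (t * q * B) (ℕ.*-monoʳ-≤ q (ℕ.+-mono-≤ (ℕ.*-monoʳ-≤ (2 * n) (ℕ.≤-trans (ℕ.*-monoʳ-≤ t (ℕ.≤-trans (ℕ.m≤m*n d (d * d) {{ℕ.m*n≢0 d d}}) (ℕ.≤-reflexive (≡.sym (ℕ.*-assoc d d d))))) tddd≤B)) (ℕ.*-monoʳ-≤ (2 + n) tddd≤B))) ⟩
    t * q * B + q * (2 * n * B + (2 + n) * B)     ≡⟨ eq₃ t q B n ⟩
    (t * q + C * q) * B                           ∎)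
    where
    eq₁ : ∀ t d N B → t * (d * N) * B ≡ t * (N * (d * B))
    eq₁ = solve-∀
    eq₂ : ∀ t q B d n x → t * (q * B + 2 * d * (n * q) + q * ((2 + n) * x)) ≡ t * q * B + q * (2 * n * (t * d) + (2 + n) * (t * x))
    eq₂ = solve-∀
    eq₃ : ∀ t q B n → t * q * B + q * (2 * n * B + (2 + n) * B) ≡ (t * q + (3 * n + 2) * q) * B
    eq₃ = solve-∀

-- Solutions in one coset of the d-th powers

module CosetBound (K : FiniteField) (F : Subfield K) (m : ℕ) (1≤m : 1 ≤ m)
  (card≡ : FiniteField.card K ≡ Subfield.size F ℕ.^ suc m) (θ : FiniteField.Carrier K) (gen : Generates K F θ) where
  open FieldFacts K
  open SubfieldFacts F
  open Frobenius K F
  open Conjugates (suc m) card≡ θ gen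
  open StepanovBound K F
  open import Relation.Binary.Reasoning.Setoid setoid

  -- The conjugate that carries the leading digit. The coordinate y = x + τ moves its root to 0,
  -- where it contributes y^E, and the other factors do not vanish at y = 0 because the conjugates
  -- are distinct.
  τ : Carrier
  τ = conjugate m

  -- The base q digits of e, attached to the conjugates from the i-th one on, in the coordinate y = x + τ.
  digits : ℕ → ℕ → ℕ → Factors
  digits zero    i e = []
  digits (suc k) i e = (conjugate i + - τ , e % size) ∷ digits k (suc i) (e / size)

  leading : ℕ → ℕ → ℕ
  leading zero    e = e
  leading (suc k) e = leading k (e / size)

  length-digits : ∀ k i e → length (digits k i e) ≡ k
  length-digits zero    i e = ≡.refl
  length-digits (suc k) i e = ≡.cong suc (length-digits k (suc i) (e / size))

  digits≤size : ∀ k i e → All (λ f → proj₂ f ≤ size) (digits k i e)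
  digits≤size zero    i e = []
  digits≤size (suc k) i e = ℕ.<⇒≤ (m%n<n e size) ∷ digits≤size k (suc i) (e / size)

  digits-All : ∀ {P : Carrier → Set} → (∀ i → i < m → P (conjugate i + - τ)) → ∀ k i e → i ℕ.+ k ≤ m → All (λ f → P (proj₁ f)) (digits k i e)
  digits-All p zero    i e _ = []
  digits-All p (suc k) i e l =
    p i (ℕ.≤-trans (ℕ.≤-trans (s≤s (ℕ.m≤m+n i k)) (ℕ.≤-reflexive (≡.sym (ℕ.+-suc i k)))) l)
    ∷ digits-All p k (suc i) (e / size) (ℕ.≤-trans (ℕ.≤-reflexive (≡.sym (ℕ.+-suc i k))) l)

  leading-lower : ∀ k e → leading k e ℕ.* size ℕ.^ k ≤ e
  leading-lower zero    e = ℕ.≤-reflexive (ℕ.*-identityʳ e)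
  leading-lower (suc k) e = ℕ.≤-trans (ℕ.≤-reflexive (eq (leading k (e / size)) size (size ℕ.^ k)))
    (ℕ.≤-trans (ℕ.*-monoˡ-≤ size (leading-lower k (e / size))) (m/n*n≤m e size))
    where
    eq : ∀ a q b → a ℕ.* (q ℕ.* b) ≡ a ℕ.* b ℕ.* q
    eq = solve-∀

  leading-upper : ∀ k e → e < suc (leading k e) ℕ.* size ℕ.^ k
  leading-upper zero    e = ℕ.≤-reflexive (≡.sym (ℕ.*-identityʳ (suc e)))
  leading-upper (suc k) e = ℕ.<-≤-trans
    (≡.subst (_< suc (e / size) ℕ.* size) (≡.sym (m≡m%n+[m/n]*n e size)) (ℕ.+-monoˡ-< (e / size ℕ.* size) (m%n<n e size)))
    (ℕ.≤-trans (ℕ.*-monoˡ-≤ size (leading-upper k (e / size))) (ℕ.≤-reflexive (eq (suc (leading k (e / size))) size (size ℕ.^ k))))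
    where
    eq : ∀ a q b → a ℕ.* b ℕ.* q ≡ a ℕ.* (q ℕ.* b)
    eq = solve-∀

  translate : ∀ x i → x + τ + (conjugate i + - τ) ≈ conjugate i + x
  translate x i = begin
    x + τ + (conjugate i + - τ) ≈⟨ +-congˡ (+-comm _ _) ⟩
    x + τ + (- τ + conjugate i) ≈⟨ +-assoc _ _ _ ⟩
    x + (τ + (- τ + conjugate i)) ≈⟨ +-congˡ (trans (sym (+-assoc _ _ _)) (trans (+-congʳ (-‿inverseʳ τ)) (+-identityˡ _))) ⟩
    x + conjugate i             ≈⟨ +-comm _ _ ⟩
    conjugate i + x             ∎

  conjugate-suc : ∀ i {x} → mem x → (conjugate i + x) ^ size ≈ conjugate (suc i) + x
  conjugate-suc i {x} mx = begin
    (conjugate i + x) ^ size         ≈⟨ frobenius _ _ ⟩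
    conjugate i ^ size + x ^ size    ≈⟨ +-cong (trans (^-assocʳ θ (size ℕ.^ i) size) (^-congʳ θ (ℕ.*-comm (size ℕ.^ i) size))) (^size mx) ⟩
    conjugate (suc i) + x            ∎

  -- As x lies in F, the q-th power of θ^(q^i) + x is θ^(q^(i + 1)) + x. Each digit is spent on the
  -- current conjugate, and the quotient of the exponent passes to the next one.
  value-digits : ∀ k i e {x} → mem x → (conjugate i + x) ^ e ≈ (conjugate (i ℕ.+ k) + x) ^ leading k e * value (digits k i e) (x + τ)
  value-digits zero    i e {x} mx = sym (trans (*-identityʳ _) (^-congˡ e (+-congʳ (^-congʳ θ (≡.cong (size ℕ.^_) (ℕ.+-identityʳ i))))))
  value-digits (suc k) i e {x} mx = begin
    z ^ e                             ≈⟨ ^-congʳ z (≡.trans (m≡m%n+[m/n]*n e size) (≡.cong (e % size ℕ.+_) (ℕ.*-comm (e / size) size))) ⟩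
    z ^ (e % size ℕ.+ size ℕ.* (e / size))         ≈⟨ ^-homo-* z (e % size) _ ⟩
    z ^ (e % size) * z ^ (size ℕ.* (e / size))     ≈⟨ *-cong (^-congˡ (e % size) (sym (translate x i)))
                                                      (trans (sym (^-assocʳ z size (e / size))) (^-congˡ (e / size) (conjugate-suc i mx))) ⟩
    u * (conjugate (suc i) + x) ^ (e / size)       ≈⟨ *-congˡ (value-digits k (suc i) (e / size) mx) ⟩
    u * ((conjugate (suc i ℕ.+ k) + x) ^ leading k (e / size) * V) ≈⟨ trans (sym (*-assoc _ _ _)) (trans (*-congʳ (*-comm _ _)) (*-assoc _ _ _)) ⟩
    (conjugate (suc i ℕ.+ k) + x) ^ leading k (e / size) * (u * V)
      ≈⟨ *-congʳ (^-congˡ (leading k (e / size)) (+-congʳ (^-congʳ θ (≡.cong (size ℕ.^_) (≡.sym (ℕ.+-suc i k)))))) ⟩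
    (conjugate (i ℕ.+ suc k) + x) ^ leading k (e / size) * (u * V) ∎
    where
    z = conjugate i + x
    u = (x + τ + (conjugate i + - τ)) ^ (e % size)
    V = value (digits k (suc i) (e / size)) (x + τ)

  -- Comparing d e + 1 = q^n with `leading-lower` and `leading-upper` gives d E ≤ q ≤ d (E + 1), the
  -- two estimates of the leading digit on which `Parameters` rests.
  coset-bound : ∀ {t d e} xs c → Distinct xs → All mem xs → All (λ x → (θ + x) ^ e ≈ c) xs →
    3 ℕ.+ m ≤ t → t ℕ.^ (8 ℕ.* suc m) ≤ size → 1 ≤ d → d ≤ t ℕ.^ suc m → d ℕ.* e ≡ card ℕ.∸ 1 →
    t ℕ.* (d ℕ.* length xs) ≤ t ℕ.* size ℕ.+ (3 ℕ.* suc m ℕ.+ 2) ℕ.* size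
  coset-bound {t} {d} {e} xs c distinct-xs mem-xs c-xs m+3≤t t^≤q 1≤d d≤ de≡ = P.conclusion
    (distinct-⊆-length distinct-xs (All.map ∈members mem-xs))
    (≡.subst (λ N → N ℕ.* P.M ≤ size ℕ.* B ℕ.+ P.J ℕ.* (suc m ℕ.* size)) (List.length-map (_+ τ) xs)
      (stepanov fs E {{ℕ.>-nonZero P.1≤E}} σ c B P.M (suc m) P.J P.M≤q (ℕ.≤-reflexive (≡.cong suc (length-digits m 0 e))) P.q≤JE P.count
        (digits≤size m 0 e) (digits-All ρ≉0 m 0 e ℕ.≤-refl) (map (_+ τ) xs)
        (AllPairs.map⁺ (AllPairs.map (λ ne p → ne (∙-cancelʳ τ _ _ p)) distinct-xs))
        (All.map⁺ (All.zipWith solution (mem-xs , c-xs)))))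
    where
    open import Algebra.Properties.Group +-group using (∙-cancelʳ)
    E = leading m e
    B = t ℕ.^ (4 ℕ.* suc m)
    fs = digits m 0 e
    σ = τ ^ size + - τ
    q^m-nonZero : NonZero (size ℕ.^ m)
    q^m-nonZero = ℕ.m^n≢0 size m
    suc-Z : suc (d ℕ.* e) ≡ size ℕ.^ suc m
    suc-Z = ≡.trans (≡.cong suc de≡) (≡.trans (ℕ.m+[n∸m]≡n (ℕ.<⇒≤ 1<card)) card≡)
    dE≤q : d ℕ.* E ≤ size
    dE≤q = ℕ.*-cancelʳ-≤ _ _ (size ℕ.^ m) {{q^m-nonZero}} (ℕ.≤-trans (ℕ.≤-reflexive (ℕ.*-assoc d E _))
      (ℕ.≤-trans (ℕ.*-monoʳ-≤ d (leading-lower m e)) (ℕ.≤-trans (ℕ.n≤1+n _) (ℕ.≤-reflexive suc-Z))))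
    q≤d+dE : size ≤ d ℕ.* suc E
    q≤d+dE = ℕ.*-cancelʳ-≤ _ _ (size ℕ.^ m) {{q^m-nonZero}} (ℕ.≤-trans (ℕ.≤-reflexive (≡.sym suc-Z))
      (ℕ.≤-trans (ℕ.*-monoʳ-< d {{ℕ.>-nonZero 1≤d}} (leading-upper m e)) (ℕ.≤-reflexive (≡.sym (ℕ.*-assoc d (suc E) _)))))
    module P = Parameters (suc m) t size d E B m+3≤t (s≤s z≤n) 1≤d d≤ ≡.refl t^≤q dE≤q q≤d+dE
    ρ≉0 : ∀ i → i < m → ¬ conjugate i + - τ ≈ 0#
    ρ≉0 i i<m p = conjugate-distinct i<m (ℕ.n<1+n m) (x∙y⁻¹≈ε⇒x≈y _ _ p)
    solution : ∀ {x} → mem x × (θ + x) ^ e ≈ c → Solution fs E {{ℕ.>-nonZero P.1≤E}} σ c (x + τ)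
    solution {x} (mx , r) =
      (λ p → conjugate+x≉0 (s≤s 1≤m) m mx (trans (+-comm _ _) p)) ,
      digits-All (λ i _ p → conjugate+x≉0 (s≤s 1≤m) i mx (trans (sym (translate x i)) p)) m 0 e ℕ.≤-refl ,
      (begin
        (x + τ) ^ size                ≈⟨ frobenius x τ ⟩
        x ^ size + τ ^ size           ≈⟨ +-cong (^size mx) (sym (trans (+-congˡ (+-comm _ _)) (trans (sym (+-assoc _ _ _)) (trans (+-congʳ (-‿inverseʳ τ)) (+-identityˡ _))))) ⟩
        x + (τ + σ)                   ≈⟨ +-assoc _ _ _ ⟨
        x + τ + σ                     ∎) ,
      (begin
        (x + τ) ^ E * value fs (x + τ)           ≈⟨ *-congʳ (^-congˡ E (+-comm _ _)) ⟩
        (conjugate m + x) ^ E * value fs (x + τ) ≈⟨ value-digits m 0 e mx ⟨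
        (conjugate 0 + x) ^ e                    ≈⟨ ^-congˡ e (+-congʳ (*-identityʳ θ)) ⟩
        (θ + x) ^ e                              ≈⟨ r ⟩
        c                                        ∎)

-- Counting list entries by predicates

[m*n]^k≡m^k*n^k : ∀ m n k → (m ℕ.* n) ℕ.^ k ≡ m ℕ.^ k ℕ.* n ℕ.^ k
[m*n]^k≡m^k*n^k m n zero    = ≡.refl
[m*n]^k≡m^k*n^k m n (suc k) = ≡.trans (≡.cong (m ℕ.* n ℕ.*_) ([m*n]^k≡m^k*n^k m n k)) (ℕ.[m*n]*[o*p]≡[m*o]*[n*p] m n (m ℕ.^ k) (n ℕ.^ k))

module Counting {A : Set} where

  count : {P : A → Set} → Decidable P → List A → ℕ
  count P? xs = length (filter P? xs)

  count-accept : ∀ {P : A → Set} (P? : Decidable P) {x xs} → P x → count P? (x ∷ xs) ≡ suc (count P? xs)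
  count-accept P? p = ≡.cong length (List.filter-accept P? p)

  count-reject : ∀ {P : A → Set} (P? : Decidable P) {x xs} → ¬ P x → count P? (x ∷ xs) ≡ count P? xs
  count-reject P? ¬p = ≡.cong length (List.filter-reject P? ¬p)

  count-⊎ : ∀ {P Q R : A → Set} (P? : Decidable P) (Q? : Decidable Q) (R? : Decidable R) →
    (∀ {x} → P x → Q x ⊎ R x) → (∀ {x} → Q x → P x) → (∀ {x} → R x → P x) → (∀ {x} → Q x → ¬ R x) →
    ∀ xs → count P? xs ≡ count Q? xs ℕ.+ count R? xs
  count-⊎ P? Q? R? split Q⊆P R⊆P disjoint []       = ≡.refl
  count-⊎ P? Q? R? split Q⊆P R⊆P disjoint (x ∷ xs) with ih ← count-⊎ P? Q? R? split Q⊆P R⊆P disjoint xs | P? x | Q? x | R? x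
  ... | yes p | yes q | yes r = ⊥-elim (disjoint q r)
  ... | yes p | yes q | no ¬r = ≡.cong suc ih
  ... | yes p | no ¬q | yes r = ≡.trans (≡.cong suc ih) (≡.sym (ℕ.+-suc _ _))
  ... | yes p | no ¬q | no ¬r with split p
  ...   | inj₁ q = ⊥-elim (¬q q)
  ...   | inj₂ r = ⊥-elim (¬r r)
  count-⊎ P? Q? R? split Q⊆P R⊆P disjoint (x ∷ xs) | no ¬p | yes q | _     = ⊥-elim (¬p (Q⊆P q))
  count-⊎ P? Q? R? split Q⊆P R⊆P disjoint (x ∷ xs) | no ¬p | no ¬q | yes r = ⊥-elim (¬p (R⊆P r))
  count-⊎ P? Q? R? split Q⊆P R⊆P disjoint (x ∷ xs) | no ¬p | no ¬q | no ¬r = ih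

  count-¬ : ∀ {P : A → Set} (P? : Decidable P) xs → length xs ≡ count P? xs ℕ.+ count (¬? ∘ P?) xs
  count-¬ P? []       = ≡.refl
  count-¬ P? (x ∷ xs) with ih ← count-¬ P? xs | P? x
  ... | yes p = ≡.cong suc ih
  ... | no ¬p = ≡.trans (≡.cong suc ih) (≡.sym (ℕ.+-suc _ _))

  count-filter : ∀ {P Q : A → Set} (P? : Decidable P) (Q? : Decidable Q) xs → count P? (filter Q? xs) ≤ count P? xs
  count-filter P? Q? []       = z≤n
  count-filter P? Q? (x ∷ xs) with ih ← count-filter P? Q? xs | Q? x
  ... | yes _ with P? x
  ...   | yes _ = s≤s ih
  ...   | no _  = ih
  count-filter P? Q? (x ∷ xs) | no _ with P? x
  ...   | yes _ = ℕ.m≤n⇒m≤1+n ih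
  ...   | no _  = ih

  -- The union bound: entries belonging to the first index are removed, and the remaining indices
  -- cover what is left.
  cover : ∀ {B : Set} {P : B → A → Set} (P? : ∀ u → Decidable (P u)) k S us xs → All (λ x → Any (λ u → P u x) us) xs →
    (∀ u → k ℕ.* count (P? u) xs ≤ S) → k ℕ.* length xs ≤ length us ℕ.* S
  cover P? k S []       []       _         bound = ℕ.≤-reflexive (ℕ.*-zeroʳ k)
  cover P? k S []       (x ∷ xs) (() ∷ _)  bound
  cover {P = P} P? k S (u ∷ us) xs       cov       bound = ℕ.≤-trans
    (ℕ.≤-reflexive (≡.trans (≡.cong (k ℕ.*_) (count-¬ (P? u) xs)) (ℕ.*-distribˡ-+ k _ _)))
    (ℕ.+-mono-≤ (bound u) (cover P? k S us ys (All.zipWith step (All.filter⁺ (¬? ∘ P? u) cov , All.all-filter (¬? ∘ P? u) xs))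
      (λ u′ → ℕ.≤-trans (ℕ.*-monoʳ-≤ k (count-filter (P? u′) (¬? ∘ P? u) xs)) (bound u′))))
    where
    ys = filter (¬? ∘ P? u) xs
    step : ∀ {x} → Any (λ u → P u x) (u ∷ us) × ¬ P u x → Any (λ u → P u x) us
    step (here p  , ¬p) = ⊥-elim (¬p p)
    step (there a , _)  = a

open Counting public

-- Equidistribution in the subgroups of index d

module Equidistribution (K : FiniteField) (F : Subfield K) (m : ℕ) (1≤m : 1 ≤ m)
  (card≡ : FiniteField.card K ≡ Subfield.size F ℕ.^ suc m) (θ : FiniteField.Carrier K) (gen : Generates K F θ)
  (α : FiniteField.Carrier K) (α≉0 : ¬ FiniteField._≈_ K α (FiniteField.0# K))
  (t : ℕ) (m+3≤t : 3 ℕ.+ m ≤ t) (t^≤q : t ℕ.^ (8 ℕ.* suc m) ≤ Subfield.size F) where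
  open FieldFacts K
  open RootCounting K
  open SubfieldFacts F
  open Frobenius K F
  open Conjugates (suc m) card≡ θ gen
  open CosetBound K F m 1≤m card≡ θ gen
  open BlockProducts K F
  private
    module EqR = Relation.Binary.Reasoning.Setoid setoid
    n q C : ℕ
    n = suc m
    q = size
    C = 3 ℕ.* n ℕ.+ 2
    instance
      t-nonZero : NonZero t
      t-nonZero = ℕ.>-nonZero (ℕ.≤-trans (s≤s z≤n) m+3≤t)

  Z : ℕ
  Z = card ℕ.∸ 1

  suc-Z : suc Z ≡ q ℕ.^ n
  suc-Z = ≡.trans (ℕ.m+[n∸m]≡n (ℕ.<⇒≤ 1<card)) card≡

  line : Carrier → Carrier
  line x = α * (θ + x)

  line≉0 : ∀ {x} → mem x → ¬ line x ≈ 0#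
  line≉0 mx = *-≉0 α≉0 (θ+x≉0 (s≤s 1≤m) mx)

  power? : ∀ e u → Decidable (λ x → line x ^ e ≈ u)
  power? e u x = (line x ^ e) ≟ u

  filter-distinct : ∀ {P : Carrier → Set} (P? : Decidable P) → Distinct (filter P? members)
  filter-distinct P? = AllPairs.filter⁺ P? members-distinct

  filter-mem : ∀ {P : Carrier → Set} (P? : Decidable P) → All mem (filter P? members)
  filter-mem P? = All.filter⁺ P? members-mem

  t≤q : t ≤ q
  t≤q = ℕ.≤-trans (ℕ.≤-trans (ℕ.≤-reflexive (≡.sym (ℕ.^-identityʳ t))) (ℕ.^-monoʳ-≤ t (s≤s (z≤n {m ℕ.+ 7 ℕ.* suc m})))) t^≤q

  coset-count : ∀ {d e} u → 1 ≤ d → d ≤ t ℕ.^ n → d ℕ.* e ≡ Z → t ℕ.* d ℕ.* count (power? e u) members ≤ t ℕ.* q ℕ.+ C ℕ.* q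
  coset-count {d} {e} u 1≤d d≤ de≡ = ℕ.≤-trans (ℕ.≤-reflexive (ℕ.*-assoc t d _))
    (coset-bound {t} {d} {e} (filter (power? e u) members) (i ^ e * u) (filter-distinct (power? e u)) (filter-mem (power? e u))
      (All.map solve (All.all-filter (power? e u) members)) m+3≤t t^≤q 1≤d d≤ de≡)
    where
    open EqR
    i = proj₁ (inverse α α≉0)
    solve : ∀ {x} → line x ^ e ≈ u → (θ + x) ^ e ≈ i ^ e * u
    solve {x} p = begin
      (θ + x) ^ e                   ≈⟨ ^-congˡ e (trans (sym (*-assoc i α _)) (trans (*-congʳ (trans (*-comm i α) (proj₂ (inverse α α≉0)))) (*-identityˡ _))) ⟨
      (i * line x) ^ e              ≈⟨ ^-distrib-* i (line x) e ⟩
      i ^ e * line x ^ e            ≈⟨ *-congˡ p ⟩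
      i ^ e * u                     ∎

  -- This is |N - q / d| ≤ C q / t multiplied by t d. The error is the same for all d, so that the
  -- sieve can simply add it up.
  Equidistributed : ℕ → ℕ → Set
  Equidistributed d e = t ℕ.* (d ℕ.* N) ≤ t ℕ.* q ℕ.+ C ℕ.* (d ℕ.* q) × t ℕ.* q ≤ t ℕ.* (d ℕ.* N) ℕ.+ C ℕ.* (d ℕ.* q)
    where N = count (power? e 1#) members

  -- The lower bound comes from the upper bounds for the other cosets, since the cosets cover F.
  small-index : ∀ {d e} → 1 ≤ d → d ≤ t ℕ.^ n → d ℕ.* e ≡ Z → Equidistributed d e
  small-index {d} {e} 1≤d d≤ de≡ =
    ℕ.≤-trans (ℕ.≤-reflexive (≡.sym (ℕ.*-assoc t d N))) (ℕ.≤-trans (coset-count 1# 1≤d d≤ de≡)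
      (ℕ.+-monoʳ-≤ (t ℕ.* q) (ℕ.*-monoʳ-≤ C (ℕ.m≤n*m q d)))) ,
    lower
    where
    open ℕ.≤-Reasoning
    instance _ = ℕ.>-nonZero 1≤d
    N = count (power? e 1#) members
    S = t ℕ.* q ℕ.+ C ℕ.* q
    rest = filter (¬? ∘ power? e 1#) members
    root? : Decidable (λ u → u ^ d ≈ 1#)
    root? u = (u ^ d) ≟ 1#
    one? : Decidable (λ u → ¬ u ≈ 1#)
    one? u = ¬? (u ≟ 1#)
    others = filter one? (filter root? elems)

    others-count : suc (length others) ≤ d
    others-count = ^≈-count (1# ∷ others) 1≤d 1≉0
      (All.map (λ ne e → ne (sym e)) (All.all-filter one? (filter root? elems)) ∷ AllPairs.filter⁺ one? (AllPairs.filter⁺ root? distinct))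
      (1^ d ∷ All.filter⁺ one? (All.all-filter root? elems))

    covered : All (λ x → Any (λ u → line x ^ e ≈ u) others) rest
    covered = All.zipWith (λ {x} (mx , ne) →
        ∈-filter⁺ setoid one? (λ e′ ne′ p → ne′ (trans e′ p))
          (∈-filter⁺ setoid root? (λ e′ p → trans (^-congˡ d (sym e′)) p) (complete (line x ^ e))
            (trans (^-assocʳ (line x) e d) (trans (^-congʳ (line x) (≡.trans (ℕ.*-comm e d) de≡)) (^card-1 (line≉0 mx))))) ne)
      (filter-mem (¬? ∘ power? e 1#) , All.all-filter (¬? ∘ power? e 1#) members)

    rest-count : t ℕ.* d ℕ.* length rest ≤ length others ℕ.* S
    rest-count = cover (λ u → power? e u) (t ℕ.* d) S others rest covered
      (λ u → ℕ.≤-trans (ℕ.*-monoʳ-≤ (t ℕ.* d) (count-filter (power? e u) (¬? ∘ power? e 1#) members)) (coset-count u 1≤d d≤ de≡))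

    lower : t ℕ.* q ≤ t ℕ.* (d ℕ.* N) ℕ.+ C ℕ.* (d ℕ.* q)
    lower = ℕ.+-cancelˡ-≤ (t ℕ.* d ℕ.* q) _ _ (begin
      t ℕ.* d ℕ.* q ℕ.+ t ℕ.* q                           ≡⟨ ≡.cong (λ x → t ℕ.* d ℕ.* x ℕ.+ t ℕ.* q) (count-¬ (power? e 1#) members) ⟩
      t ℕ.* d ℕ.* (N ℕ.+ length rest) ℕ.+ t ℕ.* q         ≡⟨ eq₁ t d N (length rest) q ⟩
      t ℕ.* (d ℕ.* N) ℕ.+ (t ℕ.* d ℕ.* length rest ℕ.+ t ℕ.* q) ≤⟨ ℕ.+-monoʳ-≤ (t ℕ.* (d ℕ.* N)) (ℕ.+-mono-≤ rest-count (ℕ.m≤m+n (t ℕ.* q) (C ℕ.* q))) ⟩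
      t ℕ.* (d ℕ.* N) ℕ.+ (length others ℕ.* S ℕ.+ S)     ≡⟨ ≡.cong (t ℕ.* (d ℕ.* N) ℕ.+_) (ℕ.+-comm _ S) ⟩
      t ℕ.* (d ℕ.* N) ℕ.+ suc (length others) ℕ.* S       ≤⟨ ℕ.+-monoʳ-≤ (t ℕ.* (d ℕ.* N)) (ℕ.*-monoˡ-≤ S others-count) ⟩
      t ℕ.* (d ℕ.* N) ℕ.+ d ℕ.* (t ℕ.* q ℕ.+ C ℕ.* q)     ≡⟨ eq₂ t d N q C ⟩
      t ℕ.* d ℕ.* q ℕ.+ (t ℕ.* (d ℕ.* N) ℕ.+ C ℕ.* (d ℕ.* q)) ∎)
      where
      eq₁ : ∀ t d N r q → t ℕ.* d ℕ.* (N ℕ.+ r) ℕ.+ t ℕ.* q ≡ t ℕ.* (d ℕ.* N) ℕ.+ (t ℕ.* d ℕ.* r ℕ.+ t ℕ.* q)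
      eq₁ = solve-∀
      eq₂ : ∀ t d N q C → t ℕ.* (d ℕ.* N) ℕ.+ d ℕ.* (t ℕ.* q ℕ.+ C ℕ.* q) ≡ t ℕ.* d ℕ.* q ℕ.+ (t ℕ.* (d ℕ.* N) ℕ.+ C ℕ.* (d ℕ.* q))
      eq₂ = solve-∀

  -- Both q / d and N are at most C q / t, so they differ by no more than that. For N, `block-bound`
  -- with b the integer part of N / n gives (b t)^n ≤ e d < q^n, and the remainder of N modulo n is
  -- harmless since t ≤ q.
  large-index : ∀ {d e} → t ℕ.^ n ≤ d → d ℕ.* e ≡ Z → Equidistributed d e
  large-index {d} {e} ≤d de≡ = upper , lower
    where
    open ℕ.≤-Reasoning
    N = count (power? e 1#) members
    b = N / n
    1≤e : 1 ≤ e
    1≤e with e ℕ.≟ 0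
    ... | no e≢0 = ℕ.n≢0⇒n>0 e≢0
    ... | yes e≡0 = ⊥-elim (ℕ.<⇒≢ (ℕ.m<n⇒0<n∸m 1<card) (≡.trans (≡.sym (≡.trans (≡.cong (d ℕ.*_) e≡0) (ℕ.*-zeroʳ d))) de≡))
    b^n≤e : b ℕ.^ n ≤ e
    b^n≤e = block-bound m card≡ θ gen 1≤e α≉0 (filter-distinct (power? e 1#)) (filter-mem (power? e 1#)) (All.all-filter (power? e 1#) members)
      (ℕ.≤-trans (ℕ.≤-reflexive (ℕ.*-comm n b)) (m/n*n≤m N n))
    bt≤q : b ℕ.* t ≤ q
    bt≤q = ℕ.≮⇒≥ λ q<bt → ℕ.<⇒≱ (begin-strict
      (b ℕ.* t) ℕ.^ n      ≡⟨ [m*n]^k≡m^k*n^k b t n ⟩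
      b ℕ.^ n ℕ.* t ℕ.^ n  ≤⟨ ℕ.*-mono-≤ b^n≤e ≤d ⟩
      e ℕ.* d              ≡⟨ ≡.trans (ℕ.*-comm e d) de≡ ⟩
      Z                    <⟨ ℕ.≤-reflexive suc-Z ⟩
      q ℕ.^ n              ∎) (ℕ.^-monoˡ-≤ n (ℕ.<⇒≤ q<bt))
    tN≤ : t ℕ.* N ≤ C ℕ.* q
    tN≤ = begin
      t ℕ.* N                          ≡⟨ ≡.cong (t ℕ.*_) (m≡m%n+[m/n]*n N n) ⟩
      t ℕ.* (N % n ℕ.+ b ℕ.* n)        ≤⟨ ℕ.*-monoʳ-≤ t (ℕ.+-monoˡ-≤ (b ℕ.* n) (ℕ.<⇒≤ (m%n<n N n))) ⟩
      t ℕ.* (n ℕ.+ b ℕ.* n)            ≡⟨ eq₁ t n b ⟩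
      n ℕ.* t ℕ.+ n ℕ.* (b ℕ.* t)      ≤⟨ ℕ.+-mono-≤ (ℕ.*-monoʳ-≤ n t≤q) (ℕ.*-monoʳ-≤ n bt≤q) ⟩
      n ℕ.* q ℕ.+ n ℕ.* q              ≤⟨ ℕ.m≤m+n _ (n ℕ.* q ℕ.+ 2 ℕ.* q) ⟩
      n ℕ.* q ℕ.+ n ℕ.* q ℕ.+ (n ℕ.* q ℕ.+ 2 ℕ.* q) ≡⟨ eq₂ n q ⟩
      C ℕ.* q                          ∎
      where
      eq₁ : ∀ t n b → t ℕ.* (n ℕ.+ b ℕ.* n) ≡ n ℕ.* t ℕ.+ n ℕ.* (b ℕ.* t)
      eq₁ = solve-∀
      eq₂ : ∀ n q → n ℕ.* q ℕ.+ n ℕ.* q ℕ.+ (n ℕ.* q ℕ.+ 2 ℕ.* q) ≡ (3 ℕ.* n ℕ.+ 2) ℕ.* q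
      eq₂ = solve-∀
    upper : t ℕ.* (d ℕ.* N) ≤ t ℕ.* q ℕ.+ C ℕ.* (d ℕ.* q)
    upper = begin
      t ℕ.* (d ℕ.* N)                  ≡⟨ swap t d N ⟩
      d ℕ.* (t ℕ.* N)                  ≤⟨ ℕ.*-monoʳ-≤ d tN≤ ⟩
      d ℕ.* (C ℕ.* q)                  ≡⟨ swap d C q ⟩
      C ℕ.* (d ℕ.* q)                  ≤⟨ ℕ.m≤n+m _ (t ℕ.* q) ⟩
      t ℕ.* q ℕ.+ C ℕ.* (d ℕ.* q)      ∎
      where
      swap : ∀ a b c → a ℕ.* (b ℕ.* c) ≡ b ℕ.* (a ℕ.* c)
      swap = solve-∀
    lower : t ℕ.* q ≤ t ℕ.* (d ℕ.* N) ℕ.+ C ℕ.* (d ℕ.* q)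
    lower = begin
      t ℕ.* q                          ≤⟨ ℕ.*-monoˡ-≤ q (ℕ.≤-trans (ℕ.m≤m*n t (t ℕ.^ m) {{ℕ.m^n≢0 t m}}) ≤d) ⟩
      d ℕ.* q                          ≤⟨ ℕ.m≤n*m (d ℕ.* q) C ⟩
      C ℕ.* (d ℕ.* q)                  ≤⟨ ℕ.m≤n+m _ (t ℕ.* (d ℕ.* N)) ⟩
      t ℕ.* (d ℕ.* N) ℕ.+ C ℕ.* (d ℕ.* q) ∎

  equidistributed : ∀ {d e} → 1 ≤ d → d ℕ.* e ≡ Z → Equidistributed d e
  equidistributed {d} 1≤d de≡ with ℕ.≤-total d (t ℕ.^ n)
  ... | inj₁ d≤ = small-index 1≤d d≤ de≡
  ... | inj₂ ≤d = large-index ≤d de≡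

-- Prime divisors and products of primes

prime-divisor : ∀ {h} → 2 ≤ h → ∃ λ p → Prime p × p ∣ h
prime-divisor {h} 2≤h = go factors factorsPrime isFactorisation
  where
  open PrimeFactorisation (factorise h {{ℕ.>-nonZero (ℕ.<⇒≤ 2≤h)}})
  go : ∀ ps → All Prime ps → h ≡ product ps → ∃ λ p → Prime p × p ∣ h
  go []       _       e = ⊥-elim (ℕ.<⇒≢ 2≤h (≡.sym e))
  go (p ∷ ps) (q ∷ _) e = p , q , ≡.subst (p ∣_) (≡.sym e) (m∣m*n (product ps))

PrimeDivisor : ℕ → ℕ → Set
PrimeDivisor e p = Prime p × p ∣ e

primeDivisor? : ∀ e → Decidable (PrimeDivisor e)
primeDivisor? e p = prime? p ×-dec (p ∣? e)

primeDivisors : ℕ → List ℕ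
primeDivisors e = filter (primeDivisor? e) (upTo (suc e))

primeDivisors-sound : ∀ e → All (PrimeDivisor e) (primeDivisors e)
primeDivisors-sound e = All.all-filter (primeDivisor? e) (upTo (suc e))

primeDivisors-complete : ∀ {e p} → 1 ≤ e → PrimeDivisor e p → p ∈ˡ primeDivisors e
primeDivisors-complete {e} 1≤e d@(_ , p∣e) = ∈ˡ.∈-filter⁺ (primeDivisor? e) (∈-upTo⁺ (s≤s (∣⇒≤ {{ℕ.>-nonZero 1≤e}} p∣e))) d

prime>1 : ∀ {p} → Prime p → 1 < p
prime>1 {p} pr = ℕ.nonTrivial⇒n>1 p {{prime⇒nonTrivial pr}}

distinct-primes-coprime : ∀ {p r} → Prime p → Prime r → p ≢ r → Coprime p r
distinct-primes-coprime pp pr p≢r (d∣p , d∣r) with prime⇒irreducible pp d∣p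
... | inj₁ d≡1    = d≡1
... | inj₂ ≡.refl with prime⇒irreducible pr d∣r
...   | inj₁ p≡1 = p≡1
...   | inj₂ p≡r = ⊥-elim (p≢r p≡r)

pairwise-coprime : ∀ {e ps} → All (PrimeDivisor e) ps → AllPairs _≢_ ps → AllPairs Coprime ps
pairwise-coprime []             []       = []
pairwise-coprime ((p , _) ∷ ps) (d ∷ ds) = with-head ps d ∷ pairwise-coprime ps ds
  where
  with-head : ∀ {rs} → All (PrimeDivisor _) rs → All (_ ≢_) rs → All (Coprime _) rs
  with-head []             []       = []
  with-head ((r , _) ∷ rs) (d ∷ ds) = distinct-primes-coprime p r d ∷ with-head rs ds

primeDivisors-coprime : ∀ e → AllPairs Coprime (primeDivisors e)
primeDivisors-coprime e = pairwise-coprime (primeDivisors-sound e) (AllPairs.filter⁺ (primeDivisor? e) (upTo⁺ (suc e)))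

coprime-product : ∀ {p ps} → All (Coprime p) ps → Coprime (product ps) p
coprime-product []       (d∣1 , _)    = ∣1⇒≡1 d∣1
coprime-product {p} {r ∷ ps} (c ∷ cs) {d} (d∣rP , d∣p) =
  coprime-product cs (coprime-divisor (λ (x∣d , x∣r) → c (∣-trans x∣d d∣p , x∣r)) d∣rP , d∣p)

product-∣ : ∀ {e ps} → AllPairs Coprime ps → All (_∣ e) ps → product ps ∣ e
product-∣ []       []       = 1∣ _
product-∣ {ps = p ∷ ps} (c ∷ cs) (divides k ≡.refl ∷ ds) = ≡.subst (p ℕ.* product ps ∣_) (ℕ.*-comm p k)
  (*-monoʳ-∣ p (coprime-divisor (coprime-product c) (≡.subst (product ps ∣_) (ℕ.*-comm k p) (product-∣ cs ds))))

-- Euler's function of the product, when the entries are distinct primes.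
totient : List ℕ → ℕ
totient ps = product (map ℕ.pred ps)

product≤2^*totient : ∀ {ps} → All (1 <_) ps → product ps ≤ 2 ℕ.^ length ps ℕ.* totient ps
product≤2^*totient []                           = s≤s z≤n
product≤2^*totient {suc (suc p) ∷ ps} (_ ∷ ls) = ℕ.≤-trans
  (ℕ.*-mono-≤ (ℕ.≤-trans (s≤s (s≤s (ℕ.m≤n+m p p))) (ℕ.≤-reflexive (eq p))) (product≤2^*totient ls))
  (ℕ.≤-reflexive (ℕ.[m*n]*[o*p]≡[m*o]*[n*p] 2 (suc p) (2 ℕ.^ length ps) (totient ps)))
  where
  eq : ∀ p → suc (suc (p ℕ.+ p)) ≡ 2 ℕ.* suc p
  eq = solve-∀
product≤2^*totient {suc zero ∷ ps} (s≤s () ∷ _)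

totient≥1 : ∀ {ps} → All (1 <_) ps → 1 ≤ totient ps
totient≥1 []                          = s≤s z≤n
totient≥1 {suc (suc p) ∷ ps} (_ ∷ ls) = ℕ.*-mono-≤ (s≤s (z≤n {p})) (totient≥1 ls)
totient≥1 {suc zero ∷ ps} (s≤s () ∷ _)

count-<-applyUpTo : ∀ k N (f : ℕ → ℕ) a → (∀ i → f i ≡ a ℕ.+ i) → count (ℕ._<? k) (applyUpTo f N) ≤ k ℕ.∸ a
count-<-applyUpTo k zero    f a e = z≤n
count-<-applyUpTo k (suc N) f a e with ih ← count-<-applyUpTo k N (f ∘ suc) (suc a) (λ i → ≡.trans (e (suc i)) (ℕ.+-suc a i)) | f 0 ℕ.<? k
... | yes l = ℕ.≤-trans (ℕ.≤-reflexive (count-accept (ℕ._<? k) l)) (ℕ.≤-trans (s≤s ih) (ℕ.≤-reflexive (≡.sym (ℕ.+-∸-assoc 1 (≡.subst (_< k) (≡.trans (e 0) (ℕ.+-identityʳ a)) l)))))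
... | no ¬l = ℕ.≤-trans (ℕ.≤-trans (ℕ.≤-reflexive (count-reject (ℕ._<? k) ¬l)) ih) (ℕ.∸-monoʳ-≤ k (ℕ.n≤1+n a))

-- Each entry must pay for one factor k: it does so itself if it is at least k, and otherwise
-- through the extra power of k.
^length≤product : ∀ k {ps} → 1 ≤ k → All (1 <_) ps → k ℕ.^ length ps ≤ k ℕ.^ count (ℕ._<? k) ps ℕ.* product ps
^length≤product k 1≤k []                 = s≤s z≤n
^length≤product k {p ∷ ps} 1≤k (1<p ∷ ls) with ih ← ^length≤product k 1≤k ls | p ℕ.<? k
... | yes p<k rewrite count-accept (ℕ._<? k) {xs = ps} p<k = ℕ.≤-trans (ℕ.*-monoʳ-≤ k ih) (ℕ.≤-trans (ℕ.≤-reflexive (≡.sym (ℕ.*-assoc k _ (product ps))))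
  (ℕ.*-monoʳ-≤ (k ℕ.* k ℕ.^ count (ℕ._<? k) ps) (ℕ.m≤n*m (product ps) p {{ℕ.>-nonZero (ℕ.<⇒≤ 1<p)}})))
... | no p≮k rewrite count-reject (ℕ._<? k) {xs = ps} p≮k = ℕ.≤-trans (ℕ.*-mono-≤ (ℕ.≮⇒≥ p≮k) ih) (ℕ.≤-reflexive (eq p (k ℕ.^ count (ℕ._<? k) ps) (product ps)))
  where
  eq : ∀ a b c → a ℕ.* (b ℕ.* c) ≡ b ℕ.* (a ℕ.* c)
  eq = solve-∀

primes>1 : ∀ {e ps} → All (PrimeDivisor e) ps → All (1 <_) ps
primes>1 = All.map (prime>1 ∘ proj₁)

-- At most k primes lie below k. Since k is arbitrary, the number of prime divisors is o(log) of
-- their product, which is the source of the q^o(1) in the sieve.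
^primeDivisors : ∀ k e → 1 ≤ k → k ℕ.^ length (primeDivisors e) ≤ k ℕ.^ k ℕ.* product (primeDivisors e)
^primeDivisors k e 1≤k = ℕ.≤-trans (^length≤product k 1≤k (primes>1 (primeDivisors-sound e)))
  (ℕ.*-monoˡ-≤ (product (primeDivisors e)) (ℕ.^-monoʳ-≤ k {{ℕ.>-nonZero 1≤k}}
    (ℕ.≤-trans (count-filter (ℕ._<? k) (primeDivisor? e) (upTo (suc e))) (count-<-applyUpTo k (suc e) id 0 (λ _ → ≡.refl)))))

-- Integer roots and the threshold

root : ∀ k q → 1 ≤ k → ∃ λ t → t ℕ.^ k ≤ q × q < suc t ℕ.^ k
root k zero    1≤k = 0 , ℕ.≤-reflexive (0^k 1≤k) , ℕ.m^n>0 1 k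
  where
  0^k : ∀ {k} → 1 ≤ k → 0 ℕ.^ k ≡ 0
  0^k {suc k} _ = ≡.refl
root k (suc q) 1≤k with root k q 1≤k
... | t , t^≤ , <t^ with suc t ℕ.^ k ℕ.≤? suc q
...   | yes l = suc t , l , ℕ.≤-<-trans <t^ (ℕ.^-monoˡ-< k {{ℕ.>-nonZero 1≤k}} (ℕ.n<1+n (suc t)))
...   | no ¬l = t , ℕ.m≤n⇒m≤1+n t^≤ , ℕ.≰⇒> ¬l

module Threshold (n r : ℕ) (1≤n : 1 ≤ n) (1≤r : 1 ≤ r) where
  open import Data.Nat using (_+_; _*_; _^_; _∸_)
  open ℕ.≤-Reasoning

  -- The base is such that base ^ s ≤ constant · q ^ n, for s the number of prime divisors of e, forces 16 ^ s ≤ constant · (t + 1).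
  C base constant T₀ L : ℕ
  C = 3 * n + 2
  base = 4 ^ (16 * (n * n))
  constant = base ^ base
  T₀ = 2 + n + 2 * (constant * ((C * r) * (C * r)))
  L = suc T₀ ^ (8 * n)

  constant≥1 : 1 ≤ constant
  constant≥1 = ℕ.m^n>0 base {{ℕ.m^n≢0 4 (16 * (n * n))}} base

  -- The product of the primes is at most 2^s times its totient, so 4^s C r < t suffices. Taking
  -- 8n^2-th roots in the bound for base^s gives 16^s ≤ constant (t + 1). As 16^s is the square of
  -- 4^s, the square of 4^s C r is at most linear in t, so it stays below t^2 once t > T₀.
  few-primes : ∀ {t q} e → q < suc t ^ (8 * n) → product (primeDivisors e) ≤ q ^ n → T₀ < t →
    2 ^ length (primeDivisors e) * (C * (r * product (primeDivisors e))) < t * totient (primeDivisors e)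
  few-primes {t} {q} e q< P≤ T₀<t = begin-strict
    2 ^ s * (C * (r * product ps))                ≤⟨ ℕ.*-monoʳ-≤ (2 ^ s) (ℕ.*-monoʳ-≤ C (ℕ.*-monoʳ-≤ r (product≤2^*totient (primes>1 (primeDivisors-sound e))))) ⟩
    2 ^ s * (C * (r * (2 ^ s * totient ps)))      ≡⟨ eq₁ (2 ^ s) C r (totient ps) ⟩
    (2 ^ s * 2 ^ s) * (C * r) * totient ps        ≡⟨ ≡.cong (λ x → x * (C * r) * totient ps) ([m*n]^k≡m^k*n^k 2 2 s) ⟨
    4 ^ s * (C * r) * totient ps                  <⟨ ℕ.*-monoˡ-< (totient ps) {{ℕ.>-nonZero (totient≥1 (primes>1 (primeDivisors-sound e)))}} 4^s< ⟩
    t * totient ps                                ∎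
    where
    ps = primeDivisors e
    s = length ps
    N = 8 * (n * n)
    eq₁ : ∀ a C r φ → a * (C * (r * (a * φ))) ≡ a * a * (C * r) * φ
    eq₁ = solve-∀
    N-nonZero : NonZero N
    N-nonZero = ℕ.m*n≢0 8 (n * n) {{_}} {{ℕ.m*n≢0 n n {{ℕ.>-nonZero 1≤n}} {{ℕ.>-nonZero 1≤n}}}}
    16^s : (16 ^ s) ^ N ≤ (constant * suc t) ^ N
    16^s = begin
      (16 ^ s) ^ N                      ≡⟨ ≡.cong (_^ N) (≡.trans ([m*n]^k≡m^k*n^k 4 4 s) (≡.sym (ℕ.^-distribˡ-+-* 4 s s))) ⟩
      (4 ^ (s + s)) ^ N                 ≡⟨ ℕ.^-*-assoc 4 (s + s) N ⟩
      4 ^ ((s + s) * N)                 ≡⟨ ≡.cong (4 ^_) (eq s (n * n)) ⟩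
      4 ^ (16 * (n * n) * s)            ≡⟨ ℕ.^-*-assoc 4 (16 * (n * n)) s ⟨
      base ^ s                          ≤⟨ ^primeDivisors base e (ℕ.m^n>0 4 (16 * (n * n))) ⟩
      constant * product ps             ≤⟨ ℕ.*-monoʳ-≤ constant (ℕ.≤-trans P≤ (ℕ.^-monoˡ-≤ n (ℕ.<⇒≤ q<))) ⟩
      constant * (suc t ^ (8 * n)) ^ n  ≡⟨ ≡.cong (constant *_) (≡.trans (ℕ.^-*-assoc (suc t) (8 * n) n) (≡.cong (suc t ^_) (ℕ.*-assoc 8 n n))) ⟩
      constant * suc t ^ N              ≤⟨ ℕ.*-monoˡ-≤ (suc t ^ N) (≡.subst (_≤ constant ^ N) (ℕ.*-identityʳ constant) (ℕ.^-monoʳ-≤ constant {{ℕ.>-nonZero constant≥1}} (ℕ.>-nonZero⁻¹ N {{N-nonZero}}))) ⟩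
      constant ^ N * suc t ^ N          ≡⟨ [m*n]^k≡m^k*n^k constant (suc t) N ⟨
      (constant * suc t) ^ N            ∎
      where
      eq : ∀ s x → (s + s) * (8 * x) ≡ 16 * x * s
      eq = solve-∀
    16^s≤ : 16 ^ s ≤ constant * suc t
    16^s≤ = ℕ.≮⇒≥ λ l → ℕ.<⇒≱ (ℕ.^-monoˡ-< N {{N-nonZero}} l) 16^s
    1≤t : 1 ≤ t
    1≤t = ℕ.≤-trans (s≤s z≤n) T₀<t
    4^s< : 4 ^ s * (C * r) < t
    4^s< = ℕ.≰⇒> λ t≤ → ℕ.<⇒≱ T₀<t (ℕ.≤-trans (ℕ.*-cancelʳ-≤ _ _ t {{ℕ.>-nonZero 1≤t}} (begin
      t * t                                            ≤⟨ ℕ.*-mono-≤ t≤ t≤ ⟩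
      4 ^ s * (C * r) * (4 ^ s * (C * r))              ≡⟨ ℕ.[m*n]*[o*p]≡[m*o]*[n*p] (4 ^ s) (C * r) (4 ^ s) (C * r) ⟩
      4 ^ s * 4 ^ s * ((C * r) * (C * r))              ≡⟨ ≡.cong (_* ((C * r) * (C * r))) ([m*n]^k≡m^k*n^k 4 4 s) ⟨
      16 ^ s * ((C * r) * (C * r))                     ≤⟨ ℕ.*-monoˡ-≤ ((C * r) * (C * r)) (ℕ.≤-trans 16^s≤ (ℕ.*-monoʳ-≤ constant (ℕ.+-monoˡ-≤ t 1≤t))) ⟩
      constant * (t + t) * ((C * r) * (C * r))         ≡⟨ eq constant t ((C * r) * (C * r)) ⟩
      2 * (constant * ((C * r) * (C * r))) * t         ∎)) (ℕ.m≤n+m _ (2 + n)))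
      where
      eq : ∀ c t x → c * (t + t) * x ≡ 2 * (c * x) * t
      eq = solve-∀

  above-threshold : ∀ {t q} → L < q → q < suc t ^ (8 * n) → T₀ < t
  above-threshold L<q q< = ℕ.≰⇒> λ t≤T₀ → ℕ.<⇒≱ (ℕ.<-trans L<q q<) (ℕ.^-monoˡ-≤ (8 * n) (s≤s t≤T₀))

-- Multiplicative orders

module Orders (K : FiniteField) where
  open FieldFacts K
  open import Relation.Binary.Reasoning.Setoid setoid

  ^-multiple : ∀ {u a} k → u ^ a ≈ 1# → u ^ (k ℕ.* a) ≈ 1#
  ^-multiple {u} {a} k p = trans (^-congʳ u (ℕ.*-comm k a)) (trans (sym (^-assocʳ u a k)) (trans (^-congˡ k p) (1^ k)))

  ^-identity : ∀ {u a b g} → Bézout.Identity g a b → u ^ a ≈ 1# → u ^ b ≈ 1# → u ^ g ≈ 1#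
  ^-identity {u} {a} {b} {g} (Bézout.+- x y eq) p r = begin
    u ^ g                     ≈⟨ *-identityʳ _ ⟨
    u ^ g * 1#                ≈⟨ *-congˡ (^-multiple y r) ⟨
    u ^ g * u ^ (y ℕ.* b)     ≈⟨ ^-homo-* u g (y ℕ.* b) ⟨
    u ^ (g ℕ.+ y ℕ.* b)       ≈⟨ ^-congʳ u eq ⟩
    u ^ (x ℕ.* a)             ≈⟨ ^-multiple x p ⟩
    1#                        ∎
  ^-identity {u} {a} {b} {g} (Bézout.-+ x y eq) p r = begin
    u ^ g                     ≈⟨ *-identityʳ _ ⟨
    u ^ g * 1#                ≈⟨ *-congˡ (^-multiple x p) ⟨
    u ^ g * u ^ (x ℕ.* a)     ≈⟨ ^-homo-* u g (x ℕ.* a) ⟨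
    u ^ (g ℕ.+ x ℕ.* a)       ≈⟨ ^-congʳ u eq ⟩
    u ^ (y ℕ.* b)             ≈⟨ ^-multiple y r ⟩
    1#                        ∎

  HasOrder-resp : ∀ {u v e} → u ≈ v → HasOrder u e → HasOrder v e
  HasOrder-resp {u} {v} {e} u≈v (1≤e , u^e , minimal) =
    1≤e , trans (power e) u^e , λ k 1≤k v^k → minimal k 1≤k (trans (sym (power k)) v^k)
    where
    power : ∀ k → FiniteField._^_ K v k ≈ FiniteField._^_ K u k
    power k = ≡.subst₂ _≈_ (≡.sym (^≡ v k)) (≡.sym (^≡ u k)) (^-congˡ k (sym u≈v))

  -- If v^k = 1, Bézout gives v^g = 1 for g = gcd(k, e). If g ≠ e, some prime p divides e / g, so g
  -- divides e / p and v^(e / p) = 1, which is excluded. Hence g = e divides k.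
  order-from-primes : ∀ {v e} → 1 ≤ e → v ^ e ≈ 1# → (∀ {p k} → Prime p → p ℕ.* k ≡ e → ¬ v ^ k ≈ 1#) → HasOrder v e
  order-from-primes {v} {e} 1≤e v^e prime-exponents = 1≤e , ≡.subst (_≈ 1#) (≡.sym (^≡ v e)) v^e , λ k 1≤k v^k →
    minimal k 1≤k (≡.subst (_≈ 1#) (^≡ v k) v^k)
    where
    minimal : ∀ k → 1 ≤ k → v ^ k ≈ 1# → e ≤ k
    minimal k 1≤k v^k with Bézout.lemma k e
    ... | Bézout.result g gcd identity with GCD.commonDivisor gcd
    ...   | g∣k , divides zero e≡ = ⊥-elim (ℕ.<⇒≢ 1≤e (≡.sym e≡))
    ...   | g∣k , divides (suc zero) e≡ = ℕ.≤-trans (ℕ.≤-reflexive (≡.trans e≡ (ℕ.*-identityˡ g))) (∣⇒≤ {{>-nonZero 1≤k}} g∣k)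
    ...   | g∣k , divides h@(suc (suc _)) e≡ with prime-divisor {h} (s≤s (s≤s z≤n))
    ...     | p , pr , divides h′ h≡ = ⊥-elim (prime-exponents {p} {h′ ℕ.* g} pr
      (≡.trans (≡.sym (ℕ.*-assoc p h′ g)) (≡.trans (≡.cong (ℕ._* g) (≡.trans (ℕ.*-comm p h′) (≡.sym h≡))) (≡.sym e≡)))
      (^-multiple h′ (^-identity identity v^k v^e)))

-- The sieve over primes

-- Division with z ÷ 0 = 0.
infixl 7 _÷_
_÷_ : ℕ → ℕ → ℕ
z ÷ zero  = 0
z ÷ suc d = z / suc d

÷-unique : ∀ {d e z} → 1 ≤ d → d ℕ.* e ≡ z → z ÷ d ≡ e
÷-unique {suc d} {e} _ ≡.refl = ≡.trans (≡.cong (_/ suc d) (ℕ.*-comm (suc d) e)) (m*n/n≡m e (suc d))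

-- One step of the sieve, p = suc p′: X + Y = A, where A and Y are close to Φ q / (m P) and Φ q / (m p P).
module SieveStep (t q m P Φ p′ c A X Y : ℕ) (A≡ : A ≡ X ℕ.+ Y) where
  open import Data.Nat using (_+_; _*_)
  open ℕ.≤-Reasoning
  private
    p : ℕ
    p = suc p′

  -- Scaled to the common denominator m p P, the bound for A less that for Y has main term p Φ - Φ =
  -- p′ Φ, and two equal errors add to 2 c. The subtraction is replaced by adding the same terms on
  -- both sides.
  upper : t * (m * P * A) ≤ t * (q * Φ) + c * (m * P * q) → t * (q * Φ) ≤ t * (m * p * P * Y) + c * (m * p * P * q) →
    t * (m * (p * P) * X) ≤ t * (q * (p′ * Φ)) + 2 * c * (m * (p * P) * q)
  upper A≤ ≤Y = ℕ.+-cancelʳ-≤ (t * (m * p * P * Y) + t * (q * Φ)) _ _ (begin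
    t * (m * (p * P) * X) + (t * (m * p * P * Y) + t * (q * Φ))  ≡⟨ eq₁ t q m P Φ p′ X Y ⟩
    p * (t * (m * P * (X + Y))) + t * (q * Φ)                    ≡⟨ ≡.cong (λ a → p * (t * (m * P * a)) + t * (q * Φ)) A≡ ⟨
    p * (t * (m * P * A)) + t * (q * Φ)                          ≤⟨ ℕ.+-mono-≤ (ℕ.*-monoʳ-≤ p A≤) ≤Y ⟩
    p * (t * (q * Φ) + c * (m * P * q)) + (t * (m * p * P * Y) + c * (m * p * P * q)) ≡⟨ eq₂ t q m P Φ p′ c Y ⟩
    t * (q * (p′ * Φ)) + 2 * c * (m * (p * P) * q) + (t * (m * p * P * Y) + t * (q * Φ)) ∎)
    where
    eq₁ : ∀ t q m P Φ p′ X Y → t * (m * (suc p′ * P) * X) + (t * (m * suc p′ * P * Y) + t * (q * Φ)) ≡ suc p′ * (t * (m * P * (X + Y))) + t * (q * Φ)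
    eq₁ = solve-∀
    eq₂ : ∀ t q m P Φ p′ c Y → suc p′ * (t * (q * Φ) + c * (m * P * q)) + (t * (m * suc p′ * P * Y) + c * (m * suc p′ * P * q)) ≡
      t * (q * (p′ * Φ)) + 2 * c * (m * (suc p′ * P) * q) + (t * (m * suc p′ * P * Y) + t * (q * Φ))
    eq₂ = solve-∀

  lower : t * (q * Φ) ≤ t * (m * P * A) + c * (m * P * q) → t * (m * p * P * Y) ≤ t * (q * Φ) + c * (m * p * P * q) →
    t * (q * (p′ * Φ)) ≤ t * (m * (p * P) * X) + 2 * c * (m * (p * P) * q)
  lower ≤A Y≤ = ℕ.+-cancelʳ-≤ (t * (m * p * P * Y) + t * (q * Φ)) _ _ (begin
    t * (q * (p′ * Φ)) + (t * (m * p * P * Y) + t * (q * Φ))     ≡⟨ eq₁ t q m P Φ p′ Y ⟩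
    p * (t * (q * Φ)) + t * (m * p * P * Y)                      ≤⟨ ℕ.+-mono-≤ (ℕ.*-monoʳ-≤ p ≤A) Y≤ ⟩
    p * (t * (m * P * A) + c * (m * P * q)) + (t * (q * Φ) + c * (m * p * P * q)) ≡⟨ ≡.cong (λ a → p * (t * (m * P * a) + c * (m * P * q)) + (t * (q * Φ) + c * (m * p * P * q))) A≡ ⟩
    p * (t * (m * P * (X + Y)) + c * (m * P * q)) + (t * (q * Φ) + c * (m * p * P * q)) ≡⟨ eq₂ t q m P Φ p′ c X Y ⟩
    t * (m * (p * P) * X) + 2 * c * (m * (p * P) * q) + (t * (m * p * P * Y) + t * (q * Φ)) ∎)
    where
    eq₁ : ∀ t q m P Φ p′ Y → t * (q * (p′ * Φ)) + (t * (m * suc p′ * P * Y) + t * (q * Φ)) ≡ suc p′ * (t * (q * Φ)) + t * (m * suc p′ * P * Y)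
    eq₁ = solve-∀
    eq₂ : ∀ t q m P Φ p′ c X Y → suc p′ * (t * (m * P * (X + Y)) + c * (m * P * q)) + (t * (q * Φ) + c * (m * suc p′ * P * q)) ≡
      t * (m * (suc p′ * P) * X) + 2 * c * (m * (suc p′ * P) * q) + (t * (m * suc p′ * P * Y) + t * (q * Φ))
    eq₂ = solve-∀

module Sieving (K : FiniteField) (F : Subfield K) (m : ℕ) (1≤m : 1 ≤ m)
  (card≡ : FiniteField.card K ≡ Subfield.size F ℕ.^ suc m) (θ : FiniteField.Carrier K) (gen : Generates K F θ)
  (α : FiniteField.Carrier K) (α≉0 : ¬ FiniteField._≈_ K α (FiniteField.0# K))
  (t : ℕ) (m+3≤t : 3 ℕ.+ m ≤ t) (t^≤q : t ℕ.^ (8 ℕ.* suc m) ≤ Subfield.size F) where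
  open FieldFacts K
  open SubfieldFacts F
  open Equidistribution K F m 1≤m card≡ θ gen α α≉0 t m+3≤t t^≤q
  open Orders K
  open Frobenius K F using (1<size)
  private
    q C : ℕ
    q = size
    C = 3 ℕ.* suc m ℕ.+ 2

  -- For d dividing Z: α(θ + x) lies in the subgroup of index d.
  InIndex : ℕ → Carrier → Set
  InIndex d x = line x ^ (Z ÷ d) ≈ 1#

  inIndex? : ∀ d → Decidable (InIndex d)
  inIndex? d x = (line x ^ (Z ÷ d)) ≟ 1#

  -- With d = r and all the primes dividing Z / r, these are the x for which the order is exactly Z
  -- / r. Other d occur because the recursion of `sieve` multiplies d by primes.
  Sifted : ℕ → List ℕ → Carrier → Set
  Sifted d ps x = InIndex d x × All (λ p → ¬ InIndex (d ℕ.* p) x) ps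

  sifted? : ∀ d ps → Decidable (Sifted d ps)
  sifted? d ps x = inIndex? d x ×-dec All.all? (λ p → ¬? (inIndex? (d ℕ.* p) x)) ps

  InIndex-≡ : ∀ {d e x} → 1 ≤ d → d ℕ.* e ≡ Z → InIndex d x ≡ (line x ^ e ≈ 1#)
  InIndex-≡ {x = x} 1≤d de≡ = ≡.cong (λ k → line x ^ k ≈ 1#) (÷-unique 1≤d de≡)

  coarsen : ∀ {d p x} → 1 ≤ d → 1 ≤ p → d ℕ.* p ∣ Z → InIndex (d ℕ.* p) x → InIndex d x
  coarsen {d} {p} {x} 1≤d 1≤p (divides w Z≡) h = ≡.subst id (≡.sym (InIndex-≡ 1≤d (≡.trans (eq d p w) (≡.sym Z≡))))
    (^-multiple p (≡.subst id (InIndex-≡ (ℕ.*-mono-≤ 1≤d 1≤p) (≡.trans (ℕ.*-comm (d ℕ.* p) w) (≡.sym Z≡))) h))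
    where
    eq : ∀ d p w → d ℕ.* (p ℕ.* w) ≡ w ℕ.* (d ℕ.* p)
    eq = solve-∀

  -- With Z = d p r w, the two hypotheses say that the w-th power u of α(θ + x) has u^r = 1 and u^p
  -- = 1; Bézout for the coprime p and r gives u = 1.
  intersect : ∀ {d p r x} → 1 ≤ d → 1 ≤ p → 1 ≤ r → Coprime p r → d ℕ.* p ℕ.* r ∣ Z →
    InIndex (d ℕ.* p) x → InIndex (d ℕ.* r) x → InIndex (d ℕ.* p ℕ.* r) x
  intersect {d} {p} {r} {x} 1≤d 1≤p 1≤r cop (divides w Z≡) hp hr =
    ≡.subst id (≡.sym (InIndex-≡ (ℕ.*-mono-≤ (ℕ.*-mono-≤ 1≤d 1≤p) 1≤r) (≡.trans (ℕ.*-comm (d ℕ.* p ℕ.* r) w) (≡.sym Z≡))))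
      (trans (^-congʳ (line x) (≡.sym (ℕ.*-identityʳ w))) (trans (sym (^-assocʳ (line x) w 1)) (^-identity (coprime-Bézout cop)
        (trans (^-assocʳ (line x) w p) (trans (^-congʳ (line x) (ℕ.*-comm w p)) (≡.subst id (InIndex-≡ (ℕ.*-mono-≤ 1≤d 1≤r) (≡.trans (eq₁ d p r w) (≡.sym Z≡))) hr)))
        (trans (^-assocʳ (line x) w r) (≡.subst id (InIndex-≡ (ℕ.*-mono-≤ 1≤d 1≤p) (≡.trans (eq₂ d p r w) (≡.sym Z≡))) hp)))))
    where
    eq₁ : ∀ d p r w → d ℕ.* r ℕ.* (p ℕ.* w) ≡ w ℕ.* (d ℕ.* p ℕ.* r)
    eq₁ = solve-∀
    eq₂ : ∀ d p r w → d ℕ.* p ℕ.* (w ℕ.* r) ≡ w ℕ.* (d ℕ.* p ℕ.* r)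
    eq₂ = solve-∀

  -- The x are split by membership in the subgroup of index d p. For the members, avoiding index d r
  -- is the same as avoiding index d p r, by `coarsen` and `intersect`.
  sift-step : ∀ {d p ps} → 1 ≤ d → 1 ≤ p → All (1 ≤_) ps → All (Coprime p) ps → d ℕ.* (p ℕ.* product ps) ∣ Z → ∀ xs →
    count (sifted? d ps) xs ≡ count (sifted? d (p ∷ ps)) xs ℕ.+ count (sifted? (d ℕ.* p) ps) xs
  sift-step {d} {p} {ps} 1≤d 1≤p 1≤ps cop dpP∣Z = count-⊎ (sifted? d ps) (sifted? d (p ∷ ps)) (sifted? (d ℕ.* p) ps)
    split (λ { (h , _ ∷ a) → h , a }) (λ (h , a) → coarsen 1≤d 1≤p dp∣Z h , refine h ps id 1≤ps cop a) (λ { (_ , ¬h ∷ _) (h , _) → ¬h h })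
    where
    dp∣Z : d ℕ.* p ∣ Z
    dp∣Z = ∣-trans (≡.subst (d ℕ.* p ∣_) (ℕ.*-assoc d p (product ps)) (m∣m*n (product ps))) dpP∣Z

    dpr∣Z : ∀ {r} → r ∈ˡ ps → d ℕ.* p ℕ.* r ∣ Z
    dpr∣Z {r} r∈ = ∣-trans (≡.subst (d ℕ.* p ℕ.* r ∣_) (ℕ.*-assoc d p (product ps)) (*-monoʳ-∣ (d ℕ.* p) (∈⇒∣product r∈))) dpP∣Z

    refine : ∀ {x} → InIndex (d ℕ.* p) x → ∀ rs → (∀ {r} → r ∈ˡ rs → r ∈ˡ ps) → All (1 ≤_) rs → All (Coprime p) rs →
      All (λ r → ¬ InIndex (d ℕ.* p ℕ.* r) x) rs → All (λ r → ¬ InIndex (d ℕ.* r) x) rs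
    refine h []       _   []       []       []       = []
    refine h (r ∷ rs) sub (l ∷ ls) (c ∷ cs) (a ∷ as) =
      (λ hr → a (intersect 1≤d 1≤p l c (dpr∣Z (sub (here ≡.refl))) h hr)) ∷ refine h rs (sub ∘ there) ls cs as

    split : ∀ {x} → Sifted d ps x → Sifted d (p ∷ ps) x ⊎ Sifted (d ℕ.* p) ps x
    split {x} (h , a) with inIndex? (d ℕ.* p) x
    ... | no ¬hp = inj₁ (h , ¬hp ∷ a)
    ... | yes hp = inj₂ (hp , All.zipWith (λ {r} ((r∈ , l) , ¬hr) hpr → ¬hr (coarsen-r l r∈ hpr)) (All.zip (All.tabulate id , 1≤ps) , a))
      where
      swap : ∀ d p r → d ℕ.* p ℕ.* r ≡ d ℕ.* r ℕ.* p
      swap = solve-∀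
      coarsen-r : ∀ {r} → 1 ≤ r → r ∈ˡ ps → InIndex (d ℕ.* p ℕ.* r) x → InIndex (d ℕ.* r) x
      coarsen-r {r} l r∈ hpr = coarsen (ℕ.*-mono-≤ 1≤d l) 1≤p (≡.subst (_∣ Z) (swap d p r) (dpr∣Z r∈)) (≡.subst (λ k → InIndex k x) (swap d p r) hpr)

  -- Divided by t d P, with P the product and φ its totient: the count differs from q φ / (d P) by
  -- at most 2^s C q / t. Induction replaces the sum over squarefree divisors; each prime doubles
  -- the error, since the estimates for d and for d p are both used.
  sieve : ∀ ps {d} → 1 ≤ d → All (1 ≤_) ps → AllPairs Coprime ps → d ℕ.* product ps ∣ Z →
    t ℕ.* (d ℕ.* product ps ℕ.* count (sifted? d ps) members) ≤ t ℕ.* (q ℕ.* totient ps) ℕ.+ 2 ℕ.^ length ps ℕ.* C ℕ.* (d ℕ.* product ps ℕ.* q) ×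
    t ℕ.* (q ℕ.* totient ps) ≤ t ℕ.* (d ℕ.* product ps ℕ.* count (sifted? d ps) members) ℕ.+ 2 ℕ.^ length ps ℕ.* C ℕ.* (d ℕ.* product ps ℕ.* q)
  sieve [] {d} 1≤d [] [] (divides e Z≡) =
    ≡.subst₂ _≤_ lhs (≡.cong₂ ℕ._+_ main (error d q C)) (proj₁ eqd) ,
    ≡.subst₂ _≤_ main (≡.cong₂ ℕ._+_ lhs (error d q C)) (proj₂ eqd)
    where
    de≡ : d ℕ.* e ≡ Z
    de≡ = ≡.trans (ℕ.*-comm d e) (≡.trans (≡.cong (e ℕ.*_) (≡.sym (ℕ.*-identityʳ d))) (≡.sym Z≡))
    eqd = equidistributed 1≤d de≡
    N = count (power? e 1#) members
    same : N ≡ count (sifted? d []) members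
    same = ≡.cong length (List.filter-≐ (power? e 1#) (sifted? d [])
      ((λ h → ≡.subst id (≡.sym (InIndex-≡ 1≤d de≡)) h , []) , λ (h , _) → ≡.subst id (InIndex-≡ 1≤d de≡) h) members)
    lhs : t ℕ.* (d ℕ.* N) ≡ t ℕ.* (d ℕ.* 1 ℕ.* count (sifted? d []) members)
    lhs = ≡.cong₂ (λ a b → t ℕ.* (a ℕ.* b)) (≡.sym (ℕ.*-identityʳ d)) same
    main : t ℕ.* q ≡ t ℕ.* (q ℕ.* 1)
    main = ≡.cong (t ℕ.*_) (≡.sym (ℕ.*-identityʳ q))
    error : ∀ d q C → C ℕ.* (d ℕ.* q) ≡ 1 ℕ.* C ℕ.* (d ℕ.* 1 ℕ.* q)
    error = solve-∀
  sieve (suc p′ ∷ ps) {d} 1≤d (1≤p ∷ 1≤ps) (c ∷ cs) dpP∣Z = 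
    ℕ.≤-trans (Step.upper (proj₁ ihA) (proj₂ ihY)) (ℕ.+-monoʳ-≤ (t ℕ.* (q ℕ.* totient (p ∷ ps))) error) ,
    ℕ.≤-trans (Step.lower (proj₂ ihA) (proj₁ ihY)) (ℕ.+-monoʳ-≤ (t ℕ.* (d ℕ.* (p ℕ.* P) ℕ.* count (sifted? d (p ∷ ps)) members)) error)
    where
    p = suc p′
    P = product ps
    s = 2 ℕ.^ length ps
    two : ∀ s C z → 2 ℕ.* (s ℕ.* C) ℕ.* z ≡ 2 ℕ.* s ℕ.* C ℕ.* z
    two = solve-∀
    error = ℕ.≤-reflexive (two s C (d ℕ.* (p ℕ.* P) ℕ.* q))
    ihA = sieve ps {d} 1≤d 1≤ps cs (∣-trans (*-monoʳ-∣ d (∣n⇒∣m*n p (divides 1 (≡.sym (ℕ.*-identityˡ P))))) dpP∣Z)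
    ihY = sieve ps {d ℕ.* p} (ℕ.*-mono-≤ 1≤d 1≤p) 1≤ps cs (≡.subst (_∣ Z) (≡.sym (ℕ.*-assoc d p P)) dpP∣Z)
    module Step = SieveStep t q d P (totient ps) p′ (s ℕ.* C) (count (sifted? d ps) members) (count (sifted? d (p ∷ ps)) members)
      (count (sifted? (d ℕ.* p) ps) members) (sift-step 1≤d 1≤p 1≤ps c dpP∣Z members)

  -- If no x survived, the lower bound of `sieve` at d = r would leave the main term below the error
  -- term, against the hypothesis. A survivor has order e by `order-from-primes`.
  primitive-on-line : ∀ {r e} → 1 ≤ r → r ℕ.* e ≡ Z →
    2 ℕ.^ length (primeDivisors e) ℕ.* (C ℕ.* (r ℕ.* product (primeDivisors e))) < t ℕ.* totient (primeDivisors e) →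
    Σ Carrier λ x → mem x × HasOrder (line x) e
  primitive-on-line {r} {e} 1≤r re≡ few = find (filter (sifted? r ps) members) ≡.refl (filter-mem (sifted? r ps)) (All.all-filter (sifted? r ps) members)
    where
    ps = primeDivisors e
    s = 2 ℕ.^ length ps
    sound = primeDivisors-sound e
    1≤e : 1 ≤ e
    1≤e with e ℕ.≟ 0
    ... | no e≢0  = ℕ.n≢0⇒n>0 e≢0
    ... | yes e≡0 = ⊥-elim (ℕ.<⇒≢ (ℕ.m<n⇒0<n∸m 1<card) (≡.trans (≡.sym (≡.trans (≡.cong (r ℕ.*_) e≡0) (ℕ.*-zeroʳ r))) re≡))

    rP∣Z : r ℕ.* product ps ∣ Z
    rP∣Z = ≡.subst (r ℕ.* product ps ∣_) re≡ (*-monoʳ-∣ r (product-∣ (primeDivisors-coprime e) (All.map proj₂ sound)))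

    empty : count (sifted? r ps) members ≡ 0 → ⊥
    empty N≡0 = ℕ.<⇒≱ few (ℕ.*-cancelʳ-≤ _ _ q {{>-nonZero (ℕ.<⇒≤ 1<size)}} (begin
      t ℕ.* totient ps ℕ.* q           ≡⟨ eq₁ t (totient ps) q ⟩
      t ℕ.* (q ℕ.* totient ps)         ≤⟨ proj₂ (sieve ps 1≤r (All.map ℕ.<⇒≤ (primes>1 sound)) (primeDivisors-coprime e) rP∣Z) ⟩
      t ℕ.* (r ℕ.* product ps ℕ.* count (sifted? r ps) members) ℕ.+ s ℕ.* C ℕ.* (r ℕ.* product ps ℕ.* q)
        ≡⟨ ≡.cong (λ N → t ℕ.* (r ℕ.* product ps ℕ.* N) ℕ.+ s ℕ.* C ℕ.* (r ℕ.* product ps ℕ.* q)) N≡0 ⟩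
      t ℕ.* (r ℕ.* product ps ℕ.* 0) ℕ.+ s ℕ.* C ℕ.* (r ℕ.* product ps ℕ.* q) ≡⟨ eq₂ t (r ℕ.* product ps) s C q ⟩
      s ℕ.* (C ℕ.* (r ℕ.* product ps)) ℕ.* q ∎))
      where
      open ℕ.≤-Reasoning
      eq₁ : ∀ t φ q → t ℕ.* φ ℕ.* q ≡ t ℕ.* (q ℕ.* φ)
      eq₁ = solve-∀
      eq₂ : ∀ t P s C q → t ℕ.* (P ℕ.* 0) ℕ.+ s ℕ.* C ℕ.* (P ℕ.* q) ≡ s ℕ.* (C ℕ.* P) ℕ.* q
      eq₂ = solve-∀

    find : ∀ xs → filter (sifted? r ps) members ≡ xs → All mem xs → All (Sifted r ps) xs → Σ Carrier λ x → mem x × HasOrder (line x) e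
    find []      none _        _             = ⊥-elim (empty (≡.cong length none))
    find (x ∷ _) _    (mx ∷ _) ((h , a) ∷ _) = x , mx , order-from-primes 1≤e (≡.subst id (InIndex-≡ 1≤r re≡) h)
      λ {p} {k} pr pk≡ v^k → All.lookup a (primeDivisors-complete 1≤e (pr , divides k (≡.trans (≡.sym pk≡) (ℕ.*-comm p k))))
        (≡.subst id (≡.sym (InIndex-≡ (ℕ.*-mono-≤ 1≤r (ℕ.<⇒≤ (prime>1 pr))) (≡.trans (ℕ.*-assoc r p k) (≡.trans (≡.cong (r ℕ.*_) pk≡) re≡)))) v^k)

-- The line property and the translate property

open import Data.Nat using (_^_; _∸_)
open import Defs using (size; card)



-- Taking t to be the integer 8n-th root of q gives both t^(8n) ≤ q, for the estimates, and q < (t +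
-- 1)^(8n), by which L < q forces T₀ < t.
line-property : ∀ n → (2≤n : 2 ≤ n) → ∀ r → (r≥1 : 1 ≤ r) → (K : FiniteField) (F : Subfield K) →
  Threshold.L n r (ℕ.<⇒≤ 2≤n) r≥1 < size F → card K ≡ size F ^ n → r ∣ size F ^ n ∸ 1 → LineProperty K F r {{>-nonZero r≥1}}
line-property (suc m) (s≤s 1≤m) r 1≤r K F L<q card≡ (divides e Z≡) α α≉0 θ gen with root (8 ℕ.* suc m) (size F) (s≤s z≤n)
... | t , t^≤q , q<t^ = ≡.subst (λ e → Σ (FiniteField.Carrier K) λ x → Subfield.mem F x × FiniteField.HasOrder K (FiniteField._*_ K α (FiniteField._+_ K θ x)) e) (≡.sym quotient≡)
  (S.primitive-on-line 1≤r re≡ (few-primes e q<t^ P≤ T₀<t))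
  where
  open Threshold (suc m) r (s≤s z≤n) 1≤r
  T₀<t : T₀ < t
  T₀<t = above-threshold L<q q<t^
  -- The summand 2 + n of `T₀` supplies the condition 3 + m ≤ t.
  module S = Sieving K F m 1≤m card≡ θ gen α α≉0 t (ℕ.≤-trans (ℕ.m≤m+n (3 ℕ.+ m) _) (ℕ.<⇒≤ T₀<t)) t^≤q
  re≡ : r ℕ.* e ≡ card K ∸ 1
  re≡ = ≡.trans (ℕ.*-comm r e) (≡.trans (≡.sym Z≡) (≡.cong (_∸ 1) (≡.sym card≡)))
  quotient≡ : ((card K ∸ 1) / r) {{>-nonZero 1≤r}} ≡ e
  quotient≡ = ≡.trans (≡.cong (λ z → (z / r) {{>-nonZero 1≤r}}) (≡.trans (≡.sym re≡) (ℕ.*-comm r e))) (m*n/n≡m e r {{>-nonZero 1≤r}})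
  1≤Z : 0 < card K ∸ 1
  1≤Z = ℕ.m<n⇒0<n∸m (FieldFacts.1<card K)
  P≤ : product (primeDivisors e) ≤ size F ^ suc m
  P≤ = ℕ.≤-trans (∣⇒≤ {{>-nonZero (ℕ.<-≤-trans 1≤Z (ℕ.≤-reflexive (≡.sym re≡)))}} (∣n⇒∣m*n r (product-∣ (primeDivisors-coprime e) (All.map proj₂ (primeDivisors-sound e)))))
    (ℕ.≤-trans (ℕ.≤-reflexive re≡) (ℕ.≤-trans (ℕ.m∸n≤m (card K) 1) (ℕ.≤-reflexive card≡)))

translate-property : ∀ K F r .{{_ : ℕ.NonZero r}} → LineProperty K F r → TranslateProperty K F r
translate-property K F r property θ gen with property (FiniteField.1# K) (FiniteField.1≉0 K) θ gen
... | x , mx , order = x , mx , Orders.HasOrder-resp K (FiniteField.*-identityˡ K _) order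

theorem1p3 : ∀ (n : ℕ) → 2 ≤ n → ∀ (r : ℕ) → (r≥1 : 1 ≤ r) →
    Σ ℕ λ L → Σ ℕ λ T → T ≤ L ×
    (∀ (K : FiniteField) (F : Subfield K) →
    L < size F → card K ≡ size F ^ n → r ∣ size F ^ n ∸ 1 →
    LineProperty K F r {{>-nonZero r≥1}}) ×
    (∀ (K : FiniteField) (F : Subfield K) →
    T < size F → card K ≡ size F ^ n → r ∣ size F ^ n ∸ 1 →
    TranslateProperty K F r {{>-nonZero r≥1}})
-- The set of translates is the line with α = 1, so the same number serves as both thresholds.
theorem1p3 n 2≤n r r≥1 = Threshold.L n r (ℕ.<⇒≤ 2≤n) r≥1 , Threshold.L n r (ℕ.<⇒≤ 2≤n) r≥1 , ℕ.≤-refl , line-property n 2≤n r r≥1 ,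
  λ K F T<q card≡ r∣Z → translate-property K F r {{>-nonZero r≥1}} (line-property n 2≤n r r≥1 K F T<q card≡ r∣Z)
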